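{- Let $\mathbb{F}$ be a field. The polynomial $p(\mathbf{x})=(x_{11}+\cdots+x_{17})(x_{21}+\cdots+x_{27})+(x_{31}+\cdots+x_{37})(x_{41}+\cdots+x_{47})$ is computable by a width-2 general ABP over $\mathbb{F}$, but is not computable by any width-2 weak ABP over $\mathbb{F}$.
   Context: An algebraic branching program (ABP) over $\mathbb{F}$ is a DAG with source $s$ and sink $t$, vertices assigned to layers, edges going from layer $i$ to layer $i+1$ and labelled by affine linear forms; width = max layer size, value = sum over $s$-$t$ paths of the products of edge labels. A weak ABP has edge labels of the form $\alpha x_i+\beta$ with $\alpha,\beta\in\mathbb{F}$ (a single variable); a general ABP allows arbitrary affine linear forms $\sum_i\alpha_ix_i+\beta$. -}

module Defs where

open import Level using (Level; _⊔_; suc)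
open import Algebra.Bundles using (CommutativeRing)
open import Data.Nat as ℕ using (ℕ; _≤_)
open import Data.Fin as Fin using (Fin; combine)
open import Data.Vec as Vec using (Vec; replicate; zipWith; updateAt)
open import Data.Vec.Properties using (≡-dec)
open import Data.List as List using (List; []; _∷_; _++_; concatMap; map; foldr)
open import Data.Product using (_×_; _,_; Σ; ∃-syntax)
open import Relation.Nullary using (¬_; yes; no)

record Field (c ℓ : Level) : Set (Level.suc (c ⊔ ℓ)) where
  field
    commutativeRing : CommutativeRing c ℓ
  open CommutativeRing commutativeRing public
  field
    1≉0     : ¬ (1# ≈ 0#)
    inverse : ∀ x → ¬ (x ≈ 0#) → Σ Carrier (λ y → x * y ≈ 1#)

-- Polynomials in n variables over a field F, as formal finite sums of
-- terms (coefficient , exponent vector); two polynomials are equal when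
-- every monomial has the same total coefficient.

module Polynomials {c ℓ} (F : Field c ℓ) where
  private module F = Field F

  Monomial : ℕ → Set
  Monomial n = Vec ℕ n

  Poly : ℕ → Set c
  Poly n = List (F.Carrier × Monomial n)

  module _ {n : ℕ} where
    0ₚ : Poly n
    0ₚ = []

    constₚ : F.Carrier → Poly n
    constₚ a = (a , replicate n 0) ∷ []

    1ₚ : Poly n
    1ₚ = constₚ F.1#

    var : Fin n → Poly n
    var i = (F.1# , updateAt (replicate n 0) i ℕ.suc) ∷ []

    infixl 6 _+ₚ_
    infixl 7 _*ₚ_ _·ₚ_

    _+ₚ_ : Poly n → Poly n → Poly n
    p +ₚ q = p ++ q

    _*ₚ_ : Poly n → Poly n → Poly n
    p *ₚ q = concatMap (λ { (a , m) → map (λ { (b , m′) → (a F.* b , zipWith ℕ._+_ m m′) }) q }) p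

    _·ₚ_ : F.Carrier → Poly n → Poly n
    a ·ₚ p = constₚ a *ₚ p

    coeff : Poly n → Monomial n → F.Carrier
    coeff [] m = F.0#
    coeff ((a , m′) ∷ p) m with ≡-dec ℕ._≟_ m′ m
    ... | yes _ = a F.+ coeff p m
    ... | no _  = coeff p m

    infix 4 _≈ₚ_
    _≈ₚ_ : Poly n → Poly n → Set ℓ
    p ≈ₚ q = ∀ m → coeff p m F.≈ coeff q m

    Σₚ : ∀ {k} → (Fin k → Poly n) → Poly n
    Σₚ {k} f = foldr _+ₚ_ 0ₚ (List.map f (List.allFin k))

-- Layered algebraic branching programs.
-- 'Layers A m' describes the part of an ABP starting at a layer with m
-- vertices: either that layer is the sink layer {t} (m = 1), or there is
-- a next layer with k vertices and an edge labelling E v w ∈ A between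
-- vertex v of the current layer and vertex w of the next layer (a label
-- that evaluates to 0 is the same as having no edge).  An ABP is a
-- 'Layers A 1': the first layer is {s}.

data Layers {a} (A : Set a) : ℕ → Set a where
  sinkLayer : Layers A 1
  nextLayer : ∀ {m} (k : ℕ) → (Fin m → Fin k → A) → Layers A k → Layers A m

ABP : ∀ {a} → Set a → Set a
ABP A = Layers A 1

data LayersWidth≤ {a} {A : Set a} (w : ℕ) : ∀ {m} → Layers A m → Set a where
  sinkLayer : 1 ≤ w → LayersWidth≤ w sinkLayer
  nextLayer : ∀ {m k E L} → m ≤ w → LayersWidth≤ w L → LayersWidth≤ w (nextLayer {m = m} k E L)

module ABPs {c ℓ} (F : Field c ℓ) where
  open Polynomials F
  private module F = Field F

  AffineForm : ℕ → Set c
  AffineForm n = Vec F.Carrier n × F.Carrier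

  ⟦_⟧ᵃ : ∀ {n} → AffineForm n → Poly n
  ⟦ αs , β ⟧ᵃ = Σₚ (λ i → Vec.lookup αs i ·ₚ var i) +ₚ constₚ β

  WeakForm : ℕ → Set c
  WeakForm n = Fin n × F.Carrier × F.Carrier

  ⟦_⟧ʷ : ∀ {n} → WeakForm n → Poly n
  ⟦ i , α , β ⟧ʷ = α ·ₚ var i +ₚ constₚ β

  pathSum : ∀ {n a} {A : Set a} → (A → Poly n) → ∀ {m} → Layers A m → Fin m → Poly n
  pathSum ⟦_⟧ sinkLayer v = 1ₚ
  pathSum ⟦_⟧ (nextLayer k E L) v = Σₚ (λ w → ⟦ E v w ⟧ *ₚ pathSum ⟦_⟧ L w)

  value : ∀ {n a} {A : Set a} → (A → Poly n) → ABP A → Poly n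
  value ⟦_⟧ P = pathSum ⟦_⟧ P Fin.zero

  GeneralABPWidth : ℕ → (n : ℕ) → Poly n → Set (c ⊔ ℓ)
  GeneralABPWidth w n p =
    Σ (ABP (AffineForm n)) (λ P → LayersWidth≤ w P × (value ⟦_⟧ᵃ P ≈ₚ p))

  WeakABPWidth : ℕ → (n : ℕ) → Poly n → Set (c ⊔ ℓ)
  WeakABPWidth w n p =
    Σ (ABP (WeakForm n)) (λ P → LayersWidth≤ w P × (value ⟦_⟧ʷ P ≈ₚ p))

module Theorem5p4Poly {c ℓ} (F : Field c ℓ) where
  open Polynomials F

  x : Fin 4 → Fin 7 → Poly 28
  x i j = var (combine i j)

  rowSum : Fin 4 → Poly 28
  rowSum i = Σₚ (λ j → x i j)

  p : Poly 28
  p = rowSum (Fin.# 0) *ₚ rowSum (Fin.# 1) +ₚ rowSum (Fin.# 2) *ₚ rowSum (Fin.# 3)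

{-# OPTIONS --safe #-}
module Submission where

-- A program with two vertices per layer is a product of 2 × 2 matrices.  A weak matrix (one variable per
-- entry) is either a shear [a ; x a + b] up to a constant change of rows, with a and b independent
-- constant vectors, or its determinant can be made to vanish, with constant column space, by assigning
-- at most two variables, possibly in a quadratic extension of the field.  A product of shears is a
-- matrix of continuants, whose quadratic members are of the form f g + γ with f, g affine and γ
-- constant, and p is not of that form.  If a matrix degenerates, then the restriction of p is a product
-- of what comes before and what comes after that matrix; being irreducible, p is already computed up to
-- a constant by one of the two.  Going from left to right, either the part after the matrix takes over,
-- with at most the four variables of that matrix assigned, or p is, up to a constant, a product of
-- shears, with at most 4 + 2 variables assigned.  Each of the four sums of p has seven variables, so
-- the restricted p is still irreducible and not of the form f g + γ.  Equality in the field is not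
-- decidable, but as the goal is a negation, case distinctions are available under double negation.

-- The obstacle is that assignments would pile up along the program if they were kept. They do not,
-- because the program computes the restricted target under every assignment: when a matrix
-- degenerates, all values given to variables outside that matrix are forgotten before
-- irreducibility is applied. If the part before the matrix is then constant, the scan restarts
-- behind the matrix with a fresh constant vector. If the part after it is constant, the shears
-- gathered since the last restart are all that is left, and only here do the values from the last
-- restart and the new ones count together. Six values never exhaust a row of seven variables, which
-- explains the size of `p`. The quadratic extension comes from a single situation: two rows in the
-- same variable, whose determinant has degree at most two in it. Since the field may grow at each
-- such matrix, the induction quantifies over all fields and transports polynomials along
-- embeddings.

open import Defs
open import Level using (Level; _⊔_)
open import Algebra.Bundles using (CommutativeRing; RawRing)
import Algebra.Solver.Ring
import Algebra.Solver.Ring.AlmostCommutativeRing as ACR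
open import Data.Bool using (if_then_else_)
open import Data.Empty using (⊥; ⊥-elim)
open import Data.Fin as Fin using (Fin; zero; suc; combine; _↑ˡ_; _↑ʳ_)
open import Data.Fin.Patterns using (0F; 1F; 2F; 3F)
import Data.Fin.Properties as Fin
open import Data.List as List using (List; []; _∷_; _++_; [_]; length)
import Data.List.Membership.DecPropositional as DecMembership
open import Data.List.Membership.Propositional using (_∈_)
import Data.List.Membership.Propositional.Properties as ∈
import Data.List.Properties as List
open import Data.List.Relation.Unary.All as All using (All; []; _∷_)
import Data.List.Relation.Unary.All.Properties as All
open import Data.List.Relation.Unary.Any as Any using (here; there)
import Data.List.Relation.Unary.Any.Properties as Any
open import Data.Maybe as Maybe using (Maybe; just; nothing; maybe)
open import Data.Nat as ℕ using (ℕ; zero; suc; _≤_; _<_; z≤n; s≤s)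
import Data.Nat.Properties as ℕ
open import Data.Product using (_×_; _,_; proj₁; proj₂; Σ; Σ-syntax)
open import Data.Sum using (_⊎_; inj₁; inj₂; map₁)
open import Data.Vec as Vec using (Vec; []; _∷_; replicate; zipWith; updateAt)
import Data.Vec.Properties as Vec
import Data.Vec.Relation.Binary.Lex.Strict as Lex
open import Data.Vec.Relation.Binary.Pointwise.Inductive using (Pointwise-≡⇒≡; ≡⇒Pointwise-≡)
open import Function using (_∘_)
open import Relation.Binary using (StrictTotalOrder; tri<; tri≈; tri>)
import Relation.Binary.PropositionalEquality as ≡
open ≡ using (_≡_)
open import Relation.Nullary using (Dec; ¬_; yes; no; does)
open import Relation.Nullary.Decidable using (¬¬-excluded-middle)

-- Ring solving with integer coefficients, and ring homomorphisms.

-- The library's ring solvers for an abstract ring cannot cancel x - x, since equality of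
-- coefficients in the ring is not decidable.  Here the coefficients are integers, as formal differences.
module IntegerRingSolver {c ℓ} (R : CommutativeRing c ℓ) where
  open CommutativeRing R hiding (zero)
  open import Algebra.Properties.Ring ring using (-‿distribˡ-*; -‿distribʳ-*)
  open import Algebra.Properties.AbelianGroup +-abelianGroup using (⁻¹-∙-comm; ⁻¹-involutive; ε⁻¹≈ε)
  open import Algebra.Properties.CommutativeSemigroup +-commutativeSemigroup using (interchange)
  open import Algebra.Properties.Semiring.Mult semiring using (×-homo-+; ×1-homo-*) renaming (_×_ to _·_)
  open import Relation.Binary.Reasoning.Setoid setoid

  private
    ⟦_⟧ᶜ : ℕ × ℕ → Carrier
    ⟦ a , b ⟧ᶜ = a · 1# - b · 1#

    -- Agrees with ⟦_⟧ᶜ, but makes the constants 0 and 1 definitionally 0# and 1#.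
    ⟦_⟧ᵒ : ℕ × ℕ → Carrier
    ⟦ 0 , 0 ⟧ᵒ = 0#
    ⟦ 1 , 0 ⟧ᵒ = 1#
    ⟦ x ⟧ᵒ     = ⟦ x ⟧ᶜ

    ᵒ≈ᶜ : ∀ x → ⟦ x ⟧ᵒ ≈ ⟦ x ⟧ᶜ
    ᵒ≈ᶜ (0 , 0)           = sym (-‿inverseʳ _)
    ᵒ≈ᶜ (1 , 0)           = sym (trans (+-congˡ ε⁻¹≈ε) (trans (+-identityʳ _) (+-identityʳ _)))
    ᵒ≈ᶜ (0 , suc _)       = refl
    ᵒ≈ᶜ (1 , suc _)       = refl
    ᵒ≈ᶜ (suc (suc _) , _) = refl

    coefficients : RawRing _ _
    coefficients = record
      { Carrier = ℕ × ℕ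
      ; _≈_ = _≡_
      ; _+_ = λ { (a , b) (c , d) → (a ℕ.+ c , b ℕ.+ d) }
      ; _*_ = λ { (a , b) (c , d) → (a ℕ.* c ℕ.+ b ℕ.* d , a ℕ.* d ℕ.+ b ℕ.* c) }
      ; -_ = λ { (a , b) → (b , a) }
      ; 0# = (0 , 0)
      ; 1# = (1 , 0)
      }

    +-homoᶜ : ∀ x y → ⟦ RawRing._+_ coefficients x y ⟧ᶜ ≈ ⟦ x ⟧ᶜ + ⟦ y ⟧ᶜ
    +-homoᶜ (a , b) (c , d) = begin
      (a ℕ.+ c) · 1# - (b ℕ.+ d) · 1#               ≈⟨ +-cong (×-homo-+ 1# a c) (-‿cong (×-homo-+ 1# b d)) ⟩
      (a · 1# + c · 1#) - (b · 1# + d · 1#)         ≈⟨ +-congˡ (⁻¹-∙-comm _ _) ⟨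
      (a · 1# + c · 1#) + (- (b · 1#) - d · 1#)     ≈⟨ interchange _ _ _ _ ⟩
      ⟦ a , b ⟧ᶜ + ⟦ c , d ⟧ᶜ                       ∎

    difference-* : ∀ x y z w → (x * z + y * w) - (x * w + y * z) ≈ (x - y) * (z - w)
    difference-* x y z w = sym (begin
      (x - y) * (z - w)                                   ≈⟨ distribʳ _ _ _ ⟩
      x * (z - w) + - y * (z - w)                         ≈⟨ +-cong (distribˡ _ _ _) (distribˡ _ _ _) ⟩
      (x * z + x * - w) + (- y * z + - y * - w)           ≈⟨ +-cong (+-congˡ (sym (-‿distribʳ-* _ _)))
                                                               (+-cong (sym (-‿distribˡ-* _ _)) neg-*-neg) ⟩
      (x * z + - (x * w)) + (- (y * z) + y * w)           ≈⟨ +-congˡ (+-comm _ _) ⟩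
      (x * z + - (x * w)) + (y * w + - (y * z))           ≈⟨ interchange _ _ _ _ ⟩
      (x * z + y * w) + (- (x * w) + - (y * z))           ≈⟨ +-congˡ (⁻¹-∙-comm _ _) ⟩
      (x * z + y * w) - (x * w + y * z)                   ∎)
      where
      neg-*-neg : - y * - w ≈ y * w
      neg-*-neg = trans (sym (-‿distribˡ-* _ _)) (trans (-‿cong (sym (-‿distribʳ-* _ _))) (⁻¹-involutive _))

    *-homoᶜ : ∀ x y → ⟦ RawRing._*_ coefficients x y ⟧ᶜ ≈ ⟦ x ⟧ᶜ * ⟦ y ⟧ᶜ
    *-homoᶜ (a , b) (c , d) = trans (+-cong (expand a c b d) (-‿cong (expand a d b c))) (difference-* _ _ _ _)
      where
      expand : ∀ i j k l → (i ℕ.* j ℕ.+ k ℕ.* l) · 1# ≈ (i · 1#) * (j · 1#) + (k · 1#) * (l · 1#)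
      expand i j k l = trans (×-homo-+ 1# (i ℕ.* j) (k ℕ.* l)) (+-cong (×1-homo-* i j) (×1-homo-* k l))

    -‿homoᶜ : ∀ x → ⟦ RawRing.-_ coefficients x ⟧ᶜ ≈ - ⟦ x ⟧ᶜ
    -‿homoᶜ (a , b) = trans (+-comm _ _) (trans (+-congˡ (sym (⁻¹-involutive _))) (⁻¹-∙-comm _ _))

    morphism : coefficients ACR.-Raw-AlmostCommutative⟶ ACR.fromCommutativeRing R
    morphism = record
      { ⟦_⟧    = ⟦_⟧ᵒ
      ; +-homo = λ x y → trans (ᵒ≈ᶜ (RawRing._+_ coefficients x y)) (trans (+-homoᶜ x y) (sym (+-cong (ᵒ≈ᶜ x) (ᵒ≈ᶜ y))))
      ; *-homo = λ x y → trans (ᵒ≈ᶜ (RawRing._*_ coefficients x y)) (trans (*-homoᶜ x y) (sym (*-cong (ᵒ≈ᶜ x) (ᵒ≈ᶜ y))))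
      ; -‿homo = λ x → trans (ᵒ≈ᶜ (RawRing.-_ coefficients x)) (trans (-‿homoᶜ x) (-‿cong (sym (ᵒ≈ᶜ x))))
      ; 0-homo = refl
      ; 1-homo = refl
      }

    -- Two formal differences are the same integer when their cross sums agree. This is decidable in
    -- the naturals and sound in every ring, so it supplies a zero test without one for `R`.
    difference-≟ : ∀ x y → Maybe (⟦ x ⟧ᵒ ≈ ⟦ y ⟧ᵒ)
    difference-≟ (a , b) (c , d) with a ℕ.+ d ℕ.≟ c ℕ.+ b
    ... | no _ = nothing
    ... | yes eq = just (begin
      ⟦ a , b ⟧ᵒ                               ≈⟨ ᵒ≈ᶜ (a , b) ⟩
      a · 1# - b · 1#                          ≈⟨ shift (a · 1#) (d · 1#) (b · 1#) ⟩
      (a · 1# + d · 1#) - (b · 1# + d · 1#)    ≈⟨ +-congʳ (trans (sym (×-homo-+ 1# a d))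
                                                    (trans (reflexive (≡.cong (_· 1#) eq)) (×-homo-+ 1# c b))) ⟩
      (c · 1# + b · 1#) - (b · 1# + d · 1#)    ≈⟨ +-congˡ (-‿cong (+-comm _ _)) ⟩
      (c · 1# + b · 1#) - (d · 1# + b · 1#)    ≈⟨ shift (c · 1#) (b · 1#) (d · 1#) ⟨
      c · 1# - d · 1#                          ≈⟨ ᵒ≈ᶜ (c , d) ⟨
      ⟦ c , d ⟧ᵒ                               ∎)
      where
      shift : ∀ x y z → x - z ≈ (x + y) - (z + y)
      shift x y z = sym (begin
        (x + y) - (z + y)       ≈⟨ +-congˡ (⁻¹-∙-comm _ _) ⟨
        (x + y) + (- z - y)     ≈⟨ interchange _ _ _ _ ⟩
        (x - z) + (y - y)       ≈⟨ +-congˡ (-‿inverseʳ _) ⟩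
        (x - z) + 0#            ≈⟨ +-identityʳ _ ⟩
        x - z                   ∎)

  open Algebra.Solver.Ring coefficients (ACR.fromCommutativeRing R) morphism difference-≟ public
    using (solve; _:=_; _:+_; _:*_; :-_; _:-_; con)

record Hom {a b c d} (R : CommutativeRing a b) (S : CommutativeRing c d) : Set (a ⊔ b ⊔ c ⊔ d) where
  private
    module R = CommutativeRing R
    module S = CommutativeRing S
  field
    fun    : R.Carrier → S.Carrier
    cong   : ∀ {x y} → x R.≈ y → fun x S.≈ fun y
    +-homo : ∀ x y → fun (x R.+ y) S.≈ fun x S.+ fun y
    *-homo : ∀ x y → fun (x R.* y) S.≈ fun x S.* fun y
    0-homo : fun R.0# S.≈ S.0#
    1-homo : fun R.1# S.≈ S.1#

  -‿homo : ∀ x → fun (R.- x) S.≈ S.- fun x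
  -‿homo x = begin
    fun (R.- x)                                 ≈⟨ solve 2 (λ y z → y := (y :+ z) :- z) S.refl _ _ ⟩
    (fun (R.- x) S.+ fun x) S.- fun x           ≈⟨ S.+-congʳ (S.sym (+-homo _ _)) ⟩
    fun (R.- x R.+ x) S.- fun x                 ≈⟨ S.+-congʳ (S.trans (cong (R.-‿inverseˡ x)) 0-homo) ⟩
    S.0# S.- fun x                              ≈⟨ S.+-identityˡ _ ⟩
    S.- fun x                                   ∎
    where
    open IntegerRingSolver S
    open import Relation.Binary.Reasoning.Setoid S.setoid

idʰ : ∀ {a b} (R : CommutativeRing a b) → Hom R R
idʰ R = record
  { fun = λ x → x ; cong = λ eq → eq ; +-homo = λ _ _ → refl ; *-homo = λ _ _ → refl
  ; 0-homo = refl ; 1-homo = refl }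
  where open CommutativeRing R

infixr 9 _∘ʰ_
_∘ʰ_ : ∀ {a b c d e f} {R : CommutativeRing a b} {S : CommutativeRing c d} {T : CommutativeRing e f} →
       Hom S T → Hom R S → Hom R T
_∘ʰ_ {T = T} g f = record
  { fun    = G.fun ∘ F.fun
  ; cong   = G.cong ∘ F.cong
  ; +-homo = λ x y → trans (G.cong (F.+-homo x y)) (G.+-homo _ _)
  ; *-homo = λ x y → trans (G.cong (F.*-homo x y)) (G.*-homo _ _)
  ; 0-homo = trans (G.cong F.0-homo) G.0-homo
  ; 1-homo = trans (G.cong F.1-homo) G.1-homo
  }
  where
  module F = Hom f
  module G = Hom g
  open CommutativeRing T using (trans)

-- Polynomials as a commutative ring, by way of pairings.

infixl 6 _⊕_
_⊕_ : ∀ {n} → Vec ℕ n → Vec ℕ n → Vec ℕ n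
_⊕_ = zipWith ℕ._+_

𝟎 : ∀ {n} → Vec ℕ n
𝟎 = replicate _ 0

unit : ∀ {n} → Fin n → Vec ℕ n
unit i = updateAt 𝟎 i suc

_≟ᵐ_ : ∀ {n} (m m′ : Vec ℕ n) → Dec (m ≡ m′)
_≟ᵐ_ = Vec.≡-dec ℕ._≟_

module Negation {c ℓ} (K : Field c ℓ) {n : ℕ} where
  open Field K
  open Polynomials K

  -ₚ_ : Poly n → Poly n
  -ₚ p = List.map (λ { (a , m) → (- a , m) }) p

-- A polynomial p is paired with a function h on monomials to Σ ι(a) h(m), the sum ranging over the
-- terms a m of p.  Coefficients, products and evaluations of polynomials are such pairings.
module Pairing {c ℓ a b} (K : Field c ℓ) (A : CommutativeRing a b)
               (ι : Hom (Field.commutativeRing K) A) (n : ℕ) where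
  private module K = Field K
  open CommutativeRing A hiding (zero)
  open Hom ι renaming (fun to i; cong to i-cong)
  open Polynomials K
  open Negation K
  open IntegerRingSolver A
  open import Relation.Binary.Reasoning.Setoid setoid

  ⟪_,_⟫ : Poly n → (Monomial n → Carrier) → Carrier
  ⟪ [] , h ⟫          = 0#
  ⟪ (a , m) ∷ p , h ⟫ = i a * h m + ⟪ p , h ⟫

  pair-congʳ : ∀ p {h h′} → (∀ m → h m ≈ h′ m) → ⟪ p , h ⟫ ≈ ⟪ p , h′ ⟫
  pair-congʳ []            eq = refl
  pair-congʳ ((a , m) ∷ p) eq = +-cong (*-congˡ (eq m)) (pair-congʳ p eq)

  pair-0 : ∀ p → ⟪ p , (λ _ → 0#) ⟫ ≈ 0#
  pair-0 []      = refl
  pair-0 (_ ∷ p) = trans (+-cong (zeroʳ _) (pair-0 p)) (+-identityˡ _)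

  pair-+ : ∀ p h h′ → ⟪ p , (λ m → h m + h′ m) ⟫ ≈ ⟪ p , h ⟫ + ⟪ p , h′ ⟫
  pair-+ []            h h′ = sym (+-identityˡ _)
  pair-+ ((a , m) ∷ p) h h′ = trans (+-congˡ (pair-+ p h h′))
    (solve 5 (λ k x y u v → k :* (x :+ y) :+ (u :+ v) := (k :* x :+ u) :+ (k :* y :+ v)) refl _ _ _ _ _)

  pair-*ˡ : ∀ p k h → ⟪ p , (λ m → k * h m) ⟫ ≈ k * ⟪ p , h ⟫
  pair-*ˡ []            k h = sym (zeroʳ _)
  pair-*ˡ ((a , m) ∷ p) k h = trans (+-congˡ (pair-*ˡ p k h))
    (solve 4 (λ x k y u → x :* (k :* y) :+ k :* u := k :* (x :* y :+ u)) refl _ _ _ _)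

  pair-swap : ∀ p q (h : Monomial n → Monomial n → Carrier) →
              ⟪ p , (λ m → ⟪ q , h m ⟫) ⟫ ≈ ⟪ q , (λ m′ → ⟪ p , (λ m → h m m′) ⟫) ⟫
  pair-swap []            q h = sym (pair-0 q)
  pair-swap ((a , m) ∷ p) q h = begin
    i a * ⟪ q , h m ⟫ + ⟪ p , (λ m → ⟪ q , h m ⟫) ⟫                           ≈⟨ +-cong (sym (pair-*ˡ q _ _)) (pair-swap p q h) ⟩
    ⟪ q , (λ m′ → i a * h m m′) ⟫ + ⟪ q , (λ m′ → ⟪ p , (λ m → h m m′) ⟫) ⟫   ≈⟨ pair-+ q _ _ ⟨
    ⟪ q , (λ m′ → i a * h m m′ + ⟪ p , (λ m → h m m′) ⟫) ⟫                    ∎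

  pair-++ : ∀ p q h → ⟪ p ++ q , h ⟫ ≈ ⟪ p , h ⟫ + ⟪ q , h ⟫
  pair-++ []      q h = sym (+-identityˡ _)
  pair-++ (_ ∷ p) q h = trans (+-congˡ (pair-++ p q h)) (sym (+-assoc _ _ _))

  pair-neg : ∀ p h → ⟪ -ₚ p , h ⟫ ≈ - ⟪ p , h ⟫
  pair-neg []            h = solve 0 (con (0 , 0) := :- con (0 , 0)) refl
  pair-neg ((a , m) ∷ p) h = trans (+-cong (*-congʳ (-‿homo a)) (pair-neg p h))
    (solve 3 (λ x y u → :- x :* y :+ :- u := :- (x :* y :+ u)) refl _ _ _)

  private
    pair-term-* : ∀ a m (q : Poly n) h → ⟪ ((a , m) ∷ []) *ₚ q , h ⟫ ≈ i a * ⟪ q , (λ m′ → h (m ⊕ m′)) ⟫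
    pair-term-* a m []             h = sym (zeroʳ _)
    pair-term-* a m ((b , m′) ∷ q) h = trans (+-cong (*-congʳ (*-homo a b)) (pair-term-* a m q h))
      (solve 4 (λ x y z u → (x :* y) :* z :+ x :* u := x :* (y :* z :+ u)) refl _ _ _ _)

    split-* : ∀ a m (p q : Poly n) → ((a , m) ∷ p) *ₚ q ≡ ((a , m) ∷ []) *ₚ q ++ p *ₚ q
    split-* a m p q = ≡.cong (_++ p *ₚ q) (≡.sym (List.++-identityʳ _))

  -- The product is a convolution over the monoid of exponent vectors. In this form commutativity
  -- and associativity of polynomials reduce to `pair-swap` and to the laws of `_⊕_`.
  pair-* : ∀ p q h → ⟪ p *ₚ q , h ⟫ ≈ ⟪ p , (λ m → ⟪ q , (λ m′ → h (m ⊕ m′)) ⟫) ⟫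
  pair-* []            q h = refl
  pair-* ((a , m) ∷ p) q h = begin
    ⟪ ((a , m) ∷ p) *ₚ q , h ⟫                             ≡⟨ ≡.cong ⟪_, h ⟫ (split-* a m p q) ⟩
    ⟪ ((a , m) ∷ []) *ₚ q ++ p *ₚ q , h ⟫                  ≈⟨ pair-++ (((a , m) ∷ []) *ₚ q) (p *ₚ q) h ⟩
    ⟪ ((a , m) ∷ []) *ₚ q , h ⟫ + ⟪ p *ₚ q , h ⟫           ≈⟨ +-cong (pair-term-* a m q h) (pair-* p q h) ⟩
    i a * ⟪ q , (λ m′ → h (m ⊕ m′)) ⟫ + _                  ∎

  private
    remove : Monomial n → Poly n → Poly n
    remove m [] = []
    remove m ((a , m′) ∷ p) with m′ ≟ᵐ m
    ... | yes _ = remove m p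
    ... | no _  = (a , m′) ∷ remove m p

    length-remove : ∀ m p → length (remove m p) ≤ length p
    length-remove m [] = z≤n
    length-remove m ((a , m′) ∷ p) with m′ ≟ᵐ m
    ... | yes _ = ℕ.m≤n⇒m≤1+n (length-remove m p)
    ... | no _  = s≤s (length-remove m p)

    pair-remove : ∀ m p h → ⟪ p , h ⟫ ≈ i (coeff p m) * h m + ⟪ remove m p , h ⟫
    pair-remove m [] h = sym (trans (+-identityʳ _) (trans (*-congʳ 0-homo) (zeroˡ _)))
    pair-remove m ((a , m′) ∷ p) h with m′ ≟ᵐ m
    ... | yes ≡.refl = begin
      i a * h m + ⟪ p , h ⟫                                          ≈⟨ +-congˡ (pair-remove m p h) ⟩
      i a * h m + (i (coeff p m) * h m + ⟪ remove m p , h ⟫)         ≈⟨ solve 4 (λ x y z u → x :* z :+ (y :* z :+ u) := (x :+ y) :* z :+ u) refl _ _ _ _ ⟩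
      (i a + i (coeff p m)) * h m + ⟪ remove m p , h ⟫               ≈⟨ +-congʳ (*-congʳ (+-homo _ _)) ⟨
      i (a K.+ coeff p m) * h m + ⟪ remove m p , h ⟫                 ∎
    ... | no _ = trans (+-congˡ (pair-remove m p h))
      (solve 3 (λ x y z → x :+ (y :+ z) := y :+ (x :+ z)) refl _ _ _)

    coeff-remove : ∀ m p → coeff (remove m p) m K.≈ K.0#
    coeff-remove m [] = K.refl
    coeff-remove m ((a , m′) ∷ p) with m′ ≟ᵐ m
    ... | yes _ = coeff-remove m p
    ... | no m′≢m with m′ ≟ᵐ m
    ...   | yes m′≡m = ⊥-elim (m′≢m m′≡m)
    ...   | no _     = coeff-remove m p

    coeff-remove-≢ : ∀ m p m₁ → ¬ m ≡ m₁ → coeff (remove m p) m₁ K.≈ coeff p m₁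
    coeff-remove-≢ m [] m₁ m≢m₁ = K.refl
    coeff-remove-≢ m ((a , m′) ∷ p) m₁ m≢m₁ with m′ ≟ᵐ m
    coeff-remove-≢ m ((a , m′) ∷ p) m₁ m≢m₁ | yes ≡.refl with m′ ≟ᵐ m₁
    ... | yes m≡m₁ = ⊥-elim (m≢m₁ m≡m₁)
    ... | no _     = coeff-remove-≢ m p m₁ m≢m₁
    coeff-remove-≢ m ((a , m′) ∷ p) m₁ m≢m₁ | no _ with m′ ≟ᵐ m₁
    ... | yes _ = K.+-congˡ (coeff-remove-≢ m p m₁ m≢m₁)
    ... | no _  = coeff-remove-≢ m p m₁ m≢m₁

    -- Vanishing coefficients do not make the list empty, since terms may cancel. All terms with the
    -- exponent of the head are gathered into one coefficient, which is zero; what remains is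
    -- shorter but not a structural subterm, hence the bound `k`.
    pair-vanish : ∀ k p → length p ≤ k → (∀ m → coeff p m K.≈ K.0#) → ∀ h → ⟪ p , h ⟫ ≈ 0#
    pair-vanish k [] _ _ h = refl
    pair-vanish (suc k) p@((a , m) ∷ p′) (s≤s len) p≈0 h = begin
      ⟪ p , h ⟫                                     ≈⟨ pair-remove m p h ⟩
      i (coeff p m) * h m + ⟪ remove m p , h ⟫      ≈⟨ +-cong (*-congʳ (trans (i-cong (p≈0 m)) 0-homo))
                                                         (pair-vanish k (remove m p) shorter removed≈0 h) ⟩
      0# * h m + 0#                                 ≈⟨ trans (+-identityʳ _) (zeroˡ _) ⟩
      0#                                            ∎
      where
      shorter : length (remove m p) ≤ k
      shorter with m ≟ᵐ m
      ... | yes _  = ℕ.≤-trans (length-remove m p′) len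
      ... | no m≢m = ⊥-elim (m≢m ≡.refl)
      removed≈0 : ∀ m₁ → coeff (remove m p) m₁ K.≈ K.0#
      removed≈0 m₁ with m ≟ᵐ m₁
      ... | yes ≡.refl = coeff-remove m p
      ... | no m≢m₁    = K.trans (coeff-remove-≢ m p m₁ m≢m₁) (p≈0 m₁)

  vanish : ∀ p → (∀ m → coeff p m K.≈ K.0#) → ∀ h → ⟪ p , h ⟫ ≈ 0#
  vanish p = pair-vanish (length p) p ℕ.≤-refl

module PolynomialRing {c ℓ} (K : Field c ℓ) (n : ℕ) where
  private module K = Field K
  open Polynomials K
  open Negation K public
  open Pairing K K.commutativeRing (idʰ K.commutativeRing) n public
  open IntegerRingSolver K.commutativeRing
  open import Relation.Binary.Reasoning.Setoid K.setoid

  -- Unlike _≈ₚ_, whose unfolding hides its arguments from unification, this record determines them.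
  infix 4 _≋_
  record _≋_ (p q : Poly n) : Set ℓ where
    constructor coefficientwise
    field coefficients : p ≈ₚ q
  open _≋_ public

  δ : Monomial n → Monomial n → K.Carrier
  δ m m′ = if does (m′ ≟ᵐ m) then K.1# else K.0#

  coeff≈pair : ∀ p m → coeff p m K.≈ ⟪ p , δ m ⟫
  coeff≈pair [] m = K.refl
  coeff≈pair ((a , m′) ∷ p) m with m′ ≟ᵐ m
  ... | yes _ = K.+-cong (K.sym (K.*-identityʳ a)) (coeff≈pair p m)
  ... | no _  = K.trans (coeff≈pair p m) (K.sym (K.trans (K.+-congʳ (K.zeroʳ a)) (K.+-identityˡ _)))

  -- Pairing with `δ m` extracts the coefficient at `m`, so pairings separate polynomials. Most ring
  -- laws below are thereby proved in `K`, one pairing at a time.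
  pair-injective : ∀ {p q} → (∀ h → ⟪ p , h ⟫ K.≈ ⟪ q , h ⟫) → p ≋ q
  pair-injective {p} {q} eq = coefficientwise λ m → K.trans (coeff≈pair p m) (K.trans (eq (δ m)) (K.sym (coeff≈pair q m)))

  coeff-difference : ∀ p q m → coeff (p ++ -ₚ q) m K.≈ coeff p m K.- coeff q m
  coeff-difference p q m = begin
    coeff (p ++ -ₚ q) m                   ≈⟨ coeff≈pair (p ++ -ₚ q) m ⟩
    ⟪ p ++ -ₚ q , δ m ⟫                   ≈⟨ pair-++ p (-ₚ q) (δ m) ⟩
    ⟪ p , δ m ⟫ K.+ ⟪ -ₚ q , δ m ⟫        ≈⟨ K.+-congˡ (pair-neg q (δ m)) ⟩
    ⟪ p , δ m ⟫ K.- ⟪ q , δ m ⟫           ≈⟨ K.+-cong (coeff≈pair p m) (K.-‿cong (coeff≈pair q m)) ⟨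
    coeff p m K.- coeff q m               ∎

  module _ {a b} (A : CommutativeRing a b) (ι : Hom K.commutativeRing A) where
    private
      module A = CommutativeRing A
      module P = Pairing K A ι n
      module S = IntegerRingSolver A

    -- Apply `vanish` to the difference of `p` and `q`. As `A` is an arbitrary ring over `K`, this
    -- also makes substitution into other polynomial rings well defined.
    pair-congˡ : ∀ {p q} → p ≋ q → ∀ h → P.⟪ p , h ⟫ A.≈ P.⟪ q , h ⟫
    pair-congˡ {p} {q} p≈q h = A.trans (S.solve 2 (λ x y → x S.:= (x S.:+ S.:- y) S.:+ y) A.refl _ _)
      (A.trans (A.+-congʳ difference≈0) (A.+-identityˡ _))
      where
      difference≈0 : P.⟪ p , h ⟫ A.- P.⟪ q , h ⟫ A.≈ A.0#
      difference≈0 = A.trans (A.sym (A.trans (P.pair-++ p (-ₚ q) h) (A.+-congˡ (P.pair-neg q h))))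
        (P.vanish (p ++ -ₚ q) (λ m → K.trans (coeff-difference p q m)
          (K.trans (K.+-congʳ (coefficients p≈q m)) (K.-‿inverseʳ _))) h)

  private
    cong-pair : ∀ {p q} → p ≋ q → ∀ h → ⟪ p , h ⟫ K.≈ ⟪ q , h ⟫
    cong-pair = pair-congˡ K.commutativeRing (idʰ K.commutativeRing)

    ⊕-assoc : ∀ (m m′ m″ : Monomial n) → (m ⊕ m′) ⊕ m″ ≡ m ⊕ (m′ ⊕ m″)
    ⊕-assoc = Vec.zipWith-assoc ℕ.+-assoc

    ⊕-comm : ∀ (m m′ : Monomial n) → m ⊕ m′ ≡ m′ ⊕ m
    ⊕-comm = Vec.zipWith-comm ℕ.+-comm

    +-congₚ : ∀ {p p′ q q′} → p ≋ p′ → q ≋ q′ → p +ₚ q ≋ p′ +ₚ q′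
    +-congₚ {p} {p′} {q} {q′} p≈ q≈ = pair-injective λ h →
      K.trans (pair-++ p q h) (K.trans (K.+-cong (cong-pair p≈ h) (cong-pair q≈ h))
        (K.sym (pair-++ p′ q′ h)))

    +-assocₚ : ∀ p q r → (p +ₚ q) +ₚ r ≋ p +ₚ (q +ₚ r)
    +-assocₚ p q r = pair-injective λ h →
      K.trans (pair-++ (p ++ q) r h) (K.trans (K.+-congʳ (pair-++ p q h)) (K.trans (K.+-assoc _ _ _)
        (K.sym (K.trans (pair-++ p (q ++ r) h) (K.+-congˡ (pair-++ q r h))))))

    +-commₚ : ∀ p q → p +ₚ q ≋ q +ₚ p
    +-commₚ p q = pair-injective λ h →
      K.trans (pair-++ p q h) (K.trans (K.+-comm _ _) (K.sym (pair-++ q p h)))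

    +-identityʳₚ : ∀ p → p +ₚ 0ₚ ≋ p
    +-identityʳₚ p = pair-injective λ h → K.trans (pair-++ p [] h) (K.+-identityʳ _)

    +-inverseʳₚ : ∀ p → p +ₚ (-ₚ p) ≋ 0ₚ
    +-inverseʳₚ p = coefficientwise λ m → K.trans (coeff-difference p p m) (K.-‿inverseʳ _)

    -‿congₚ : ∀ {p q} → p ≋ q → -ₚ p ≋ -ₚ q
    -‿congₚ {p} {q} p≈q = pair-injective λ h →
      K.trans (pair-neg p h) (K.trans (K.-‿cong (cong-pair {p} {q} p≈q h)) (K.sym (pair-neg q h)))

    *-congₚ : ∀ {p p′ q q′} → p ≋ p′ → q ≋ q′ → p *ₚ q ≋ p′ *ₚ q′
    *-congₚ {p} {p′} {q} {q′} p≈ q≈ = pair-injective λ h → begin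
      ⟪ p *ₚ q , h ⟫                                        ≈⟨ pair-* p q h ⟩
      ⟪ p , (λ m → ⟪ q , (λ m′ → h (m ⊕ m′)) ⟫) ⟫           ≈⟨ cong-pair p≈ _ ⟩
      ⟪ p′ , (λ m → ⟪ q , (λ m′ → h (m ⊕ m′)) ⟫) ⟫          ≈⟨ pair-congʳ p′ (λ m → cong-pair q≈ _) ⟩
      ⟪ p′ , (λ m → ⟪ q′ , (λ m′ → h (m ⊕ m′)) ⟫) ⟫         ≈⟨ pair-* p′ q′ h ⟨
      ⟪ p′ *ₚ q′ , h ⟫                                      ∎

    *-commₚ : ∀ p q → p *ₚ q ≋ q *ₚ p
    *-commₚ p q = pair-injective λ h → begin
      ⟪ p *ₚ q , h ⟫                                        ≈⟨ pair-* p q h ⟩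
      ⟪ p , (λ m → ⟪ q , (λ m′ → h (m ⊕ m′)) ⟫) ⟫           ≈⟨ pair-swap p q _ ⟩
      ⟪ q , (λ m′ → ⟪ p , (λ m → h (m ⊕ m′)) ⟫) ⟫           ≈⟨ pair-congʳ q (λ m′ → pair-congʳ p λ m → K.reflexive (≡.cong h (⊕-comm m m′))) ⟩
      ⟪ q , (λ m′ → ⟪ p , (λ m → h (m′ ⊕ m)) ⟫) ⟫           ≈⟨ pair-* q p h ⟨
      ⟪ q *ₚ p , h ⟫                                        ∎

    *-assocₚ : ∀ p q r → (p *ₚ q) *ₚ r ≋ p *ₚ (q *ₚ r)
    *-assocₚ p q r = pair-injective λ h → begin
      ⟪ (p *ₚ q) *ₚ r , h ⟫                                 ≈⟨ pair-* (p *ₚ q) r h ⟩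
      ⟪ p *ₚ q , (λ m → ⟪ r , (λ m″ → h (m ⊕ m″)) ⟫) ⟫      ≈⟨ pair-* p q _ ⟩
      ⟪ p , (λ m → ⟪ q , (λ m′ → ⟪ r , (λ m″ → h ((m ⊕ m′) ⊕ m″)) ⟫) ⟫) ⟫
        ≈⟨ pair-congʳ p (λ m → pair-congʳ q λ m′ → pair-congʳ r λ m″ → K.reflexive (≡.cong h (⊕-assoc m m′ m″))) ⟩
      ⟪ p , (λ m → ⟪ q , (λ m′ → ⟪ r , (λ m″ → h (m ⊕ (m′ ⊕ m″))) ⟫) ⟫) ⟫
        ≈⟨ pair-congʳ p (λ m → K.sym (pair-* q r _)) ⟩
      ⟪ p , (λ m → ⟪ q *ₚ r , (λ m′ → h (m ⊕ m′)) ⟫) ⟫      ≈⟨ pair-* p (q *ₚ r) h ⟨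
      ⟪ p *ₚ (q *ₚ r) , h ⟫                                 ∎

    *-identityˡₚ : ∀ p → 1ₚ *ₚ p ≋ p
    *-identityˡₚ p = pair-injective λ h → begin
      ⟪ 1ₚ *ₚ p , h ⟫                                       ≈⟨ pair-* 1ₚ p h ⟩
      K.1# K.* ⟪ p , (λ m → h (𝟎 ⊕ m)) ⟫ K.+ K.0#           ≈⟨ K.trans (K.+-identityʳ _) (K.*-identityˡ _) ⟩
      ⟪ p , (λ m → h (𝟎 ⊕ m)) ⟫                             ≈⟨ pair-congʳ p (λ m → K.reflexive (≡.cong h (Vec.zipWith-identityˡ ℕ.+-identityˡ m))) ⟩
      ⟪ p , h ⟫                                             ∎

    distribʳₚ : ∀ r p q → (p +ₚ q) *ₚ r ≋ p *ₚ r +ₚ q *ₚ r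
    distribʳₚ r p q = pair-injective λ h → begin
      ⟪ (p ++ q) *ₚ r , h ⟫                                 ≈⟨ pair-* (p ++ q) r h ⟩
      ⟪ p ++ q , _ ⟫                                        ≈⟨ pair-++ p q _ ⟩
      ⟪ p , _ ⟫ K.+ ⟪ q , _ ⟫                               ≈⟨ K.+-cong (pair-* p r h) (pair-* q r h) ⟨
      ⟪ p *ₚ r , h ⟫ K.+ ⟪ q *ₚ r , h ⟫                     ≈⟨ pair-++ (p *ₚ r) (q *ₚ r) h ⟨
      ⟪ p *ₚ r ++ q *ₚ r , h ⟫                              ∎

  private
    transₚ : ∀ {p q r : Poly n} → p ≋ q → q ≋ r → p ≋ r
    transₚ p≈q q≈r = coefficientwise λ m → K.trans (coefficients p≈q m) (coefficients q≈r m)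

  polynomialRing : CommutativeRing c ℓ
  polynomialRing = record
    { Carrier = Poly n
    ; _≈_ = _≋_
    ; _+_ = _+ₚ_
    ; _*_ = _*ₚ_
    ; -_ = -ₚ_
    ; 0# = 0ₚ
    ; 1# = 1ₚ
    ; isCommutativeRing = record
      { isRing = record
        { +-isAbelianGroup = record
          { isGroup = record
            { isMonoid = record
              { isSemigroup = record
                { isMagma = record
                  { isEquivalence = record
                    { refl  = coefficientwise λ m → K.refl
                    ; sym   = λ p≈q → coefficientwise λ m → K.sym (coefficients p≈q m)
                    ; trans = transₚ }
                  ; ∙-cong = +-congₚ }
                ; assoc = +-assocₚ }
              ; identity = (λ p → coefficientwise λ m → K.refl) , +-identityʳₚ }
            ; inverse = (λ p → transₚ (+-commₚ (-ₚ p) p) (+-inverseʳₚ p)) , +-inverseʳₚ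
            ; ⁻¹-cong = -‿congₚ }
          ; comm = +-commₚ }
        ; *-cong = *-congₚ
        ; *-assoc = *-assocₚ
        ; *-identity = *-identityˡₚ , λ p → transₚ (*-commₚ p 1ₚ) (*-identityˡₚ p)
        ; distrib = (λ r p q → transₚ (*-commₚ r (p ++ q))
                      (transₚ (distribʳₚ r p q)
                        (+-congₚ (*-commₚ p r) (*-commₚ q r)))) , distribʳₚ
        }
      ; *-comm = *-commₚ
      }
    }

  constant : Hom K.commutativeRing polynomialRing
  constant = record
    { fun    = constₚ
    ; cong   = λ {x} {y} x≈y → pair-injective λ h → K.+-congʳ (K.*-congʳ x≈y)
    ; +-homo = λ x y → pair-injective λ h →
        solve 3 (λ x y z → (x :+ y) :* z :+ con (0 , 0) := x :* z :+ (y :* z :+ con (0 , 0))) K.refl x y _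
    ; *-homo = λ x y → pair-injective λ h →
        K.+-congʳ (K.*-congˡ (K.reflexive (≡.cong h (≡.sym (Vec.zipWith-identityˡ ℕ.+-identityˡ _)))))
    ; 0-homo = pair-injective λ h → K.trans (K.+-identityʳ _) (K.zeroˡ _)
    ; 1-homo = coefficientwise λ m → K.refl
    }

-- Evaluation homomorphisms.

module Evaluation {c ℓ a b} (K : Field c ℓ) (A : CommutativeRing a b)
                  (ι : Hom (Field.commutativeRing K) A) {n : ℕ} where
  open CommutativeRing A hiding (zero)
  open Hom ι renaming (fun to i)
  open Polynomials K
  open Pairing K A ι n
  open IntegerRingSolver A
  open import Algebra.Properties.Semiring.Exp semiring using (_^_; ^-homo-*)
  open import Relation.Binary.Reasoning.Setoid setoid
  private module R = PolynomialRing K n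

  monomialValue : ∀ {n} → (Fin n → Carrier) → Vec ℕ n → Carrier
  monomialValue e []      = 1#
  monomialValue e (k ∷ m) = e zero ^ k * monomialValue (e ∘ suc) m

  monomialValue-⊕ : ∀ {n} (e : Fin n → Carrier) m m′ →
                    monomialValue e (m ⊕ m′) ≈ monomialValue e m * monomialValue e m′
  monomialValue-⊕ e []      []        = sym (*-identityˡ _)
  monomialValue-⊕ e (k ∷ m) (k′ ∷ m′) =
    trans (*-cong (^-homo-* (e zero) k k′) (monomialValue-⊕ (e ∘ suc) m m′))
      (solve 4 (λ x y z w → (x :* y) :* (z :* w) := (x :* z) :* (y :* w)) refl _ _ _ _)

  monomialValue-𝟎 : ∀ {n} (e : Fin n → Carrier) → monomialValue e 𝟎 ≈ 1#
  monomialValue-𝟎 {zero}  e = refl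
  monomialValue-𝟎 {suc n} e = trans (*-identityˡ _) (monomialValue-𝟎 (e ∘ suc))

  monomialValue-unit : ∀ {n} (e : Fin n → Carrier) j → monomialValue e (unit j) ≈ e j
  monomialValue-unit e zero    = trans (*-cong (*-identityʳ _) (monomialValue-𝟎 (e ∘ suc))) (*-identityʳ _)
  monomialValue-unit e (suc j) = trans (*-identityˡ _) (monomialValue-unit (e ∘ suc) j)

  -- The universal property of polynomials: pairing with a function that is multiplicative on
  -- exponent vectors is a ring homomorphism.
  evaluation : (Fin n → Carrier) → Hom R.polynomialRing A
  evaluation e = record
    { fun    = λ p → ⟪ p , monomialValue e ⟫
    ; cong   = λ p≈q → R.pair-congˡ A ι p≈q _
    ; +-homo = λ p q → pair-++ p q _
    ; *-homo = λ p q → begin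
        ⟪ p *ₚ q , χ ⟫                                     ≈⟨ pair-* p q χ ⟩
        ⟪ p , (λ m → ⟪ q , (λ m′ → χ (m ⊕ m′)) ⟫) ⟫        ≈⟨ pair-congʳ p (λ m → trans (pair-congʳ q (monomialValue-⊕ e m))
                                                                (trans (pair-*ˡ q _ _) (*-comm _ _))) ⟩
        ⟪ p , (λ m → ⟪ q , χ ⟫ * χ m) ⟫                    ≈⟨ trans (pair-*ˡ p _ _) (*-comm _ _) ⟩
        ⟪ p , χ ⟫ * ⟪ q , χ ⟫                              ∎
    ; 0-homo = refl
    ; 1-homo = trans (+-identityʳ _) (trans (*-cong 1-homo (monomialValue-𝟎 e)) (*-identityˡ _))
    }
    where χ = monomialValue e

  eval-const : ∀ e x → Hom.fun (evaluation e) (constₚ x) ≈ i x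
  eval-const e x = trans (+-identityʳ _) (trans (*-congˡ (monomialValue-𝟎 e)) (*-identityʳ _))

  eval-var : ∀ e j → Hom.fun (evaluation e) (var j) ≈ e j
  eval-var e j = trans (+-identityʳ _) (trans (*-cong 1-homo (monomialValue-unit e j)) (*-identityˡ _))

-- Degrees, graded lexicographic order and leading terms.

degree : ∀ {n} → Vec ℕ n → ℕ
degree = Vec.sum

degree-⊕ : ∀ {n} (m m′ : Vec ℕ n) → degree (m ⊕ m′) ≡ degree m ℕ.+ degree m′
degree-⊕ []      []        = ≡.refl
degree-⊕ (k ∷ m) (k′ ∷ m′) = ≡.trans (≡.cong (k ℕ.+ k′ ℕ.+_) (degree-⊕ m m′)) (interchange k k′ (degree m) (degree m′))
  where open import Algebra.Properties.CommutativeSemigroup ℕ.+-commutativeSemigroup using (interchange)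

degree-𝟎 : ∀ n → degree (𝟎 {n}) ≡ 0
degree-𝟎 zero    = ≡.refl
degree-𝟎 (suc n) = degree-𝟎 n

degree≡0⇒𝟎 : ∀ {n} (m : Vec ℕ n) → degree m ≡ 0 → m ≡ 𝟎
degree≡0⇒𝟎 []         _  = ≡.refl
degree≡0⇒𝟎 (zero ∷ m) eq = ≡.cong (0 ∷_) (degree≡0⇒𝟎 m eq)

degree-unit : ∀ {n} (i : Fin n) → degree (unit i) ≡ 1
degree-unit {suc n} zero    = ≡.cong suc (degree-𝟎 n)
degree-unit         (suc i) = degree-unit i

module MonomialOrder {n : ℕ} where
  private
    module < = StrictTotalOrder (Lex.<-strictTotalOrder ℕ.<-strictTotalOrder (suc n))

    -- Prefixing the degree turns lexicographic order into graded lexicographic order, which is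
    -- total, compatible with `_⊕_`, and refines the comparison of degrees.
    graded : Vec ℕ n → Vec ℕ (suc n)
    graded m = degree m ∷ m

  infix 4 _≺_
  _≺_ : Vec ℕ n → Vec ℕ n → Set
  m ≺ m′ = graded m <.< graded m′

  ≺-trans : ∀ {m m′ m″} → m ≺ m′ → m′ ≺ m″ → m ≺ m″
  ≺-trans = <.trans

  ≺-irrefl : ∀ {m} → ¬ m ≺ m
  ≺-irrefl = <.irrefl (≡⇒Pointwise-≡ ≡.refl)

  ≺-cmp : ∀ m m′ → m ≺ m′ ⊎ m ≡ m′ ⊎ m′ ≺ m
  ≺-cmp m m′ with <.compare (graded m) (graded m′)
  ... | tri< m≺m′ _ _ = inj₁ m≺m′
  ... | tri≈ _ m≋m′ _ = inj₂ (inj₁ (Vec.∷-injectiveʳ (Pointwise-≡⇒≡ m≋m′)))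
  ... | tri> _ _ m′≺m = inj₂ (inj₂ m′≺m)

  private
    lex-⊕ : ∀ {k} (x : Vec ℕ k) {y z} → Lex.Lex-< _≡_ _<_ y z → Lex.Lex-< _≡_ _<_ (x ⊕ y) (x ⊕ z)
    lex-⊕ []      (Lex.base ())
    lex-⊕ (k ∷ x) (Lex.this y<z eq) = Lex.this (ℕ.+-monoʳ-< k y<z) eq
    lex-⊕ (k ∷ x) (Lex.next eq y<z) = Lex.next (≡.cong (k ℕ.+_) eq) (lex-⊕ x y<z)

  ⊕-monoʳ-≺ : ∀ m {m′ m″} → m′ ≺ m″ → m ⊕ m′ ≺ m ⊕ m″
  ⊕-monoʳ-≺ m {m′} {m″} m′≺m″ =
    ≡.subst₂ (λ d d′ → (d ∷ m ⊕ m′) <.< (d′ ∷ m ⊕ m″)) (≡.sym (degree-⊕ m m′)) (≡.sym (degree-⊕ m m″))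
      (lex-⊕ (graded m) m′≺m″)

  ⊕-monoˡ-≺ : ∀ m {m′ m″} → m′ ≺ m″ → m′ ⊕ m ≺ m″ ⊕ m
  ⊕-monoˡ-≺ m {m′} {m″} m′≺m″ =
    ≡.subst₂ _≺_ (Vec.zipWith-comm ℕ.+-comm m m′) (Vec.zipWith-comm ℕ.+-comm m m″) (⊕-monoʳ-≺ m m′≺m″)

  ≺⇒degree≤ : ∀ {m m′} → m ≺ m′ → degree m ≤ degree m′
  ≺⇒degree≤ (Lex.this d<d′ _) = ℕ.<⇒≤ d<d′
  ≺⇒degree≤ (Lex.next d≡d′ _) = ℕ.≤-reflexive d≡d′

  degree<⇒≺ : ∀ {m m′} → degree m < degree m′ → m ≺ m′
  degree<⇒≺ d<d′ = Lex.this d<d′ ≡.refl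

module FieldProperties {c ℓ} (K : Field c ℓ) where
  open Field K

  *-cancel-0ʳ : ∀ {x y} → ¬ x ≈ 0# → x * y ≈ 0# → y ≈ 0#
  *-cancel-0ʳ {x} {y} x≉0 xy≈0 = begin
    y                       ≈⟨ *-identityˡ y ⟨
    1# * y                  ≈⟨ *-congʳ x*x⁻¹≈1 ⟨
    x * x⁻¹ * y             ≈⟨ solve 3 (λ x x⁻¹ y → x :* x⁻¹ :* y := x⁻¹ :* (x :* y)) refl _ _ _ ⟩
    x⁻¹ * (x * y)           ≈⟨ *-congˡ xy≈0 ⟩
    x⁻¹ * 0#                ≈⟨ zeroʳ _ ⟩
    0#                      ∎
    where
    open IntegerRingSolver commutativeRing
    open import Relation.Binary.Reasoning.Setoid setoid
    x⁻¹ = proj₁ (inverse x x≉0)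
    x*x⁻¹≈1 = proj₂ (inverse x x≉0)

  *-≉0 : ∀ {x y} → ¬ x ≈ 0# → ¬ y ≈ 0# → ¬ x * y ≈ 0#
  *-≉0 x≉0 y≉0 xy≈0 = y≉0 (*-cancel-0ʳ x≉0 xy≈0)

module Degree {c ℓ} (K : Field c ℓ) (n : ℕ) where
  private module K = Field K
  open Polynomials K
  open PolynomialRing K n
  open MonomialOrder {n}
  open FieldProperties K
  private module R = CommutativeRing polynomialRing
  open import Relation.Binary.Reasoning.Setoid R.setoid

  Terms : ∀ {p} → (Monomial n → Set p) → Poly n → Set _
  Terms P = All (P ∘ proj₂)

  terms-* : ∀ {p q r} {P : Monomial n → Set p} {Q : Monomial n → Set q} {R : Monomial n → Set r} →
            (∀ {m m′} → P m → Q m′ → R (m ⊕ m′)) → ∀ f g → Terms P f → Terms Q g → Terms R (f *ₚ g)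
  terms-* step []            g _          _  = []
  terms-* step ((a , m) ∷ f) g (pm ∷ pf) qg =
    All.++⁺ (All.map⁺ (All.map (step pm) qg)) (terms-* step f g pf qg)

  coeff-absent : ∀ m f → Terms (λ m′ → ¬ m′ ≡ m) f → coeff f m K.≈ K.0#
  coeff-absent m []             _            = K.refl
  coeff-absent m ((a , m′) ∷ f) (m′≢m ∷ f∌m) with m′ ≟ᵐ m
  ... | yes m′≡m = ⊥-elim (m′≢m m′≡m)
  ... | no _     = coeff-absent m f f∌m

  coeff-head : ∀ a m f → Terms (_≺ m) f → coeff ((a , m) ∷ f) m K.≈ a
  coeff-head a m f f≺m with m ≟ᵐ m
  ... | no m≢m = ⊥-elim (m≢m ≡.refl)
  ... | yes _  = K.trans (K.+-congˡ (coeff-absent m f (All.map (λ { m≺m ≡.refl → ≺-irrefl m≺m }) f≺m)))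
                   (K.+-identityʳ a)

  head-+ : ∀ a b m f → ((a , m) ∷ (b , m) ∷ f) ≋ ((a K.+ b , m) ∷ f)
  head-+ a b m f = pair-injective λ h → K.trans (K.sym (K.+-assoc _ _ _)) (K.+-congʳ (K.sym (K.distribʳ _ _ _)))

  head-0 : ∀ {a} m f → a K.≈ K.0# → ((a , m) ∷ f) ≋ f
  head-0 m f a≈0 = pair-injective λ h →
    K.trans (K.+-congʳ (K.trans (K.*-congʳ a≈0) (K.zeroˡ _))) (K.+-identityˡ _)

  head-swap : ∀ t t′ f → (t ∷ t′ ∷ f) ≋ (t′ ∷ t ∷ f)
  head-swap t t′ f = pair-injective λ h →
    K.trans (K.sym (K.+-assoc _ _ _)) (K.trans (K.+-congʳ (K.+-comm _ _)) (K.+-assoc _ _ _))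

  ∷-cong : ∀ t {f g} → f ≋ g → (t ∷ f) ≋ (t ∷ g)
  ∷-cong t = R.+-congˡ {t ∷ []}

  data Sorted : Poly n → Set (c ⊔ ℓ) where
    []  : Sorted []
    _∷_ : ∀ {a m f} → ¬ a K.≈ K.0# × Terms (_≺ m) f → Sorted f → Sorted ((a , m) ∷ f)

  private
    -- Keeping the list reduced requires knowing whether a coefficient vanishes, hence the double
    -- negation. The last component says that no exponent above those present arises, so that in the
    -- recursive case the old head stays on top.
    insert : ∀ a m f → Sorted f →
             ¬ ¬ (Σ[ g ∈ Poly n ] Sorted g × ((a , m) ∷ f) ≋ g ×
                  (∀ {m₀} → m ≺ m₀ → Terms (_≺ m₀) f → Terms (_≺ m₀) g))
    insert a m [] [] k = ¬¬-excluded-middle λ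
      { (yes a≈0) → k ([] , [] , head-0 m [] a≈0 , λ _ b → b)
      ; (no a≉0)  → k (_ , (a≉0 , []) ∷ [] , R.refl , λ m≺m₀ b → m≺m₀ ∷ b) }
    insert a m f@((b , m′) ∷ f′) s@((b≉0 , f′≺m′) ∷ s′) k with ≺-cmp m′ m
    ... | inj₁ m′≺m = ¬¬-excluded-middle λ
      { (yes a≈0) → k (f , s , head-0 m f a≈0 , λ _ b → b)
      ; (no a≉0)  → k (_ , (a≉0 , m′≺m ∷ All.map (λ m″≺m′ → ≺-trans m″≺m′ m′≺m) f′≺m′) ∷ s , R.refl ,
                       λ m≺m₀ b → m≺m₀ ∷ b) }
    ... | inj₂ (inj₁ ≡.refl) = ¬¬-excluded-middle λ
      { (yes a+b≈0) → k (f′ , s′ , R.trans (head-+ a b m f′) (head-0 m f′ a+b≈0) , λ { _ (_ ∷ b) → b })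
      ; (no a+b≉0)  → k (_ , (a+b≉0 , f′≺m′) ∷ s′ , head-+ a b m f′ , λ { m≺m₀ (_ ∷ b) → m≺m₀ ∷ b }) }
    ... | inj₂ (inj₂ m≺m′) = insert a m f′ s′ λ { (g , s″ , eq , bound) →
      k (_ , (b≉0 , bound m≺m′ f′≺m′) ∷ s″ ,
         R.trans (head-swap (a , m) (b , m′) f′) (∷-cong (b , m′) eq) ,
         λ { m≺m₀ (m′≺m₀ ∷ b) → m′≺m₀ ∷ bound m≺m₀ b }) }

  sort : ∀ f → ¬ ¬ (Σ[ g ∈ Poly n ] Sorted g × f ≋ g)
  sort []            k = k ([] , [] , R.refl)
  sort ((a , m) ∷ f) k = sort f λ { (g , s , f≋g) → insert a m g s λ { (g′ , s′ , eq , _) →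
    k (g′ , s′ , R.trans (∷-cong (a , m) f≋g) eq) } }

  -- The witness is a single leading term in the graded order, not the whole top homogeneous part,
  -- since leading terms multiply without cancellation. The zero polynomial has no degree.
  record HasDegree (d : ℕ) (f : Poly n) : Set (c ⊔ ℓ) where
    constructor hasDegree
    field
      {lead}   : K.Carrier
      {top}    : Monomial n
      rest     : Poly n
      lead≉0   : ¬ lead K.≈ K.0#
      deg-top  : degree top ≡ d
      rest≺top : Terms (_≺ top) rest
      expand   : f ≋ ((lead , top) ∷ rest)

  -- A bound is witnessed by some representation with low terms only, so it passes to sums and
  -- products without testing any coefficient.
  DegreeAtMost : ℕ → Poly n → Set (c ⊔ ℓ)
  DegreeAtMost d f = Σ[ g ∈ Poly n ] Terms (λ m → degree m ≤ d) g × f ≋ g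

  hasDegree-cong : ∀ {d f g} → f ≋ g → HasDegree d f → HasDegree d g
  hasDegree-cong f≋g (hasDegree r a≉0 d r≺ eq) = hasDegree r a≉0 d r≺ (R.trans (R.sym f≋g) eq)

  zero-or-degree : ∀ f → ¬ ¬ (f ≋ 0ₚ ⊎ Σ[ d ∈ ℕ ] HasDegree d f)
  zero-or-degree f k = sort f λ
    { (.[] , [] , eq)                     → k (inj₁ eq)
    ; (_ , _∷_ {a} {m} (a≉0 , b) s , eq)  → k (inj₂ (degree m , hasDegree _ a≉0 ≡.refl b eq)) }

  hasDegree⇒atMost : ∀ {d f} → HasDegree d f → DegreeAtMost d f
  hasDegree⇒atMost (hasDegree r _ ≡.refl r≺ eq) = _ , ℕ.≤-refl ∷ All.map ≺⇒degree≤ r≺ , eq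

  -- The coefficient at `top` is nonzero, whereas a representation bounded by a smaller degree has
  -- no term there.
  hasDegree-≤ : ∀ {d e f} → HasDegree d f → DegreeAtMost e f → d ≤ e
  hasDegree-≤ {d} {e} (hasDegree {a} {m} r a≉0 ≡.refl r≺ eq) (g , g≤e , eq′) = ℕ.≮⇒≥ λ e<d →
    a≉0 (K.trans (K.sym (coeff-head a m r r≺))
          (K.trans (coefficients (R.trans (R.sym eq) eq′) m)
            (coeff-absent m g (All.map (λ { m′≤e ≡.refl → ℕ.<⇒≱ e<d m′≤e }) g≤e))))

  -- Monotonicity of `_⊕_` puts the product of the leading terms strictly above all other terms, and
  -- a field has no zero divisors.
  hasDegree-* : ∀ {d e f g} → HasDegree d f → HasDegree e g → HasDegree (d ℕ.+ e) (f *ₚ g)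
  hasDegree-* {f = f} {g} (hasDegree {a} {m} r a≉0 ≡.refl r≺ f≋) (hasDegree {b} {m′} s b≉0 ≡.refl s≺ g≋) =
    hasDegree _ (*-≉0 a≉0 b≉0) (degree-⊕ m m′)
      (All.++⁺ (All.map⁺ (All.map (⊕-monoʳ-≺ m) s≺))
        (terms-* product≺ r ((b , m′) ∷ s) r≺ (inj₂ ≡.refl ∷ All.map inj₁ s≺)))
      (R.*-cong f≋ g≋)
    where
    product≺ : ∀ {m₁ m₂} → m₁ ≺ m → m₂ ≺ m′ ⊎ m₂ ≡ m′ → m₁ ⊕ m₂ ≺ m ⊕ m′
    product≺ {m₂ = m₂} m₁≺m (inj₁ m₂≺m′)  = ≺-trans (⊕-monoˡ-≺ m₂ m₁≺m) (⊕-monoʳ-≺ m m₂≺m′)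
    product≺ {m₂ = m₂} m₁≺m (inj₂ ≡.refl) = ⊕-monoˡ-≺ m₂ m₁≺m

  hasDegree-+ : ∀ {d e f g} → HasDegree d f → DegreeAtMost e g → e < d → HasDegree d (f +ₚ g)
  hasDegree-+ (hasDegree r a≉0 ≡.refl r≺ f≋) (s , s≤e , g≋) e<d =
    hasDegree (r ++ s) a≉0 ≡.refl (All.++⁺ r≺ (All.map (λ m≤e → degree<⇒≺ (ℕ.≤-<-trans m≤e e<d)) s≤e))
      (R.+-cong f≋ g≋)

  hasDegree-const : ∀ {a} → ¬ a K.≈ K.0# → HasDegree 0 (constₚ a)
  hasDegree-const a≉0 = hasDegree [] a≉0 (degree-𝟎 n) [] R.refl

  hasDegree-0 : ∀ {f} → HasDegree 0 f → Σ[ a ∈ K.Carrier ] ¬ a K.≈ K.0# × f ≋ constₚ a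
  hasDegree-0 (hasDegree {a} {m} []             a≉0 d r≺         eq) rewrite degree≡0⇒𝟎 m d = a , a≉0 , eq
  hasDegree-0 (hasDegree {a} {m} ((_ , m′) ∷ _) a≉0 d (m′≺m ∷ _) eq) = ⊥-elim (≺-irrefl
    (≡.subst₂ _≺_ (degree≡0⇒𝟎 m′ (ℕ.n≤0⇒n≡0 (ℕ.≤-trans (≺⇒degree≤ m′≺m) (ℕ.≤-reflexive d)))) (degree≡0⇒𝟎 m d) m′≺m))

  atMost-cong : ∀ {d f g} → f ≋ g → DegreeAtMost d f → DegreeAtMost d g
  atMost-cong f≋g (h , h≤ , eq) = h , h≤ , R.trans (R.sym f≋g) eq

  atMost-mono : ∀ {d e f} → d ≤ e → DegreeAtMost d f → DegreeAtMost e f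
  atMost-mono d≤e (h , h≤ , eq) = h , All.map (λ m≤d → ℕ.≤-trans m≤d d≤e) h≤ , eq

  atMost-+ : ∀ {d f g} → DegreeAtMost d f → DegreeAtMost d g → DegreeAtMost d (f +ₚ g)
  atMost-+ (h , h≤ , f≋) (h′ , h′≤ , g≋) = h ++ h′ , All.++⁺ h≤ h′≤ , R.+-cong f≋ g≋

  atMost-* : ∀ {d e f g} → DegreeAtMost d f → DegreeAtMost e g → DegreeAtMost (d ℕ.+ e) (f *ₚ g)
  atMost-* {d} {e} (h , h≤ , f≋) (h′ , h′≤ , g≋) = h *ₚ h′ ,
    terms-* (λ {m} {m′} m≤d m′≤e → ≡.subst (_≤ d ℕ.+ e) (≡.sym (degree-⊕ m m′)) (ℕ.+-mono-≤ m≤d m′≤e)) h h′ h≤ h′≤ ,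
    R.*-cong f≋ g≋

  atMost-const : ∀ a → DegreeAtMost 0 (constₚ a)
  atMost-const a = constₚ a , ℕ.≤-reflexive (degree-𝟎 n) ∷ [] , R.refl

  atMost-var : ∀ i → DegreeAtMost 1 (var i)
  atMost-var i = var i , ℕ.≤-reflexive (degree-unit i) ∷ [] , R.refl

  affine-cases : ∀ {f} → DegreeAtMost 1 f → ¬ ¬ (HasDegree 1 f ⊎ Σ[ a ∈ K.Carrier ] f ≋ constₚ a)
  affine-cases f≤1 k = zero-or-degree _ λ
    { (inj₁ f≋0)       → k (inj₂ (K.0# , R.trans f≋0 (R.sym (Hom.0-homo constant))))
    ; (inj₂ (d , f-d)) → helper d f-d (hasDegree-≤ f-d f≤1) }
    where
    helper : ∀ d → HasDegree d _ → d ≤ 1 → ⊥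
    helper 0 f-d _ = k (inj₂ (proj₁ (hasDegree-0 f-d) , proj₂ (proj₂ (hasDegree-0 f-d))))
    helper 1 f-d _ = k (inj₁ f-d)
    helper (suc (suc _)) _ (s≤s ())

-- Finite sums in commutative rings.

module Sums {a b} (A : CommutativeRing a b) where
  open CommutativeRing A hiding (zero)

  ∑ : ∀ {k} → (Fin k → Carrier) → Carrier
  ∑ {k} t = List.foldr _+_ 0# (List.map t (List.allFin k))

  ∑-suc : ∀ {k} (t : Fin (suc k) → Carrier) → ∑ t ≡ t zero + ∑ (t ∘ suc)
  ∑-suc t = ≡.cong (λ l → t zero + List.foldr _+_ 0# l)
    (≡.trans (List.map-tabulate suc t) (≡.sym (List.map-tabulate (λ i → i) (t ∘ suc))))

  ∑-cong : ∀ {k} {t t′ : Fin k → Carrier} → (∀ j → t j ≈ t′ j) → ∑ t ≈ ∑ t′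
  ∑-cong {zero} eq = refl
  ∑-cong {suc k} {t} {t′} eq = trans (reflexive (∑-suc t))
    (trans (+-cong (eq zero) (∑-cong (eq ∘ suc))) (sym (reflexive (∑-suc t′))))

  ∑-zero : ∀ {k} (t : Fin k → Carrier) → (∀ j → t j ≈ 0#) → ∑ t ≈ 0#
  ∑-zero {zero} t eq = refl
  ∑-zero {suc k} t eq = trans (reflexive (∑-suc t))
    (trans (+-cong (eq zero) (∑-zero (t ∘ suc) (eq ∘ suc))) (+-identityˡ _))

  ∑-single : ∀ {k} (t : Fin k → Carrier) j → (∀ j′ → ¬ j′ ≡ j → t j′ ≈ 0#) → ∑ t ≈ t j
  ∑-single t zero    eq = trans (reflexive (∑-suc t))
    (trans (+-congˡ (∑-zero (t ∘ suc) (λ j → eq (suc j) λ ()))) (+-identityʳ _))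
  ∑-single t (suc j) eq = trans (reflexive (∑-suc t))
    (trans (+-cong (eq zero λ ()) (∑-single (t ∘ suc) j (λ j′ j′≢j → eq (suc j′) (j′≢j ∘ Fin.suc-injective))))
      (+-identityˡ _))

∑-homo : ∀ {a b c d} {A : CommutativeRing a b} {B : CommutativeRing c d} (θ : Hom A B)
         {k} (t : Fin k → CommutativeRing.Carrier A) →
         CommutativeRing._≈_ B (Hom.fun θ (Sums.∑ A t)) (Sums.∑ B (Hom.fun θ ∘ t))
∑-homo {A = A} {B} θ {k} t = go (List.allFin k)
  where
  open CommutativeRing B
  module A = CommutativeRing A
  open Hom θ
  go : ∀ l → fun (List.foldr A._+_ A.0# (List.map t l)) ≈ List.foldr _+_ 0# (List.map (fun ∘ t) l)
  go []      = 0-homo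
  go (j ∷ l) = trans (+-homo _ _) (+-congˡ (go l))

-- Restrictions of `p`: irreducible and not of the form `f g + γ`.

-- The linear form of f₀, f₁, f₂, f₃ times that of g₀, g₁, g₂, g₃ is never z₀ z₁ + z₂ z₃.
module SumOfTwoProducts {c ℓ} (K : Field c ℓ) where
  open Field K hiding (zero)
  open FieldProperties K
  open IntegerRingSolver commutativeRing
  open import Relation.Binary.Reasoning.Setoid setoid

  private
    -- With `f 0F` zero, the first equation makes `g 0F` nonzero, the next two then force `f 2F` and
    -- `f 3F` to vanish, and the last would read `0 = 1`.
    first-vanishes : (f g : Fin 4 → Carrier) → f 0F ≈ 0# →
      f 0F * g 1F + f 1F * g 0F ≈ 1# → f 0F * g 2F + f 2F * g 0F ≈ 0# → f 0F * g 3F + f 3F * g 0F ≈ 0# →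
      ¬ f 2F * g 3F + f 3F * g 2F ≈ 1#
    first-vanishes f g f₀≈0 e₀₁ e₀₂ e₀₃ e₂₃ = 1≉0 (begin
      1#                                ≈⟨ e₂₃ ⟨
      f 2F * g 3F + f 3F * g 2F         ≈⟨ +-cong (*-congʳ (vanishes 2F e₀₂)) (*-congʳ (vanishes 3F e₀₃)) ⟩
      0# * g 3F + 0# * g 2F             ≈⟨ solve 2 (λ x y → con (0 , 0) :* x :+ con (0 , 0) :* y := con (0 , 0)) refl _ _ ⟩
      0#                                ∎)
      where
      drop : ∀ s t → f 0F * g s + f t * g 0F ≈ f t * g 0F
      drop s t = trans (+-congʳ (trans (*-congʳ f₀≈0) (zeroˡ _))) (+-identityˡ _)
      g₀≉0 : ¬ g 0F ≈ 0#
      g₀≉0 g₀≈0 = 1≉0 (trans (sym e₀₁) (trans (drop 1F 1F) (trans (*-congˡ g₀≈0) (zeroʳ _))))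
      vanishes : ∀ t → f 0F * g t + f t * g 0F ≈ 0# → f t ≈ 0#
      vanishes t e = *-cancel-0ʳ g₀≉0 (trans (*-comm _ _) (trans (sym (drop t t)) e))

  -- The equations are the coefficients of `z₀²`, `z₀z₁`, `z₀z₂`, `z₀z₃` and `z₂z₃`. They are
  -- symmetric in `f` and `g`, and the first makes one of `f 0F` and `g 0F` vanish.
  not-product : (f g : Fin 4 → Carrier) → f 0F * g 0F ≈ 0# →
    f 0F * g 1F + f 1F * g 0F ≈ 1# → f 0F * g 2F + f 2F * g 0F ≈ 0# → f 0F * g 3F + f 3F * g 0F ≈ 0# →
    ¬ f 2F * g 3F + f 3F * g 2F ≈ 1#
  not-product f g e₀₀ e₀₁ e₀₂ e₀₃ e₂₃ = ¬¬-excluded-middle λ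
    { (yes f₀≈0) → first-vanishes f g f₀≈0 e₀₁ e₀₂ e₀₃ e₂₃
    ; (no f₀≉0)  → first-vanishes g f (*-cancel-0ʳ f₀≉0 e₀₀)
        (trans (flip _ _ _ _) e₀₁) (trans (flip _ _ _ _) e₀₂) (trans (flip _ _ _ _) e₀₃) (trans (flip _ _ _ _) e₂₃) }
    where
    flip : ∀ x y z w → x * y + z * w ≈ w * z + y * x
    flip = solve 4 (λ x y z w → x :* y :+ z :* w := w :* z :+ y :* x) refl

Assignment : ∀ {c ℓ} → Field c ℓ → ℕ → Set c
Assignment K n = Fin n → Maybe (Field.Carrier K)

module Restriction {c ℓ} (K : Field c ℓ) (ρ : Assignment K 28) where
  open Polynomials K

  point : Fin 28 → Poly 28
  point i = maybe constₚ (var i) (ρ i)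

  rowₚ : Fin 4 → Poly 28
  rowₚ r = Σₚ (λ (j : Fin 7) → point (combine r j))

  target : Poly 28
  target = rowₚ 0F *ₚ rowₚ 1F +ₚ rowₚ 2F *ₚ rowₚ 3F

-- Only an upper bound for the set of assigned variables: `D` may have repetitions and unassigned
-- members, since just its length is counted.
Supported : ∀ {c ℓ n} {K : Field c ℓ} → Assignment K n → List (Fin n) → Set c
Supported ρ D = ∀ i → i ∈ D ⊎ ρ i ≡ nothing

module _ {c ℓ} {K : Field c ℓ} {ρ : Assignment K 28} {D : List (Fin 28)} (supported : Supported {K = K} ρ D) where

  -- The seven variables of a fully assigned row would occupy seven distinct positions of `D`.
  row-has-free-variable : length D ≤ 6 → ∀ (r : Fin 4) → Σ[ j ∈ Fin 7 ] ρ (combine r j) ≡ nothing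
  row-has-free-variable D≤6 r with Fin.any? (λ j → free? (combine r j))
    where
    free? : ∀ i → Dec (ρ i ≡ nothing)
    free? i with ρ i
    ... | just _  = no λ ()
    ... | nothing = yes ≡.refl
  ... | yes free    = free
  ... | no ¬∃free = ⊥-elim collision
    where
    assigned : ∀ j → combine r j ∈ D
    assigned j with supported (combine r j)
    ... | inj₁ i∈D  = i∈D
    ... | inj₂ free = ⊥-elim (¬∃free (j , free))
    collision : ⊥
    collision with Fin.pigeonhole (s≤s D≤6) (λ j → Any.index (assigned j))
    ... | j , j′ , j<j′ , same = Fin.<⇒≢ j<j′ (Fin.combine-injectiveʳ r j r j′
      (≡.trans (Any.lookup-index (assigned j)) (≡.trans (≡.cong (List.lookup D) same)
        (≡.sym (Any.lookup-index (assigned j′))))))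

module RestrictedTarget {c ℓ} (K : Field c ℓ) (ρ : Assignment K 28)
                        (free : ∀ (r : Fin 4) → Σ[ j ∈ Fin 7 ] ρ (combine r j) ≡ nothing) where
  open Field K hiding (zero)
  open Restriction K ρ
  open Polynomials K
  open PolynomialRing K 28
  open Degree K 28
  open IntegerRingSolver commutativeRing
  open Evaluation K commutativeRing (idʰ commutativeRing) {28}
    using (monomialValue; monomialValue-⊕; monomialValue-𝟎; monomialValue-unit)
  private module R = CommutativeRing polynomialRing
  open Sums commutativeRing
  open import Relation.Binary.Reasoning.Setoid setoid

  private
    value-degree0 : ∀ {n} (ζ : Fin n → Carrier) m → degree m ≡ 0 → monomialValue ζ m ≈ 1#
    value-degree0 ζ m eq = trans (reflexive (≡.cong (monomialValue ζ) (degree≡0⇒𝟎 m eq))) (monomialValue-𝟎 ζ)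

    value-additive : ∀ {n} (ζ ζ′ : Fin n → Carrier) m → degree m ≡ 1 →
      monomialValue (λ i → ζ i + ζ′ i) m ≈ monomialValue ζ m + monomialValue ζ′ m
    value-additive ζ ζ′ (zero ∷ m) eq = trans (*-identityˡ _) (trans (value-additive (ζ ∘ suc) (ζ′ ∘ suc) m eq)
      (sym (+-cong (*-identityˡ _) (*-identityˡ _))))
    value-additive ζ ζ′ (suc zero ∷ m) eq = trans (*-cong (*-identityʳ _) (one (λ i → ζ i + ζ′ i)))
      (trans (*-identityʳ _) (+-cong (side ζ) (side ζ′)))
      where
      one : ∀ (ζ : Fin (suc _) → Carrier) → monomialValue (ζ ∘ suc) m ≈ 1#
      one ζ = value-degree0 (ζ ∘ suc) m (ℕ.suc-injective eq)
      side : ∀ (ζ : Fin (suc _) → Carrier) → ζ zero ≈ monomialValue ζ (1 ∷ m)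
      side ζ = sym (trans (*-cong (*-identityʳ _) (one ζ)) (*-identityʳ _))

    when : ∀ {p} {P : Set p} → Dec P → Carrier → Carrier
    when (yes _) x = x
    when (no _)  _ = 0#

    when-yes : ∀ {p} {P : Set p} (P? : Dec P) {x} → P → when P? x ≈ x
    when-yes (yes _) _ = refl
    when-yes (no ¬p) p = ⊥-elim (¬p p)

    when-no : ∀ {p} {P : Set p} (P? : Dec P) {x} → ¬ P → when P? x ≈ 0#
    when-no (yes p) ¬p = ⊥-elim (¬p p)
    when-no (no _)  _  = refl

    -- Pairing with homogeneous d ζ evaluates the homogeneous part of degree d at the point ζ.
    homogeneous : ℕ → (Fin 28 → Carrier) → Monomial 28 → Carrier
    homogeneous d ζ m = when (degree m ℕ.≟ d) (monomialValue ζ m)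

    homogeneous-≡ : ∀ {d} ζ m → degree m ≡ d → homogeneous d ζ m ≈ monomialValue ζ m
    homogeneous-≡ {d} ζ m = when-yes (degree m ℕ.≟ d)

    homogeneous-≢ : ∀ {d} ζ m → ¬ degree m ≡ d → homogeneous d ζ m ≈ 0#
    homogeneous-≢ {d} ζ m = when-no (degree m ℕ.≟ d)

    pair-cong-terms : ∀ p {h h′} → Terms (λ m → h m ≈ h′ m) p → ⟪ p , h ⟫ ≈ ⟪ p , h′ ⟫
    pair-cong-terms []            _        = refl
    pair-cong-terms ((a , m) ∷ p) (e ∷ es) = +-cong (*-congˡ e) (pair-cong-terms p es)

    linear : (Fin 28 → Carrier) → Poly 28 → Carrier
    linear ζ f = ⟪ f , homogeneous 1 ζ ⟫

    quadratic : (Fin 28 → Carrier) → Poly 28 → Carrier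
    quadratic ζ f = ⟪ f , homogeneous 2 ζ ⟫

    linear-additive : ∀ ζ ζ′ f → linear (λ i → ζ i + ζ′ i) f ≈ linear ζ f + linear ζ′ f
    linear-additive ζ ζ′ f = trans (pair-congʳ f step) (pair-+ f _ _)
      where
      step : ∀ m → homogeneous 1 (λ i → ζ i + ζ′ i) m ≈ homogeneous 1 ζ m + homogeneous 1 ζ′ m
      step m = cases (degree m ℕ.≟ 1)
        where
        cases : Dec (degree m ≡ 1) → _
        cases (yes eq) = trans (homogeneous-≡ _ m eq) (trans (value-additive ζ ζ′ m eq)
          (sym (+-cong (homogeneous-≡ ζ m eq) (homogeneous-≡ ζ′ m eq))))
        cases (no ne) = trans (homogeneous-≢ _ m ne)
          (sym (trans (+-cong (homogeneous-≢ ζ m ne) (homogeneous-≢ ζ′ m ne)) (+-identityˡ _)))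

    Affine : Poly 28 → Set c
    Affine = Terms (λ m → degree m ≤ 1)

    homogeneous-⊕ : ∀ ζ m m′ → degree m ≤ 1 → degree m′ ≤ 1 →
      homogeneous 2 ζ (m ⊕ m′) ≈ homogeneous 1 ζ m * homogeneous 1 ζ m′
    homogeneous-⊕ ζ m m′ m≤1 m′≤1 = cases (degree m ℕ.≟ 1) (degree m′ ℕ.≟ 1)
      where
      degree<2 : degree m ℕ.+ degree m′ < 2 → homogeneous 2 ζ (m ⊕ m′) ≈ 0#
      degree<2 lt = homogeneous-≢ ζ (m ⊕ m′) (ℕ.<⇒≢ (≡.subst (_< 2) (≡.sym (degree-⊕ m m′)) lt))
      cases : Dec (degree m ≡ 1) → Dec (degree m′ ≡ 1) → _
      cases (yes d) (yes d′) = trans (homogeneous-≡ ζ (m ⊕ m′) (≡.trans (degree-⊕ m m′) (≡.cong₂ ℕ._+_ d d′)))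
        (trans (monomialValue-⊕ ζ m m′) (sym (*-cong (homogeneous-≡ ζ m d) (homogeneous-≡ ζ m′ d′))))
      cases (no d≢) _ = trans (degree<2 (ℕ.+-mono-<-≤ (ℕ.≤∧≢⇒< m≤1 d≢) m′≤1))
        (sym (trans (*-congʳ (homogeneous-≢ ζ m d≢)) (zeroˡ _)))
      cases (yes _) (no d′≢) = trans (degree<2 (ℕ.+-mono-≤-< m≤1 (ℕ.≤∧≢⇒< m′≤1 d′≢)))
        (sym (trans (*-congˡ (homogeneous-≢ ζ m′ d′≢)) (zeroʳ _)))

    -- Among terms of degree at most one, only two of degree one multiply to degree two, so the
    -- constant parts of the factors drop out.
    quadratic-* : ∀ ζ f g → Affine f → Affine g → quadratic ζ (f *ₚ g) ≈ linear ζ f * linear ζ g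
    quadratic-* ζ f g f≤1 g≤1 = begin
      ⟪ f *ₚ g , homogeneous 2 ζ ⟫                                       ≈⟨ pair-* f g _ ⟩
      ⟪ f , (λ m → ⟪ g , (λ m′ → homogeneous 2 ζ (m ⊕ m′)) ⟫) ⟫          ≈⟨ pair-cong-terms f (All.map (λ {t} m≤1 →
        trans (pair-cong-terms g (All.map (λ {t′} m′≤1 → homogeneous-⊕ ζ (proj₂ t) (proj₂ t′) m≤1 m′≤1) g≤1))
          (trans (pair-*ˡ g _ _) (*-comm _ _))) f≤1) ⟩
      ⟪ f , (λ m → linear ζ g * homogeneous 1 ζ m) ⟫                     ≈⟨ trans (pair-*ˡ f _ _) (*-comm _ _) ⟩
      linear ζ f * linear ζ g                                            ∎

    linear-∑ : ∀ ζ {k} (t : Fin k → Poly 28) → linear ζ (Σₚ t) ≈ ∑ (linear ζ ∘ t)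
    linear-∑ ζ {k} t = go (List.allFin k)
      where
      go : ∀ l → linear ζ (List.foldr _+ₚ_ 0ₚ (List.map t l)) ≈ List.foldr _+_ 0# (List.map (linear ζ ∘ t) l)
      go []      = refl
      go (j ∷ l) = trans (pair-++ (t j) _ _) (+-congˡ (go l))

    linear-const : ∀ ζ a → linear ζ (constₚ a) ≈ 0#
    linear-const ζ a = trans (+-identityʳ _) (trans (*-congˡ (homogeneous-≢ ζ 𝟎
      (λ eq → ℕ.0≢1+n {0} (≡.trans (≡.sym (degree-𝟎 28)) eq)))) (zeroʳ _))

    linear-var : ∀ ζ i → linear ζ (var i) ≈ ζ i
    linear-var ζ i = trans (+-identityʳ _) (trans (*-identityˡ _)
      (trans (homogeneous-≡ ζ (unit i) (degree-unit i)) (monomialValue-unit ζ i)))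

    chosen : Fin 4 → Fin 28
    chosen r = combine r (proj₁ (free r))

    -- Points dual to the rows: one free variable of row `s` is one, everything else zero. Assigned
    -- variables contribute constants, which `linear` ignores, so the linear parts of the rows form
    -- a Kronecker matrix.
    Δ : Fin 4 → Fin 28 → Carrier
    Δ s i = when (i Fin.≟ chosen s) 1#

    linear-point-≢ : ∀ s i → ¬ i ≡ chosen s → linear (Δ s) (point i) ≈ 0#
    linear-point-≢ s i ne with ρ i
    ... | just a  = linear-const (Δ s) a
    ... | nothing = trans (linear-var (Δ s) i) (when-no (i Fin.≟ chosen s) ne)

    linear-point-chosen : ∀ s → linear (Δ s) (point (chosen s)) ≈ 1#
    linear-point-chosen s with ρ (chosen s) | proj₂ (free s)
    ... | nothing | _ = trans (linear-var (Δ s) (chosen s)) (when-yes (chosen s Fin.≟ chosen s) ≡.refl)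

    linear-row-≢ : ∀ s r → ¬ r ≡ s → linear (Δ s) (rowₚ r) ≈ 0#
    linear-row-≢ s r r≢s = trans (linear-∑ (Δ s) (λ (j : Fin 7) → point (combine r j))) (∑-zero (λ (j : Fin 7) → linear (Δ s) (point (combine r j))) λ j →
      linear-point-≢ s (combine r j) (r≢s ∘ Fin.combine-injectiveˡ r j s _))

    linear-row-≡ : ∀ s → linear (Δ s) (rowₚ s) ≈ 1#
    linear-row-≡ s = trans (linear-∑ (Δ s) (λ (j : Fin 7) → point (combine s j))) (trans (∑-single (λ (j : Fin 7) → linear (Δ s) (point (combine s j))) (proj₁ (free s)) λ j j≢ →
      linear-point-≢ s (combine s j) (j≢ ∘ Fin.combine-injectiveʳ s j s _)) (linear-point-chosen s))

    kronecker : Fin 4 → Fin 4 → Carrier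
    kronecker s r = when (r Fin.≟ s) 1#

    linear-row : ∀ s r → linear (Δ s) (rowₚ r) ≈ kronecker s r
    linear-row s r with r Fin.≟ s
    ... | yes ≡.refl = linear-row-≡ s
    ... | no r≢s     = linear-row-≢ s r r≢s

    affine-point : ∀ i → Affine (point i)
    affine-point i with ρ i
    ... | just _  = z≤n ∷ []
    ... | nothing = ℕ.≤-reflexive (degree-unit i) ∷ []

    affine-row : ∀ r → Affine (rowₚ r)
    affine-row r = go (List.allFin 7)
      where
      go : ∀ l → Affine (List.foldr _+ₚ_ 0ₚ (List.map (λ j → point (combine r j)) l))
      go []      = []
      go (j ∷ l) = All.++⁺ (affine-point (combine r j)) (go l)

    quadratic-target : ∀ ζ → quadratic ζ target ≈
      linear ζ (rowₚ 0F) * linear ζ (rowₚ 1F) + linear ζ (rowₚ 2F) * linear ζ (rowₚ 3F)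
    quadratic-target ζ = trans (pair-++ (rowₚ 0F *ₚ rowₚ 1F) (rowₚ 2F *ₚ rowₚ 3F) (homogeneous 2 ζ))
      (+-cong (quadratic-* ζ (rowₚ 0F) (rowₚ 1F) (affine-row 0F) (affine-row 1F))
              (quadratic-* ζ (rowₚ 2F) (rowₚ 3F) (affine-row 2F) (affine-row 3F)))

  -- Only quadratic parts are compared, so `γ` disappears. In the directions dual to the rows the
  -- quadratic part of the target is `z₀z₁ + z₂z₃`, which is not a product of two linear forms.
  target-not-product : ∀ {f g} γ → DegreeAtMost 1 f → DegreeAtMost 1 g → ¬ target ≋ f *ₚ g +ₚ constₚ γ
  target-not-product {f₀} {g₀} γ (f , f≤1 , f≋) (g , g≤1 , g≋) eq =
    SumOfTwoProducts.not-product K (λ s → linear (Δ s) f) (λ s → linear (Δ s) g)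
      (trans (diagonal 0F) (solve 0 (:1 :* :0 :+ :0 :* :0 := :0) refl))
      (trans (polar 0F 1F) (solve 0 ((:1 :+ :0) :* (:0 :+ :1) :+ (:0 :+ :0) :* (:0 :+ :0) :- :1 :* :0 :- :0 :* :0 :- (:0 :* :1 :+ :0 :* :0) := :1) refl))
      (trans (polar 0F 2F) (solve 0 ((:1 :+ :0) :* (:0 :+ :0) :+ (:0 :+ :1) :* (:0 :+ :0) :- :1 :* :0 :- :0 :* :0 :- (:0 :* :0 :+ :1 :* :0) := :0) refl))
      (trans (polar 0F 3F) (solve 0 ((:1 :+ :0) :* (:0 :+ :0) :+ (:0 :+ :0) :* (:0 :+ :1) :- :1 :* :0 :- :0 :* :0 :- (:0 :* :0 :+ :0 :* :1) := :0) refl))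
      (trans (polar 2F 3F) (solve 0 ((:0 :+ :0) :* (:0 :+ :0) :+ (:1 :+ :0) :* (:0 :+ :1) :- :0 :* :0 :- :1 :* :0 :- (:0 :* :0 :+ :0 :* :1) := :1) refl))
    where
    :0 = con (0 , 0)
    :1 = con (1 , 0)
    product-value : ∀ ζ → linear ζ f * linear ζ g ≈
      linear ζ (rowₚ 0F) * linear ζ (rowₚ 1F) + linear ζ (rowₚ 2F) * linear ζ (rowₚ 3F)
    product-value ζ = begin
      linear ζ f * linear ζ g                                  ≈⟨ quadratic-* ζ f g f≤1 g≤1 ⟨
      quadratic ζ (f *ₚ g)                                     ≈⟨ trans (+-congˡ constant-part) (+-identityʳ _) ⟨
      quadratic ζ (f *ₚ g) + quadratic ζ (constₚ γ)            ≈⟨ pair-++ (f *ₚ g) (constₚ γ) _ ⟨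
      quadratic ζ (f *ₚ g +ₚ constₚ γ)                         ≈⟨ pair-congˡ commutativeRing (idʰ commutativeRing)
                                                                    (R.trans eq (R.+-congʳ (R.*-cong f≋ g≋))) _ ⟨
      quadratic ζ target                                       ≈⟨ quadratic-target ζ ⟩
      _                                                        ∎
      where
      constant-part : quadratic ζ (constₚ γ) ≈ 0#
      constant-part = trans (+-identityʳ _) (trans (*-congˡ (homogeneous-≢ ζ 𝟎
        (λ eq → ℕ.0≢1+n {1} (≡.trans (≡.sym (degree-𝟎 28)) eq)))) (zeroʳ _))
    κ = kronecker
    diagonal : ∀ s → linear (Δ s) f * linear (Δ s) g ≈ κ s 0F * κ s 1F + κ s 2F * κ s 3F
    diagonal s = trans (product-value (Δ s)) (+-cong (*-cong (linear-row s 0F) (linear-row s 1F))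
      (*-cong (linear-row s 2F) (linear-row s 3F)))
    -- Polarisation: a mixed coefficient is the value at `Δ s + Δ t` minus the values at the two
    -- points. Nothing is divided by two, so characteristic two is included.
    polar : ∀ s t → linear (Δ s) f * linear (Δ t) g + linear (Δ t) f * linear (Δ s) g ≈
      (κ s 0F + κ t 0F) * (κ s 1F + κ t 1F) + (κ s 2F + κ t 2F) * (κ s 3F + κ t 3F)
        - κ s 0F * κ s 1F - κ s 2F * κ s 3F - (κ t 0F * κ t 1F + κ t 2F * κ t 3F)
    polar s t = begin
      fs * gt + ft * gs                                        ≈⟨ solve 4 (λ fs ft gs gt → fs :* gt :+ ft :* gs :=
                                                                    (fs :+ ft) :* (gs :+ gt) :- fs :* gs :- ft :* gt) refl fs ft gs gt ⟩
      (fs + ft) * (gs + gt) - fs * gs - ft * gt                ≈⟨ +-cong (+-cong sum-value (-‿cong (diagonal s))) (-‿cong (diagonal t)) ⟩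
      _ - (κ s 0F * κ s 1F + κ s 2F * κ s 3F) - _              ≈⟨ +-congʳ (solve 3 (λ x y z → x :- (y :+ z) := x :- y :- z) refl _ _ _) ⟩
      _                                                        ∎
      where
      fs = linear (Δ s) f
      ft = linear (Δ t) f
      gs = linear (Δ s) g
      gt = linear (Δ t) g
      row-sum : ∀ r → linear (λ i → Δ s i + Δ t i) (rowₚ r) ≈ κ s r + κ t r
      row-sum r = trans (linear-additive (Δ s) (Δ t) (rowₚ r)) (+-cong (linear-row s r) (linear-row t r))
      sum-value : (fs + ft) * (gs + gt) ≈
        (κ s 0F + κ t 0F) * (κ s 1F + κ t 1F) + (κ s 2F + κ t 2F) * (κ s 3F + κ t 3F)
      sum-value = trans (sym (*-cong (linear-additive (Δ s) (Δ t) f) (linear-additive (Δ s) (Δ t) g)))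
        (trans (product-value _) (+-cong (*-cong (row-sum 0F) (row-sum 1F)) (*-cong (row-sum 2F) (row-sum 3F))))

  target-not-affine : ¬ DegreeAtMost 1 target
  target-not-affine t≤1 = target-not-product 0# t≤1 (atMost-mono z≤n (atMost-const 1#))
    (R.sym (R.trans (R.+-cong (R.*-identityʳ target) (Hom.0-homo constant)) (R.+-identityʳ target)))

  target-degree : ∀ {d} → HasDegree d target → d ≡ 2
  target-degree {d} t-d = ℕ.≤-antisym
    (hasDegree-≤ t-d (atMost-+ (atMost-* (row≤1 0F) (row≤1 1F)) (atMost-* (row≤1 2F) (row≤1 3F))))
    (ℕ.≰⇒> λ d≤1 → target-not-affine (atMost-mono d≤1 (hasDegree⇒atMost t-d)))
    where
    row≤1 : ∀ r → DegreeAtMost 1 (rowₚ r)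
    row≤1 r = rowₚ r , affine-row r , R.refl

  Constant : Poly 28 → Set (c ⊔ ℓ)
  Constant f = Σ[ a ∈ Carrier ] f ≋ constₚ a

  -- Degrees add up to two: either a factor has degree zero, or both are affine, which is the
  -- excluded form with `γ = 0`.
  target-irreducible : ∀ f g → target ≋ f *ₚ g → ¬ ¬ (Constant f ⊎ Constant g)
  target-irreducible f g eq k = zero-or-degree f λ
    { (inj₁ f≋0) → target-not-affine ([] , [] , R.trans eq (R.trans (R.*-congʳ f≋0) (R.zeroˡ g)))
    ; (inj₂ (d , f-d)) → zero-or-degree g λ
      { (inj₁ g≋0) → target-not-affine ([] , [] , R.trans eq (R.trans (R.*-congˡ {f} g≋0) (R.zeroʳ f)))
      ; (inj₂ (e , g-e)) → cases d e f-d g-e (target-degree (hasDegree-cong (R.sym eq) (hasDegree-* f-d g-e))) } }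
    where
    constant-of : ∀ {h} → HasDegree 0 h → Constant h
    constant-of h-0 = proj₁ (hasDegree-0 h-0) , proj₂ (proj₂ (hasDegree-0 h-0))
    cases : ∀ d e → HasDegree d f → HasDegree e g → d ℕ.+ e ≡ 2 → ⊥
    cases 0 e f-0 _ _   = k (inj₁ (constant-of f-0))
    cases (suc d) 0 _ g-0 _ = k (inj₂ (constant-of g-0))
    cases 1 1 f-1 g-1 _ = target-not-product 0# (hasDegree⇒atMost f-1) (hasDegree⇒atMost g-1)
      (R.trans eq (R.sym (R.trans (R.+-congˡ {f *ₚ g} (Hom.0-homo constant)) (R.+-identityʳ (f *ₚ g)))))
    cases (suc (suc d)) (suc e) _ _ d+e≡2 with ℕ.suc-injective (ℕ.suc-injective d+e≡2)
    ... | eq′ with ℕ.m+n≡0⇒n≡0 d eq′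
    ...   | ()

-- Products of shears as matrices of continuants.

module PlaneVectors {a b} (A : CommutativeRing a b) where
  open CommutativeRing A

  infix 8 _∧_
  _∧_ : (u v : Fin 2 → Carrier) → Carrier
  u ∧ v = u 0F * v 1F - u 1F * v 0F

  infixl 7 _⋆_
  _⋆_ : (Fin 2 → Carrier) → (Fin 2 → Fin 2 → Carrier) → Fin 2 → Carrier
  (r ⋆ M) j = r 0F * M 0F j + r 1F * M 1F j

  infixl 7 _∙_
  _∙_ : (Fin 2 → Carrier) → (Fin 2 → Carrier) → Carrier
  r ∙ c = r 0F * c 0F + r 1F * c 1F

-- An abstract interface, since the operations of Polynomials are recursive and unification would unfold them.
record DegreeAlgebra {c ℓ} (K : Field c ℓ) : Set (Level.suc (c ⊔ ℓ)) where
  private module K = Field K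
  field
    ring         : CommutativeRing c ℓ
    constant     : Hom K.commutativeRing ring
  open CommutativeRing ring
  open Hom constant renaming (fun to 𝕔)
  field
    HasDegree    : ℕ → Carrier → Set (c ⊔ ℓ)
    DegreeAtMost : ℕ → Carrier → Set (c ⊔ ℓ)

    hasDegree-cong    : ∀ {d f g} → f ≈ g → HasDegree d f → HasDegree d g
    hasDegree-const   : ∀ {a} → ¬ a K.≈ K.0# → HasDegree 0 (𝕔 a)
    hasDegree-*       : ∀ {d e f g} → HasDegree d f → HasDegree e g → HasDegree (d ℕ.+ e) (f * g)
    hasDegree-+       : ∀ {d e f g} → HasDegree d f → DegreeAtMost e g → e < d → HasDegree d (f + g)
    hasDegree⇒atMost  : ∀ {d f} → HasDegree d f → DegreeAtMost d f
    atMost-cong       : ∀ {d f g} → f ≈ g → DegreeAtMost d f → DegreeAtMost d g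
    atMost-mono       : ∀ {d e f} → d ≤ e → DegreeAtMost d f → DegreeAtMost e f
    atMost-const      : ∀ a → DegreeAtMost 0 (𝕔 a)
    atMost-+          : ∀ {d f g} → DegreeAtMost d f → DegreeAtMost d g → DegreeAtMost d (f + g)
    atMost-*          : ∀ {d e f g} → DegreeAtMost d f → DegreeAtMost e g → DegreeAtMost (d ℕ.+ e) (f * g)
    affine-cases      : ∀ {f} → DegreeAtMost 1 f → ¬ ¬ (HasDegree 1 f ⊎ Σ[ a ∈ K.Carrier ] f ≈ 𝕔 a)

  atMost-0 : ∀ {d} → DegreeAtMost d 0#
  atMost-0 = atMost-mono z≤n (atMost-cong 0-homo (atMost-const K.0#))

module Continuants {c ℓ} (K : Field c ℓ) (algebra : DegreeAlgebra K) where
  private module K = Field K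
  open DegreeAlgebra algebra
  open CommutativeRing ring using (Carrier; _≈_; _+_; _*_; 0#; 1#)
  open FieldProperties K
  open PlaneVectors K.commutativeRing using (_∧_)
  private
    module R = CommutativeRing ring
    module S = IntegerRingSolver ring
    module V = PlaneVectors ring
  open IntegerRingSolver K.commutativeRing
  open Hom constant using () renaming (cong to 𝕔-cong; +-homo to 𝕔-+; *-homo to 𝕔-*; 0-homo to 𝕔-0; 1-homo to 𝕔-1)
  open import Relation.Binary.Reasoning.Setoid R.setoid

  private
    𝕔 : K.Carrier → Carrier
    𝕔 = Hom.fun constant

  -- Generalised continuants: each step is the recurrence of a continued fraction with partial
  -- denominator `a` and partial numerator `κ`, and `s₂` is the continuant before `s₁`. Requiring
  -- degree exactly one for `a` makes the index the degree of `s₁`.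
  data Chain : ℕ → Carrier → Carrier → Set (c ⊔ ℓ) where
    base : ∀ {s₁ s₂ e} → ¬ e K.≈ K.0# → s₁ ≈ 𝕔 e → s₂ ≈ 0# → Chain 0 s₁ s₂
    step : ∀ {d s₁ s₂ u₁ u₂ a κ} → Chain d s₁ s₂ → HasDegree 1 a → ¬ κ K.≈ K.0# →
           u₁ ≈ a * s₁ + 𝕔 κ * s₂ → u₂ ≈ s₁ → Chain (suc d) u₁ u₂

  mutual
    -- The product `a * s₁` has degree `d + 1`, and `s₂`, the previous continuant, is too small to
    -- cancel its leading term.
    chain-degree : ∀ {d s₁ s₂} → Chain d s₁ s₂ → HasDegree d s₁
    chain-degree (base e≉0 eq _) = hasDegree-cong (R.sym eq) (hasDegree-const e≉0)
    chain-degree (step {κ = κ} ch a-1 _ eq _) = hasDegree-cong (R.sym eq)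
      (hasDegree-+ (hasDegree-* a-1 (chain-degree ch)) (atMost-* (atMost-const κ) (chain-second ch)) ℕ.≤-refl)

    chain-second : ∀ {d s₁ s₂} → Chain d s₁ s₂ → DegreeAtMost d s₂
    chain-second (base _ _ eq)       = atMost-cong (R.sym eq) atMost-0
    chain-second (step ch _ _ _ eq)  =
      atMost-mono (ℕ.n≤1+n _) (atMost-cong (R.sym eq) (hasDegree⇒atMost (chain-degree ch)))
    
  chain-cong : ∀ {d s₁ s₂ s₁′} → s₁ ≈ s₁′ → Chain d s₁ s₂ → Chain d s₁′ s₂
  chain-cong eq (base e≉0 e₁ e₂)         = base e≉0 (R.trans (R.sym eq) e₁) e₂
  chain-cong eq (step ch a-1 κ≉0 e₁ e₂)  = step ch a-1 κ≉0 (R.trans (R.sym eq) e₁) e₂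

  -- Both constants are absorbed into the last step: its `a` becomes `q a + u` and its `κ` becomes
  -- `q κ`. Since `q` is nonzero, `a` keeps degree one and `κ` stays nonzero.
  chain-scale : ∀ {d s₁ s₂} q u → ¬ q K.≈ K.0# → Chain d s₁ s₂ → Chain d (𝕔 q * s₁ + 𝕔 u * s₂) s₂
  chain-scale {s₁ = s₁} {s₂} q u q≉0 (base {e = e} e≉0 s₁≈e s₂≈0) = base (*-≉0 q≉0 e≉0) (begin
    𝕔 q * s₁ + 𝕔 u * s₂       ≈⟨ R.+-cong (R.*-congˡ s₁≈e) (R.*-congˡ s₂≈0) ⟩
    𝕔 q * 𝕔 e + 𝕔 u * 0#      ≈⟨ S.solve 3 (λ q e u → q S.:* e S.:+ u S.:* S.con (0 , 0) S.:= q S.:* e) R.refl (𝕔 q) (𝕔 e) (𝕔 u) ⟩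
    𝕔 q * 𝕔 e                   ≈⟨ 𝕔-* q e ⟨
    𝕔 (q K.* e)                  ∎) s₂≈0
  chain-scale {s₁ = s₁} {s₂} q u q≉0 (step {s₁ = s₁′} {s₂′} {a = a} {κ} ch a-1 κ≉0 s₁≈ s₂≈) =
    step ch (hasDegree-+ (hasDegree-* (hasDegree-const q≉0) a-1) (atMost-const u) ℕ.≤-refl) (*-≉0 q≉0 κ≉0) (begin
    𝕔 q * s₁ + 𝕔 u * s₂                                  ≈⟨ R.+-cong (R.*-congˡ s₁≈) (R.*-congˡ s₂≈) ⟩
    𝕔 q * (a * s₁′ + 𝕔 κ * s₂′) + 𝕔 u * s₁′           ≈⟨ S.solve 6 (λ q a s κ s′ u → q S.:* (a S.:* s S.:+ κ S.:* s′) S.:+ u S.:* s S.:=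
                                                                 (q S.:* a S.:+ u) S.:* s S.:+ (q S.:* κ) S.:* s′) R.refl (𝕔 q) a s₁′ (𝕔 κ) s₂′ (𝕔 u) ⟩
    (𝕔 q * a + 𝕔 u) * s₁′ + (𝕔 q * 𝕔 κ) * s₂′         ≈⟨ R.+-congˡ (R.*-congʳ (𝕔-* q κ)) ⟨
    (𝕔 q * a + 𝕔 u) * s₁′ + 𝕔 (q K.* κ) * s₂′          ∎) s₂≈

  -- The invariant under multiplication by shears from the right: up to an invertible constant
  -- matrix with rows `C₁` and `C₂`, the vector consists of two consecutive continuants.
  data State (r : Fin 2 → Carrier) : Set (c ⊔ ℓ) where
    vanishing : (∀ j → r j ≈ 0#) → State r
    chained   : ∀ {d s₁ s₂} → Chain d s₁ s₂ → (C₁ C₂ : Fin 2 → K.Carrier) → ¬ C₁ ∧ C₂ K.≈ K.0# →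
                (∀ j → r j ≈ s₁ * 𝕔 (C₁ j) + s₂ * 𝕔 (C₂ j)) → State r

  -- A nonzero constant vector is the chain `1, 0` in a basis that completes the vector by a unit
  -- vector.
  state-const : ∀ (v : Fin 2 → K.Carrier) → ¬ ¬ State (𝕔 ∘ v)
  state-const v k = ¬¬-excluded-middle λ
    { (no v₀≉0)  → k (chained unit-chain v e₁ (λ eq → v₀≉0 (K.trans (det₁ (v 0F) (v 1F)) eq)) expand)
    ; (yes v₀≈0) → ¬¬-excluded-middle λ
      { (no v₁≉0)  → k (chained unit-chain v e₀ (λ eq → v₁≉0 (K.trans (det₀ (v 0F) (v 1F)) (K.trans (K.-‿cong eq) negate-0))) expand)
      ; (yes v₁≈0) → k (vanishing λ { 0F → R.trans (𝕔-cong v₀≈0) 𝕔-0 ; 1F → R.trans (𝕔-cong v₁≈0) 𝕔-0 }) } }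
    where
    e₀ e₁ : Fin 2 → K.Carrier
    e₀ 0F = K.1#
    e₀ 1F = K.0#
    e₁ 0F = K.0#
    e₁ 1F = K.1#
    negate-0 : K.- K.0# K.≈ K.0#
    negate-0 = solve 0 (:- con (0 , 0) := con (0 , 0)) K.refl
    det₁ : ∀ x y → x K.≈ x K.* K.1# K.- y K.* K.0#
    det₁ = solve 2 (λ x y → x := x :* con (1 , 0) :- y :* con (0 , 0)) K.refl
    det₀ : ∀ x y → y K.≈ K.- (x K.* K.0# K.- y K.* K.1#)
    det₀ = solve 2 (λ x y → y := :- (x :* con (0 , 0) :- y :* con (1 , 0))) K.refl
    unit-chain : Chain 0 1# 0#
    unit-chain = base K.1≉0 (R.sym 𝕔-1) R.refl
    expand : ∀ {w : Fin 2 → K.Carrier} j → 𝕔 (v j) ≈ 1# * 𝕔 (v j) + 0# * 𝕔 (w j)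
    expand {w} j = S.solve 2 (λ v w → v S.:= S.con (1 , 0) S.:* v S.:+ S.con (0 , 0) S.:* w) R.refl (𝕔 (v j)) (𝕔 (w j))

  private
    flipped-det : ∀ k κ (a b : Fin 2 → K.Carrier) → ¬ κ K.≈ K.0# → ¬ a ∧ b K.≈ K.0# →
                  ¬ (λ j → k K.* a j K.+ b j) ∧ (λ j → κ K.* a j) K.≈ K.0#
    flipped-det k κ a b κ≉0 a∧b≉0 eq = *-≉0 κ≉0 a∧b≉0
      (K.trans (solve 6 (λ k κ a₀ a₁ b₀ b₁ → κ :* (a₀ :* b₁ :- a₁ :* b₀) :=
          :- ((k :* a₀ :+ b₀) :* (κ :* a₁) :- (k :* a₁ :+ b₁) :* (κ :* a₀))) K.refl k κ (a 0F) (a 1F) (b 0F) (b 1F))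
        (K.trans (K.-‿cong eq) (solve 0 (:- con (0 , 0) := con (0 , 0)) K.refl)))

    scaled-det : ∀ p u (a b : Fin 2 → K.Carrier) → ¬ p K.≈ K.0# → ¬ u K.≈ K.0# → ¬ a ∧ b K.≈ K.0# →
                 ¬ (λ j → p K.* a j) ∧ (λ j → u K.* b j) K.≈ K.0#
    scaled-det p u a b p≉0 u≉0 a∧b≉0 eq = *-≉0 (*-≉0 p≉0 u≉0) a∧b≉0
      (K.trans (solve 6 (λ p u a₀ a₁ b₀ b₁ → (p :* u) :* (a₀ :* b₁ :- a₁ :* b₀) :=
          (p :* a₀) :* (u :* b₁) :- (p :* a₁) :* (u :* b₀)) K.refl p u (a 0F) (a 1F) (b 0F) (b 1F)) eq)

    𝕔-combination : ∀ k a b → 𝕔 (k K.* a K.+ b) ≈ 𝕔 k * 𝕔 a + 𝕔 b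
    𝕔-combination k a b = R.trans (𝕔-+ (k K.* a) b) (R.+-congʳ (𝕔-* k a))

    -- A step needs `t` of degree exactly one. A constant `t` adds no step: the chain stays as it is
    -- and the constant moves into the basis.
    extend : ∀ {d s₁ s₂ κ t r} (a b : Fin 2 → K.Carrier) → Chain d s₁ s₂ → ¬ κ K.≈ K.0# → DegreeAtMost 1 t →
             ¬ a ∧ b K.≈ K.0# →
             (∀ j → r j ≈ (t * s₁ + 𝕔 κ * s₂) * 𝕔 (a j) + s₁ * 𝕔 (b j)) → ¬ ¬ State r
    extend {s₁ = s₁} {s₂} {κ} {t} {r} a b ch κ≉0 t≤1 a∧b≉0 eq k = affine-cases t≤1 λ
      { (inj₁ t-1)       → k (chained (step ch t-1 κ≉0 R.refl R.refl) a b a∧b≉0 eq)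
      ; (inj₂ (e , t≈e)) → k (chained ch (λ j → e K.* a j K.+ b j) (λ j → κ K.* a j) (flipped-det e κ a b κ≉0 a∧b≉0) λ j → begin
          r j                                                                ≈⟨ eq j ⟩
          (t * s₁ + 𝕔 κ * s₂) * 𝕔 (a j) + s₁ * 𝕔 (b j)                 ≈⟨ R.+-congʳ (R.*-congʳ (R.+-congʳ (R.*-congʳ t≈e))) ⟩
          (𝕔 e * s₁ + 𝕔 κ * s₂) * 𝕔 (a j) + s₁ * 𝕔 (b j)               ≈⟨ S.solve 6 (λ e s κ s′ a b →
            (e S.:* s S.:+ κ S.:* s′) S.:* a S.:+ s S.:* b S.:= s S.:* (e S.:* a S.:+ b) S.:+ s′ S.:* (κ S.:* a))
            R.refl (𝕔 e) s₁ (𝕔 κ) s₂ (𝕔 (a j)) (𝕔 (b j)) ⟩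
          s₁ * (𝕔 e * 𝕔 (a j) + 𝕔 (b j)) + s₂ * (𝕔 κ * 𝕔 (a j))        ≈⟨ R.+-cong (R.*-congˡ (𝕔-combination e (a j) (b j))) (R.*-congˡ (𝕔-* κ (a j))) ⟨
          s₁ * 𝕔 (e K.* a j K.+ b j) + s₂ * 𝕔 (κ K.* a j)                 ∎) }

    -- The new pair is `(p s₁ + w s₂) + t ς` and `ς = q s₁ + u s₂`. For nonzero `q`, `ς` is itself a
    -- continuant by `chain-scale`, and the pair is one step further. For `q = 0` it is a multiple
    -- of `s₂`, so instead of appending a step the last one of the old chain is modified.
    advance : ∀ {d s₁ s₂ t r} p q w u (a b : Fin 2 → K.Carrier) → Chain d s₁ s₂ → DegreeAtMost 1 t →
              ¬ p K.* u K.- q K.* w K.≈ K.0# → ¬ a ∧ b K.≈ K.0# →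
              (∀ j → r j ≈ ((𝕔 p * s₁ + 𝕔 w * s₂) + t * (𝕔 q * s₁ + 𝕔 u * s₂)) * 𝕔 (a j)
                           + (𝕔 q * s₁ + 𝕔 u * s₂) * 𝕔 (b j)) → ¬ ¬ State r
    advance {d} {s₁} {s₂} {t} {r} p q w u a b ch t≤1 det≉0 a∧b≉0 eq k = ¬¬-excluded-middle λ
      { (no q≉0)  → generic q≉0
      ; (yes q≈0) → triangular q≈0 ch }
      where
      ς : Carrier
      ς = 𝕔 q * s₁ + 𝕔 u * s₂
      generic : ¬ q K.≈ K.0# → ⊥
      generic q≉0 = extend {κ = κ} {t = t + 𝕔 e} a b (chain-scale q u q≉0 ch) κ≉0 (atMost-+ t≤1 (atMost-mono z≤n (atMost-const e))) a∧b≉0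
        (λ j → R.trans (eq j) (R.+-congʳ (R.*-congʳ rewrite-first))) k
        where
        q⁻¹ = proj₁ (K.inverse q q≉0)
        q*q⁻¹ = proj₂ (K.inverse q q≉0)
        -- Subtracting `e ς` from `p s₁ + w s₂` eliminates `s₁` and leaves `κ s₂`, where `κ` is
        -- minus the determinant divided by `q`.
        e = p K.* q⁻¹
        κ = w K.- e K.* u
        p≈eq : p K.≈ e K.* q
        p≈eq = K.trans (K.sym (K.*-identityʳ p)) (K.trans (K.*-congˡ (K.sym q*q⁻¹))
          (solve 3 (λ p q q⁻¹ → p :* (q :* q⁻¹) := p :* q⁻¹ :* q) K.refl p q q⁻¹))
        w≈ : w K.≈ e K.* u K.+ κ
        w≈ = solve 2 (λ w x → w := x :+ (w :- x)) K.refl w (e K.* u)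
        κ≉0 : ¬ κ K.≈ K.0#
        κ≉0 κ≈0 = det≉0 (K.trans (K.+-cong (K.*-congʳ p≈eq) (K.-‿cong (K.*-congˡ (K.trans w≈ (K.trans (K.+-congˡ κ≈0) (K.+-identityʳ _))))))
          (solve 3 (λ e q u → e :* q :* u :- q :* (e :* u) := con (0 , 0)) K.refl e q u))
        rewrite-first : (𝕔 p * s₁ + 𝕔 w * s₂) + t * ς ≈ (t + 𝕔 e) * ς + 𝕔 κ * s₂
        rewrite-first = begin
          (𝕔 p * s₁ + 𝕔 w * s₂) + t * ς
            ≈⟨ R.+-congʳ {t * ς} (R.+-cong (R.*-congʳ (R.trans (𝕔-cong p≈eq) (𝕔-* e q)))
                 (R.*-congʳ (R.trans (𝕔-cong w≈) (𝕔-combination e u κ)))) ⟩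
          ((𝕔 e * 𝕔 q) * s₁ + (𝕔 e * 𝕔 u + 𝕔 κ) * s₂) + t * ς
            ≈⟨ S.solve 7 (λ e q s u κ s′ t → ((e S.:* q) S.:* s S.:+ (e S.:* u S.:+ κ) S.:* s′) S.:+ t S.:* (q S.:* s S.:+ u S.:* s′) S.:=
                 (t S.:+ e) S.:* (q S.:* s S.:+ u S.:* s′) S.:+ κ S.:* s′) R.refl (𝕔 e) (𝕔 q) s₁ (𝕔 u) (𝕔 κ) s₂ t ⟩
          (t + 𝕔 e) * ς + 𝕔 κ * s₂ ∎
      triangular : ∀ {d} → q K.≈ K.0# → Chain d s₁ s₂ → ⊥
      triangular q≈0 chain = finish chain
        where
        pu≉0 : ¬ p K.* u K.≈ K.0#
        pu≉0 pu≈0 = det≉0 (K.trans (K.+-cong pu≈0 (K.-‿cong (K.trans (K.*-congʳ q≈0) (K.zeroˡ w))))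
          (solve 0 (con (0 , 0) :- con (0 , 0) := con (0 , 0)) K.refl))
        p≉0 : ¬ p K.≈ K.0#
        p≉0 p≈0 = pu≉0 (K.trans (K.*-congʳ p≈0) (K.zeroˡ u))
        u≉0 : ¬ u K.≈ K.0#
        u≉0 u≈0 = pu≉0 (K.trans (K.*-congˡ u≈0) (K.zeroʳ p))
        p⁻¹ = proj₁ (K.inverse p p≉0)
        -- For `q = 0` the first entry of the new pair is `p (s₁ + y s₂)`.
        y : Carrier
        y = 𝕔 p⁻¹ * (𝕔 w + t * 𝕔 u)
        y≤1 : DegreeAtMost 1 y
        y≤1 = atMost-* (atMost-const p⁻¹) (atMost-+ (atMost-mono z≤n (atMost-const w)) (atMost-* t≤1 (atMost-const u)))
        eq′ : ∀ j → r j ≈ (s₁ + y * s₂) * 𝕔 (p K.* a j) + s₂ * 𝕔 (u K.* b j)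
        eq′ j = begin
          r j
            ≈⟨ eq j ⟩
          ((𝕔 p * s₁ + 𝕔 w * s₂) + t * ς) * 𝕔 (a j) + ς * 𝕔 (b j)
            ≈⟨ R.+-cong (R.*-congʳ (R.+-congˡ {𝕔 p * s₁ + 𝕔 w * s₂} (R.*-congˡ {t} ς≈))) (R.*-congʳ ς≈) ⟩
          ((𝕔 p * s₁ + 𝕔 w * s₂) + t * (𝕔 u * s₂)) * 𝕔 (a j) + (𝕔 u * s₂) * 𝕔 (b j)
            ≈⟨ S.solve 8 (λ p s w s′ t u a b → ((p S.:* s S.:+ w S.:* s′) S.:+ t S.:* (u S.:* s′)) S.:* a S.:+ (u S.:* s′) S.:* b S.:=
                 (p S.:* s S.:+ S.con (1 , 0) S.:* (w S.:+ t S.:* u) S.:* s′) S.:* a S.:+ s′ S.:* (u S.:* b))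
                 R.refl (𝕔 p) s₁ (𝕔 w) s₂ t (𝕔 u) (𝕔 (a j)) (𝕔 (b j)) ⟩
          (𝕔 p * s₁ + 1# * (𝕔 w + t * 𝕔 u) * s₂) * 𝕔 (a j) + s₂ * (𝕔 u * 𝕔 (b j))
            ≈⟨ R.+-congʳ {s₂ * (𝕔 u * 𝕔 (b j))} (R.*-congʳ (R.+-congˡ {𝕔 p * s₁} (R.*-congʳ (R.*-congʳ {𝕔 w + t * 𝕔 u} (R.trans (R.sym 𝕔-1) (R.trans (𝕔-cong (K.sym (proj₂ (K.inverse p p≉0)))) (𝕔-* p p⁻¹))))))) ⟩
          (𝕔 p * s₁ + (𝕔 p * 𝕔 p⁻¹) * (𝕔 w + t * 𝕔 u) * s₂) * 𝕔 (a j) + s₂ * (𝕔 u * 𝕔 (b j))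
            ≈⟨ S.solve 7 (λ p s p⁻¹ x s′ a z → (p S.:* s S.:+ (p S.:* p⁻¹) S.:* x S.:* s′) S.:* a S.:+ s′ S.:* z S.:=
                 (s S.:+ (p⁻¹ S.:* x) S.:* s′) S.:* (p S.:* a) S.:+ s′ S.:* z)
                 R.refl (𝕔 p) s₁ (𝕔 p⁻¹) (𝕔 w + t * 𝕔 u) s₂ (𝕔 (a j)) (𝕔 u * 𝕔 (b j)) ⟩
          (s₁ + y * s₂) * (𝕔 p * 𝕔 (a j)) + s₂ * (𝕔 u * 𝕔 (b j))
            ≈⟨ R.+-cong (R.*-congˡ (𝕔-* p (a j))) (R.*-congˡ (𝕔-* u (b j))) ⟨
          (s₁ + y * s₂) * 𝕔 (p K.* a j) + s₂ * 𝕔 (u K.* b j) ∎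
          where
          ς≈ : ς ≈ 𝕔 u * s₂
          ς≈ = R.trans (R.+-congʳ {𝕔 u * s₂} (R.trans (R.*-congʳ (R.trans (𝕔-cong q≈0) 𝕔-0)) (R.zeroˡ s₁))) (R.+-identityˡ _)
        a′∧b′≉0 = scaled-det p u a b p≉0 u≉0 a∧b≉0
        finish : ∀ {d} → Chain d s₁ s₂ → ⊥
        -- There is no last step to modify, but `s₂` is zero, so `y` has no effect.
        finish (base e≉0 s₁≈e s₂≈0) = k (chained
          (base e≉0 (R.trans (R.+-cong s₁≈e (R.trans (R.*-congˡ {y} s₂≈0) (R.zeroʳ y))) (R.+-identityʳ _)) s₂≈0)
          _ _ a′∧b′≉0 eq′)
        -- Adding `y s₂` replaces `f` by `f + y` in the last step. The sum may be constant, so the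
        -- step is redone by `extend` on the shorter chain.
        finish (step {s₁ = s₁′} {s₂′} {a = f} {κ} ch′ f-1 κ≉0 s₁≈ s₂≈) =
          extend {κ = κ} {t = f + y} (λ j → p K.* a j) (λ j → u K.* b j) ch′ κ≉0 (atMost-+ (hasDegree⇒atMost f-1) y≤1) a′∧b′≉0
            (λ j → R.trans (eq′ j) (R.+-cong (R.*-congʳ merge) (R.*-congʳ s₂≈))) k
          where
          merge : s₁ + y * s₂ ≈ (f + y) * s₁′ + 𝕔 κ * s₂′
          merge = R.trans (R.+-cong s₁≈ (R.*-congˡ {y} s₂≈))
            (S.solve 5 (λ f s κs′ y κ → (f S.:* s S.:+ κ S.:* κs′) S.:+ y S.:* s S.:= (f S.:+ y) S.:* s S.:+ κ S.:* κs′)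
              R.refl f s₁′ s₂′ y (𝕔 κ))

  -- With `C` the basis of the state, the entries of `C G` are the constants `p`, `q`, `w`, `u` of
  -- `advance`; their determinant is the product of those of `C` and `G`.
  state-shear : ∀ {r r′ : Fin 2 → Carrier} {t} (G : Fin 2 → Fin 2 → K.Carrier) (a b : Fin 2 → K.Carrier) →
    ¬ G 0F ∧ G 1F K.≈ K.0# → ¬ a ∧ b K.≈ K.0# → DegreeAtMost 1 t →
    (∀ j → r′ j ≈ (r V.⋆ (λ k j → 𝕔 (G k 0F) * 𝕔 (a j) + 𝕔 (G k 1F) * (t * 𝕔 (a j) + 𝕔 (b j)))) j) →
    State r → ¬ ¬ State r′
  state-shear {t = t} G a b _ _ _ eq (vanishing r≈0) k = k (vanishing λ j →
    R.trans (eq j) (R.trans (R.+-cong (R.trans (R.*-congʳ (r≈0 0F)) (R.zeroˡ _)) (R.trans (R.*-congʳ (r≈0 1F)) (R.zeroˡ _))) (R.+-identityʳ _)))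
  state-shear {r} {r′} {t} G a b G≉0 a∧b≉0 t≤1 eq (chained {s₁ = s₁} {s₂} ch C₁ C₂ C≉0 r≈) =
    advance (entry C₁ 0F) (entry C₁ 1F) (entry C₂ 0F) (entry C₂ 1F) a b ch t≤1
      (λ det≈0 → *-≉0 C≉0 G≉0 (K.trans (solve 8 (λ x y z w g h i j → (x :* w :- y :* z) :* (g :* j :- h :* i) :=
          (x :* g :+ y :* i) :* (z :* h :+ w :* j) :- (x :* h :+ y :* j) :* (z :* g :+ w :* i)) K.refl
          (C₁ 0F) (C₁ 1F) (C₂ 0F) (C₂ 1F) (G 0F 0F) (G 0F 1F) (G 1F 0F) (G 1F 1F)) det≈0))
      a∧b≉0
      λ j → begin
        r′ j
          ≈⟨ eq j ⟩
        r 0F * _ + r 1F * _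
          ≈⟨ R.+-cong (R.*-congʳ (r≈ 0F)) (R.*-congʳ (r≈ 1F)) ⟩
        (s₁ * 𝕔 (C₁ 0F) + s₂ * 𝕔 (C₂ 0F)) * (𝕔 (G 0F 0F) * 𝕔 (a j) + 𝕔 (G 0F 1F) * (t * 𝕔 (a j) + 𝕔 (b j)))
          + (s₁ * 𝕔 (C₁ 1F) + s₂ * 𝕔 (C₂ 1F)) * (𝕔 (G 1F 0F) * 𝕔 (a j) + 𝕔 (G 1F 1F) * (t * 𝕔 (a j) + 𝕔 (b j)))
          ≈⟨ regroup s₁ s₂ t (𝕔 (C₁ 0F)) (𝕔 (C₁ 1F)) (𝕔 (C₂ 0F)) (𝕔 (C₂ 1F)) (𝕔 (G 0F 0F)) (𝕔 (G 0F 1F)) (𝕔 (G 1F 0F)) (𝕔 (G 1F 1F)) (𝕔 (a j)) (𝕔 (b j)) ⟩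
        _ ≈⟨ R.+-cong (R.*-congʳ (R.+-cong (R.+-cong (R.*-congʳ (entry≈ C₁ 0F)) (R.*-congʳ (entry≈ C₂ 0F))) (R.*-congˡ {t} second))) (R.*-congʳ second) ⟨
        _ ∎
    where
    entry : (Fin 2 → K.Carrier) → Fin 2 → K.Carrier
    entry C i = C 0F K.* G 0F i K.+ C 1F K.* G 1F i
    entry≈ : ∀ C i → 𝕔 (entry C i) ≈ 𝕔 (C 0F) * 𝕔 (G 0F i) + 𝕔 (C 1F) * 𝕔 (G 1F i)
    entry≈ C i = R.trans (𝕔-+ _ _) (R.+-cong (𝕔-* _ _) (𝕔-* _ _))
    second : 𝕔 (entry C₁ 1F) * s₁ + 𝕔 (entry C₂ 1F) * s₂ ≈
      (𝕔 (C₁ 0F) * 𝕔 (G 0F 1F) + 𝕔 (C₁ 1F) * 𝕔 (G 1F 1F)) * s₁ + (𝕔 (C₂ 0F) * 𝕔 (G 0F 1F) + 𝕔 (C₂ 1F) * 𝕔 (G 1F 1F)) * s₂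
    second = R.+-cong (R.*-congʳ (entry≈ C₁ 1F)) (R.*-congʳ (entry≈ C₂ 1F))
    regroup : ∀ s s′ t x y z w g h i j a b →
      (s * x + s′ * z) * (g * a + h * (t * a + b)) + (s * y + s′ * w) * (i * a + j * (t * a + b)) ≈
      (((x * g + y * i) * s + (z * g + w * i) * s′) + t * ((x * h + y * j) * s + (z * h + w * j) * s′)) * a
        + ((x * h + y * j) * s + (z * h + w * j) * s′) * b
    regroup = S.solve 13 (λ s s′ t x y z w g h i j a b →
      (s S.:* x S.:+ s′ S.:* z) S.:* (g S.:* a S.:+ h S.:* (t S.:* a S.:+ b)) S.:+ (s S.:* y S.:+ s′ S.:* w) S.:* (i S.:* a S.:+ j S.:* (t S.:* a S.:+ b)) S.:=
      (((x S.:* g S.:+ y S.:* i) S.:* s S.:+ (z S.:* g S.:+ w S.:* i) S.:* s′) S.:+ t S.:* ((x S.:* h S.:+ y S.:* j) S.:* s S.:+ (z S.:* h S.:+ w S.:* j) S.:* s′)) S.:* a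
        S.:+ ((x S.:* h S.:+ y S.:* j) S.:* s S.:+ (z S.:* h S.:+ w S.:* j) S.:* s′) S.:* b) R.refl

  -- A chain of degree two is a product of affine polynomials up to a constant.
  module _ {T : Carrier}
           (not-product : ∀ {f g} γ → DegreeAtMost 1 f → DegreeAtMost 1 g → ¬ T ≈ f * g + 𝕔 γ)
           (quadratic : ∀ {d} → HasDegree d T → d ≡ 2) where

    private
      not-chain : ∀ {d s} → ¬ Chain d T s
      not-chain ch with quadratic (chain-degree ch)
      not-chain (step {a = a} {κ} (step {a = a′} (base {e = e} _ s₁≈e s₂≈0) a′-1 _ u₁≈ u₂≈) a-1 _ T≈ _) | ≡.refl =
        not-product (κ K.* e) (hasDegree⇒atMost a-1) (atMost-* (hasDegree⇒atMost a′-1) (atMost-const e))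
          (R.trans T≈ (R.+-cong
            (R.*-congˡ {a} (R.trans u₁≈ (R.trans (R.+-cong (R.*-congˡ {a′} s₁≈e) (R.trans (R.*-congˡ s₂≈0) (R.zeroʳ _))) (R.+-identityʳ _))))
            (R.trans (R.*-congˡ (R.trans u₂≈ s₁≈e)) (R.sym (𝕔-* κ e)))))

      not-zero : ¬ T ≈ 0#
      not-zero T≈0 = not-product {0#} {0#} K.0# atMost-0 atMost-0
        (R.trans T≈0 (R.sym (R.trans (R.+-cong (R.zeroˡ 0#) 𝕔-0) (R.+-identityʳ 0#))))

      not-first : ∀ {d s₁ s₂} q → Chain d s₁ s₂ → ¬ T ≈ 𝕔 q * s₁
      not-first {s₁ = s₁} {s₂} q ch eq = ¬¬-excluded-middle λ
        { (yes q≈0) → not-zero (R.trans eq (R.trans (R.*-congʳ (R.trans (𝕔-cong q≈0) 𝕔-0)) (R.zeroˡ s₁)))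
        ; (no q≉0)  → not-chain (chain-cong (R.sym (R.trans eq (R.sym (R.trans (R.+-congˡ {𝕔 q * s₁} (R.trans (R.*-congʳ 𝕔-0) (R.zeroˡ s₂))) (R.+-identityʳ _)))))
            (chain-scale q K.0# q≉0 ch)) }

      -- A constant combination of consecutive continuants is zero or again a continuant: for
      -- `q = 0` it is a multiple of the previous one.
      not-combination : ∀ {d s₁ s₂} q u → Chain d s₁ s₂ → ¬ T ≈ 𝕔 q * s₁ + 𝕔 u * s₂
      not-combination {s₁ = s₁} {s₂} q u ch eq = ¬¬-excluded-middle λ
        { (no q≉0)  → not-chain (chain-cong (R.sym eq) (chain-scale q u q≉0 ch))
        ; (yes q≈0) → second ch (R.trans eq (R.trans (R.+-congʳ {𝕔 u * s₂} (R.trans (R.*-congʳ (R.trans (𝕔-cong q≈0) 𝕔-0)) (R.zeroˡ s₁))) (R.+-identityˡ _))) }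
        where
        second : ∀ {d} → Chain d s₁ s₂ → ¬ T ≈ 𝕔 u * s₂
        second (base _ _ s₂≈0) T≈          = not-zero (R.trans T≈ (R.trans (R.*-congˡ s₂≈0) (R.zeroʳ _)))
        second (step ch′ _ _ _ s₂≈) T≈     = not-first u ch′ (R.trans T≈ (R.*-congˡ s₂≈))

    state-misses : ∀ {r} (u : Fin 2 → K.Carrier) → State r → ¬ T ≈ r V.∙ (𝕔 ∘ u)
    state-misses u (vanishing r≈0) T≈ = not-zero (R.trans T≈
      (R.trans (R.+-cong (R.trans (R.*-congʳ (r≈0 0F)) (R.zeroˡ _)) (R.trans (R.*-congʳ (r≈0 1F)) (R.zeroˡ _))) (R.+-identityʳ _)))
    state-misses {r} u (chained {s₁ = s₁} {s₂} ch C₁ C₂ _ r≈) T≈ =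
      not-combination (entry C₁) (entry C₂) ch (begin
        T                                                 ≈⟨ T≈ ⟩
        r 0F * 𝕔 (u 0F) + r 1F * 𝕔 (u 1F)               ≈⟨ R.+-cong (R.*-congʳ (r≈ 0F)) (R.*-congʳ (r≈ 1F)) ⟩
        _                                                 ≈⟨ S.solve 8 (λ s s′ x y z w u v →
          (s S.:* x S.:+ s′ S.:* z) S.:* u S.:+ (s S.:* y S.:+ s′ S.:* w) S.:* v S.:= (x S.:* u S.:+ y S.:* v) S.:* s S.:+ (z S.:* u S.:+ w S.:* v) S.:* s′)
          R.refl s₁ s₂ (𝕔 (C₁ 0F)) (𝕔 (C₁ 1F)) (𝕔 (C₂ 0F)) (𝕔 (C₂ 1F)) (𝕔 (u 0F)) (𝕔 (u 1F)) ⟩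
        _                                                 ≈⟨ R.+-cong (R.*-congʳ (entry≈ C₁)) (R.*-congʳ (entry≈ C₂)) ⟨
        𝕔 (entry C₁) * s₁ + 𝕔 (entry C₂) * s₂          ∎)
      where
      entry : (Fin 2 → K.Carrier) → K.Carrier
      entry C = C 0F K.* u 0F K.+ C 1F K.* u 1F
      entry≈ : ∀ C → 𝕔 (entry C) ≈ 𝕔 (C 0F) * 𝕔 (u 0F) + 𝕔 (C 1F) * 𝕔 (u 1F)
      entry≈ C = R.trans (𝕔-+ _ _) (R.+-cong (𝕔-* _ _) (𝕔-* _ _))

-- Quadratic extensions and roots of polynomials of degree at most two.

IsMonicRoot : ∀ {c ℓ} (K : Field c ℓ) (β γ s : Field.Carrier K) → Set ℓ
IsMonicRoot K β γ s = s * s + β * s + γ ≈ 0#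
  where open Field K

-- K[θ] with θ² + β θ + γ = 0, where x + y θ is encoded as (x , y).
module QuadraticExtension {c ℓ} (K : Field c ℓ) (β γ : Field.Carrier K)
  (irreducible : ∀ s → ¬ IsMonicRoot K β γ s) where
  open Field K
  open FieldProperties K
  open IntegerRingSolver commutativeRing

  private
    infix 4 _≈²_
    _≈²_ : Carrier × Carrier → Carrier × Carrier → Set ℓ
    (x , y) ≈² (z , w) = x ≈ z × y ≈ w

    infixl 6 _+²_
    _+²_ : Carrier × Carrier → Carrier × Carrier → Carrier × Carrier
    (x , y) +² (z , w) = x + z , y + w

    infixl 7 _*²_
    _*²_ : Carrier × Carrier → Carrier × Carrier → Carrier × Carrier
    (x , y) *² (z , w) = x * z - γ * (y * w) , x * w + y * z - β * (y * w)

    *²-comm : ∀ p q → p *² q ≈² q *² p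
    *²-comm (x , y) (z , w) =
      solve 5 (λ γ x y z w → x :* z :- γ :* (y :* w) := z :* x :- γ :* (w :* y)) refl γ x y z w ,
      solve 5 (λ β x y z w → x :* w :+ y :* z :- β :* (y :* w) := z :* y :+ w :* x :- β :* (w :* y)) refl β x y z w

    *²-assoc : ∀ p q r → (p *² q) *² r ≈² p *² (q *² r)
    *²-assoc (x , y) (z , w) (u , v) =
      solve 8 (λ β γ x y z w u v →
        (x :* z :- γ :* (y :* w)) :* u :- γ :* ((x :* w :+ y :* z :- β :* (y :* w)) :* v) :=
        x :* (z :* u :- γ :* (w :* v)) :- γ :* (y :* (z :* v :+ w :* u :- β :* (w :* v)))) refl β γ x y z w u v ,
      solve 8 (λ β γ x y z w u v →
        (x :* z :- γ :* (y :* w)) :* v :+ (x :* w :+ y :* z :- β :* (y :* w)) :* u :- β :* ((x :* w :+ y :* z :- β :* (y :* w)) :* v) :=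
        x :* (z :* v :+ w :* u :- β :* (w :* v)) :+ y :* (z :* u :- γ :* (w :* v)) :- β :* (y :* (z :* v :+ w :* u :- β :* (w :* v))))
        refl β γ x y z w u v

    *²-identityˡ : ∀ p → (1# , 0#) *² p ≈² p
    *²-identityˡ (x , y) =
      solve 3 (λ γ x y → con (1 , 0) :* x :- γ :* (con (0 , 0) :* y) := x) refl γ x y ,
      solve 3 (λ β x y → con (1 , 0) :* y :+ con (0 , 0) :* x :- β :* (con (0 , 0) :* y) := y) refl β x y

    distribʳ² : ∀ r p q → (p +² q) *² r ≈² p *² r +² q *² r
    distribʳ² (u , v) (x , y) (z , w) =
      solve 7 (λ γ x y z w u v → (x :+ z) :* u :- γ :* ((y :+ w) :* v) :=
        (x :* u :- γ :* (y :* v)) :+ (z :* u :- γ :* (w :* v))) refl γ x y z w u v ,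
      solve 7 (λ β x y z w u v → (x :+ z) :* v :+ (y :+ w) :* u :- β :* ((y :+ w) :* v) :=
        (x :* v :+ y :* u :- β :* (y :* v)) :+ (z :* v :+ w :* u :- β :* (w :* v))) refl β x y z w u v

    trans² : ∀ {p q r} → p ≈² q → q ≈² r → p ≈² r
    trans² (e , e′) (f , f′) = trans e f , trans e′ f′

    +²-cong : ∀ {p q r s} → p ≈² q → r ≈² s → p +² r ≈² q +² s
    +²-cong (e , e′) (f , f′) = +-cong e f , +-cong e′ f′

    extensionRing : CommutativeRing c ℓ
    extensionRing = record
      { Carrier = Carrier × Carrier
      ; _≈_ = _≈²_
      ; _+_ = _+²_
      ; _*_ = _*²_
      ; -_ = λ { (x , y) → - x , - y }
      ; 0# = 0# , 0#
      ; 1# = 1# , 0#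
      ; isCommutativeRing = record
        { isRing = record
          { +-isAbelianGroup = record
            { isGroup = record
              { isMonoid = record
                { isSemigroup = record
                  { isMagma = record
                    { isEquivalence = record
                      { refl = refl , refl ; sym = λ { (e , e′) → sym e , sym e′ } ; trans = trans² }
                    ; ∙-cong = +²-cong }
                  ; assoc = λ _ _ _ → +-assoc _ _ _ , +-assoc _ _ _ }
                ; identity = (λ _ → +-identityˡ _ , +-identityˡ _) , λ _ → +-identityʳ _ , +-identityʳ _ }
              ; inverse = (λ _ → -‿inverseˡ _ , -‿inverseˡ _) , λ _ → -‿inverseʳ _ , -‿inverseʳ _
              ; ⁻¹-cong = λ { (e , e′) → -‿cong e , -‿cong e′ } }
            ; comm = λ _ _ → +-comm _ _ , +-comm _ _ }
          ; *-cong = λ { (e , e′) (f , f′) →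
              +-cong (*-cong e f) (-‿cong (*-congˡ (*-cong e′ f′))) ,
              +-cong (+-cong (*-cong e f′) (*-cong e′ f)) (-‿cong (*-congˡ (*-cong e′ f′))) }
          ; *-assoc = *²-assoc
          ; *-identity = *²-identityˡ , λ p → trans² (*²-comm p _) (*²-identityˡ p)
          ; distrib = (λ r p q → trans² (*²-comm r (p +² q)) (trans² (distribʳ² r p q)
                        (+²-cong (*²-comm p r) (*²-comm q r)))) , distribʳ²
          }
        ; *-comm = *²-comm
        }
      }

    -- The product of `x + y θ` and its conjugate `(x - β y) - y θ`; inverses are conjugates divided
    -- by it.
    norm : Carrier → Carrier → Carrier
    norm x y = x * x - β * (x * y) + γ * (y * y)

    -- For nonzero `y`, dividing by `y²` shows that a vanishing norm makes `- x / y` a root of the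
    -- polynomial; for `y = 0` the norm is `x²`.
    norm≉0 : ∀ x y → ¬ (x , y) ≈² (0# , 0#) → ¬ norm x y ≈ 0#
    norm≉0 x y xy≉0 N≈0 = ¬¬-excluded-middle λ
      { (yes y≈0) → ¬¬-excluded-middle λ
        { (yes x≈0) → xy≉0 (x≈0 , y≈0)
        ; (no x≉0)  → *-≉0 x≉0 x≉0 (trans
            (solve 3 (λ β γ x → x :* x := x :* x :- β :* (x :* con (0 , 0)) :+ γ :* (con (0 , 0) :* con (0 , 0))) refl β γ x)
            (trans (+-cong (+-congˡ (-‿cong (*-congˡ (*-congˡ (sym y≈0))))) (*-congˡ (*-cong (sym y≈0) (sym y≈0)))) N≈0)) }
      ; (no y≉0) → let (y⁻¹ , yy⁻¹≈1) = inverse y y≉0 in irreducible (- (x * y⁻¹)) (begin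
          - (x * y⁻¹) * - (x * y⁻¹) + β * - (x * y⁻¹) + γ
            ≈⟨ solve 4 (λ β γ x y⁻¹ → :- (x :* y⁻¹) :* :- (x :* y⁻¹) :+ β :* :- (x :* y⁻¹) :+ γ :=
                 (x :* y⁻¹) :* (x :* y⁻¹) :- β :* (x :* y⁻¹) :* con (1 , 0) :+ γ :* (con (1 , 0) :* con (1 , 0))) refl β γ x y⁻¹ ⟩
          (x * y⁻¹) * (x * y⁻¹) - β * (x * y⁻¹) * 1# + γ * (1# * 1#)
            ≈⟨ +-cong (+-congˡ (-‿cong (*-congˡ yy⁻¹≈1))) (*-congˡ (*-cong yy⁻¹≈1 yy⁻¹≈1)) ⟨
          (x * y⁻¹) * (x * y⁻¹) - β * (x * y⁻¹) * (y * y⁻¹) + γ * ((y * y⁻¹) * (y * y⁻¹))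
            ≈⟨ solve 5 (λ β γ x y y⁻¹ → (x :* y⁻¹) :* (x :* y⁻¹) :- β :* (x :* y⁻¹) :* (y :* y⁻¹) :+ γ :* ((y :* y⁻¹) :* (y :* y⁻¹)) :=
                 (y⁻¹ :* y⁻¹) :* (x :* x :- β :* (x :* y) :+ γ :* (y :* y))) refl β γ x y y⁻¹ ⟩
          (y⁻¹ * y⁻¹) * norm x y
            ≈⟨ trans (*-congˡ N≈0) (zeroʳ _) ⟩
          0# ∎) }
      where open import Relation.Binary.Reasoning.Setoid setoid

  extension : Field c ℓ
  extension = record
    { commutativeRing = extensionRing
    ; 1≉0     = λ { (1≈0 , _) → 1≉0 1≈0 }
    ; inverse = λ { (x , y) xy≉0 →
        let (N⁻¹ , NN⁻¹≈1) = inverse (norm x y) (norm≉0 x y xy≉0) in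
        ((x - β * y) * N⁻¹ , - y * N⁻¹) ,
        (trans (solve 5 (λ β γ x y N⁻¹ → x :* ((x :- β :* y) :* N⁻¹) :- γ :* (y :* (:- y :* N⁻¹)) :=
          (x :* x :- β :* (x :* y) :+ γ :* (y :* y)) :* N⁻¹) refl β γ x y N⁻¹) NN⁻¹≈1 ,
         solve 4 (λ β x y N⁻¹ → x :* (:- y :* N⁻¹) :+ y :* ((x :- β :* y) :* N⁻¹) :- β :* (y :* (:- y :* N⁻¹)) := con (0 , 0)) refl β x y N⁻¹) } }

  embedding : Hom commutativeRing extensionRing
  embedding = record
    { fun    = λ x → x , 0#
    ; cong   = λ e → e , refl
    ; +-homo = λ _ _ → refl , sym (+-identityˡ 0#)
    ; *-homo = λ x y → solve 3 (λ γ x y → x :* y := x :* y :- γ :* (con (0 , 0) :* con (0 , 0))) refl γ x y ,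
        solve 3 (λ β x y → con (0 , 0) := x :* con (0 , 0) :+ con (0 , 0) :* y :- β :* (con (0 , 0) :* con (0 , 0))) refl β x y
    ; 0-homo = refl , refl
    ; 1-homo = refl , refl
    }

  private module E = Field extension

  root : E.Carrier
  root = 0# , 1#

  root-equation : root E.* root E.+ Hom.fun embedding β E.* root E.+ Hom.fun embedding γ E.≈ E.0#
  root-equation =
    solve 2 (λ β γ → (con (0 , 0) :* con (0 , 0) :- γ :* (con (1 , 0) :* con (1 , 0)))
      :+ (β :* con (0 , 0) :- γ :* (con (0 , 0) :* con (1 , 0))) :+ γ := con (0 , 0)) refl β γ ,
    solve 1 (λ β → (con (0 , 0) :* con (1 , 0) :+ con (1 , 0) :* con (0 , 0) :- β :* (con (1 , 0) :* con (1 , 0)))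
      :+ (β :* con (1 , 0) :+ con (0 , 0) :* con (0 , 0) :- β :* (con (0 , 0) :* con (1 , 0))) :+ con (0 , 0) := con (0 , 0)) refl β

-- The extension may be `K` itself. It has the universe levels of `K`, so that the main induction
-- can continue over it.
record QuadraticRoot {c ℓ} (K : Field c ℓ) (A B C : Field.Carrier K) : Set (Level.suc (c ⊔ ℓ)) where
  field
    extension : Field c ℓ
    embedding : Hom (Field.commutativeRing K) (Field.commutativeRing extension)
    root      : Field.Carrier extension
  open Field extension
  open Hom embedding
  field
    root-equation : fun A * (root * root) + fun B * root + fun C ≈ 0#

module _ {c ℓ} (K : Field c ℓ) where
  open Field K
  open FieldProperties K
  open IntegerRingSolver commutativeRing

  root-in-K : ∀ {A B C} s → A * (s * s) + B * s + C ≈ 0# → QuadraticRoot K A B C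
  root-in-K s eq = record { extension = K ; embedding = idʰ commutativeRing ; root = s ; root-equation = eq }

  monic-root : ∀ {A A⁻¹ B C} → A * A⁻¹ ≈ 1# → ∀ (E : Field c ℓ) (ψ : Hom commutativeRing (Field.commutativeRing E)) θ →
    IsMonicRoot E (Hom.fun ψ (A⁻¹ * B)) (Hom.fun ψ (A⁻¹ * C)) θ →
    QuadraticRoot K A B C
  monic-root {A} {A⁻¹} {B} {C} AA⁻¹≈1 E ψ θ eq = record
    { extension = E ; embedding = ψ ; root = θ
    ; root-equation = E.trans (E.+-cong (E.+-congˡ (E.*-congʳ (expand B))) (expand C))
        (E.trans (S.solve 4 (λ A B C s → A S.:* (s S.:* s) S.:+ (A S.:* B) S.:* s S.:+ A S.:* C S.:=
            A S.:* (s S.:* s S.:+ B S.:* s S.:+ C)) E.refl (fun A) (fun (A⁻¹ * B)) (fun (A⁻¹ * C)) θ)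
          (E.trans (E.*-congˡ eq) (E.zeroʳ (fun A)))) }
    where
    module E = Field E
    module S = IntegerRingSolver E.commutativeRing
    open Hom ψ using (fun; *-homo; cong)
    expand : ∀ x → fun x E.≈ fun A E.* fun (A⁻¹ * x)
    expand x = E.trans (cong (trans (sym (*-identityˡ x)) (trans (*-congʳ (sym AA⁻¹≈1)) (*-assoc A A⁻¹ x))))
      (*-homo A (A⁻¹ * x))

  -- If `A` is nonzero and there is no root in `K`, the monic polynomial is irreducible and
  -- adjoining a root yields a field. Lower degrees need no extension.
  root-or-constant : ∀ A B C → ¬ ¬ (QuadraticRoot K A B C ⊎ A ≈ 0# × B ≈ 0# × ¬ C ≈ 0#)
  root-or-constant A B C k = ¬¬-excluded-middle λ
    { (no A≉0)  → quadratic A≉0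
    ; (yes A≈0) → ¬¬-excluded-middle λ
      { (no B≉0)  → linear A≈0 B≉0
      ; (yes B≈0) → ¬¬-excluded-middle λ
        { (no C≉0)  → k (inj₂ (A≈0 , B≈0 , C≉0))
        ; (yes C≈0) → k (inj₁ (root-in-K 0# (trans (+-cong (+-cong (*-congʳ A≈0) (*-congʳ B≈0)) C≈0)
            (solve 0 (con (0 , 0) :* (con (0 , 0) :* con (0 , 0)) :+ con (0 , 0) :* con (0 , 0) :+ con (0 , 0) := con (0 , 0)) refl)))) } } }
    where
    linear : A ≈ 0# → ¬ B ≈ 0# → ⊥
    linear A≈0 B≉0 = let (B⁻¹ , BB⁻¹≈1) = inverse B B≉0 in k (inj₁ (root-in-K (- (B⁻¹ * C))
      (trans (+-congʳ (+-congʳ (*-congʳ A≈0)))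
        (trans (solve 3 (λ B B⁻¹ C → con (0 , 0) :* (:- (B⁻¹ :* C) :* :- (B⁻¹ :* C)) :+ B :* :- (B⁻¹ :* C) :+ C := C :- (B :* B⁻¹) :* C) refl B B⁻¹ C)
          (trans (+-congˡ (-‿cong (*-congʳ BB⁻¹≈1)))
            (solve 1 (λ C → C :- con (1 , 0) :* C := con (0 , 0)) refl C))))))
    quadratic : ¬ A ≈ 0# → ⊥
    quadratic A≉0 = ¬¬-excluded-middle {A = Σ[ s ∈ Carrier ] IsMonicRoot K (A⁻¹ * B) (A⁻¹ * C) s} λ
      { (yes (s , s-root)) → k (inj₁ (monic-root AA⁻¹≈1 K (idʰ commutativeRing) s s-root))
      ; (no no-root) → adjoin (λ s eq → no-root (s , eq)) }
      where
      A⁻¹ = proj₁ (inverse A A≉0)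
      AA⁻¹≈1 = proj₂ (inverse A A≉0)
      adjoin : (∀ s → ¬ IsMonicRoot K (A⁻¹ * B) (A⁻¹ * C) s) → ⊥
      adjoin irreducible = k (inj₁ (monic-root AA⁻¹≈1 Q.extension Q.embedding Q.root Q.root-equation))
        where
        module Q = QuadraticExtension K (A⁻¹ * B) (A⁻¹ * C) irreducible

-- Linear algebra in the plane.

⟨_,_⟩ : ∀ {a} {A : Set a} → A → A → Fin 2 → A
⟨ x , y ⟩ 0F = x
⟨ x , y ⟩ 1F = y

module Plane {c ℓ} (K : Field c ℓ) where
  open Field K
  open FieldProperties K
  open IntegerRingSolver commutativeRing
  open PlaneVectors commutativeRing public using (_∧_)

  Vanishes : (Fin 2 → Carrier) → Set ℓ
  Vanishes v = v 0F ≈ 0# × v 1F ≈ 0#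

  ∧-cong : ∀ {u u′ v v′} → (∀ j → u j ≈ u′ j) → (∀ j → v j ≈ v′ j) → u ∧ v ≈ u′ ∧ v′
  ∧-cong u≈ v≈ = +-cong (*-cong (u≈ 0F) (v≈ 1F)) (-‿cong (*-cong (u≈ 1F) (v≈ 0F)))

  ∧≉0⇒nonvanishingˡ : ∀ u v → ¬ u ∧ v ≈ 0# → ¬ Vanishes u
  ∧≉0⇒nonvanishingˡ u v u∧v≉0 (u₀≈0 , u₁≈0) = u∧v≉0
    (trans (+-cong (*-congʳ u₀≈0) (-‿cong (*-congʳ u₁≈0)))
      (solve 2 (λ x y → con (0 , 0) :* x :- con (0 , 0) :* y := con (0 , 0)) refl _ _))

  -- Cramer's rule. The inverse `e` of the determinant is returned because the classification below
  -- computes with the individual coordinates.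
  coordinates : ∀ a b → ¬ a ∧ b ≈ 0# → ∀ v →
    Σ[ e ∈ Carrier ] (a ∧ b) * e ≈ 1# × (∀ j → v j ≈ ((v ∧ b) * e) * a j + ((a ∧ v) * e) * b j)
  coordinates a b a∧b≉0 v = e , inv , λ
    { 0F → cramer 0F (solve 6 (λ a₀ a₁ b₀ b₁ v₀ v₁ → (a₀ :* b₁ :- a₁ :* b₀) :* v₀ :=
             (v₀ :* b₁ :- v₁ :* b₀) :* a₀ :+ (a₀ :* v₁ :- a₁ :* v₀) :* b₀) refl (a 0F) (a 1F) (b 0F) (b 1F) (v 0F) (v 1F))
    ; 1F → cramer 1F (solve 6 (λ a₀ a₁ b₀ b₁ v₀ v₁ → (a₀ :* b₁ :- a₁ :* b₀) :* v₁ :=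
             (v₀ :* b₁ :- v₁ :* b₀) :* a₁ :+ (a₀ :* v₁ :- a₁ :* v₀) :* b₁) refl (a 0F) (a 1F) (b 0F) (b 1F) (v 0F) (v 1F)) }
    where
    e = proj₁ (inverse _ a∧b≉0)
    inv = proj₂ (inverse _ a∧b≉0)
    cramer : ∀ j → (a ∧ b) * v j ≈ (v ∧ b) * a j + (a ∧ v) * b j → v j ≈ ((v ∧ b) * e) * a j + ((a ∧ v) * e) * b j
    cramer j eq = trans (sym (*-identityˡ _)) (trans (*-congʳ (sym inv))
      (trans (solve 3 (λ d e v → d :* e :* v := e :* (d :* v)) refl (a ∧ b) e (v j))
        (trans (*-congˡ eq) (solve 5 (λ e x a y b → e :* (x :* a :+ y :* b) := x :* e :* a :+ y :* e :* b) refl e (v ∧ b) (a j) (a ∧ v) (b j)))))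

  multiple : ∀ a b → ¬ a ∧ b ≈ 0# → ∀ v → a ∧ v ≈ 0# → Σ[ μ ∈ Carrier ] (∀ j → v j ≈ μ * a j)
  multiple a b a∧b≉0 v a∧v≈0 with coordinates a b a∧b≉0 v
  ... | e , _ , eq = (v ∧ b) * e , λ j → trans (eq j) (trans (+-congˡ (*-congʳ (*-congʳ a∧v≈0)))
        (solve 3 (λ x e b → x :+ con (0 , 0) :* e :* b := x) refl _ e (b j)))

  -- One of the unit vectors completes `u` to a basis, in which `v` has no second coordinate.
  parallel : ∀ {u v} → ¬ Vanishes u → u ∧ v ≈ 0# → ¬ ¬ (Σ[ μ ∈ Carrier ] (∀ j → v j ≈ μ * u j))
  parallel {u} {v} u≉0 u∧v≈0 k = ¬¬-excluded-middle λ
    { (no u₀≉0)  → k (multiple u ⟨ 0# , 1# ⟩ (λ eq → u₀≉0 (trans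
        (solve 2 (λ x y → x := x :* con (1 , 0) :- y :* con (0 , 0)) refl (u 0F) (u 1F)) eq)) v u∧v≈0)
    ; (yes u₀≈0) → k (multiple u ⟨ 1# , 0# ⟩ (λ eq → u≉0 (u₀≈0 , trans
        (solve 2 (λ x y → y := x :* con (0 , 0) :+ :- (x :* con (0 , 0) :- y :* con (1 , 0))) refl (u 0F) (u 1F))
        (trans (+-congˡ (-‿cong eq)) (solve 1 (λ x → x :* con (0 , 0) :+ :- con (0 , 0) := con (0 , 0)) refl (u 0F))))) v u∧v≈0) }

-- Polynomial rings over varying fields, and partial assignments.

module AlgebraRing {c ℓ} {K : Field c ℓ} (A : DegreeAlgebra K) where
  open CommutativeRing (DegreeAlgebra.ring A) public hiding (ring; zero)
  open Hom (DegreeAlgebra.constant A) public using () renaming (fun to 𝕔)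

-- All fields at once, since making a determinant vanish may require a quadratic extension.
record PolynomialModel (c ℓ : Level) (n : ℕ) : Set (Level.suc (c ⊔ ℓ)) where
  field
    algebra : (K : Field c ℓ) → DegreeAlgebra K

  ring : Field c ℓ → CommutativeRing c ℓ
  ring K = DegreeAlgebra.ring (algebra K)

  field
    var          : ∀ K → Fin n → AlgebraRing.Carrier (algebra K)
    atMost-var   : ∀ K i → DegreeAlgebra.DegreeAtMost (algebra K) 1 (var K i)
    substitution : ∀ {K K′} → Hom (Field.commutativeRing K) (Field.commutativeRing K′) →
                   (Fin n → AlgebraRing.Carrier (algebra K′)) → Hom (ring K) (ring K′)
    subst-const  : ∀ {K K′} ψ e a → AlgebraRing._≈_ (algebra K′)
                   (Hom.fun (substitution {K} {K′} ψ e) (AlgebraRing.𝕔 (algebra K) a)) (AlgebraRing.𝕔 (algebra K′) (Hom.fun ψ a))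
    subst-var    : ∀ {K K′} ψ e i → AlgebraRing._≈_ (algebra K′) (Hom.fun (substitution {K} {K′} ψ e) (var K i)) (e i)

  module Ring (K : Field c ℓ) = AlgebraRing (algebra K)

module Specialisations {c ℓ n} (model : PolynomialModel c ℓ n) where
  open PolynomialModel model

  Embedding : Field c ℓ → Field c ℓ → Set (c ⊔ ℓ)
  Embedding K K′ = Hom (Field.commutativeRing K) (Field.commutativeRing K′)

  idᵉ : ∀ {K} → Embedding K K
  idᵉ {K} = idʰ (Field.commutativeRing K)

  point : ∀ K → Assignment K n → Fin n → Ring.Carrier K
  point K ρ i = maybe (Ring.𝕔 K) (var K i) (ρ i)

  point-just : ∀ {K ρ i s} → ρ i ≡ just s → point K ρ i ≡ Ring.𝕔 K s
  point-just eq = ≡.cong (maybe _ _) eq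

  affine-point : ∀ K ρ i → DegreeAlgebra.DegreeAtMost (algebra K) 1 (point K ρ i)
  affine-point K ρ i with ρ i
  ... | just s  = DegreeAlgebra.atMost-mono (algebra K) z≤n (DegreeAlgebra.atMost-const (algebra K) s)
  ... | nothing = atMost-var K i

  -- `ρ′` extends `ρ` along the embedding and may assign further variables.
  Agrees : ∀ {K K′} → Embedding K K′ → Assignment K n → Assignment K′ n → Set (c ⊔ ℓ)
  Agrees {K} {K′} ψ ρ ρ′ = ∀ i s → ρ i ≡ just s → Σ[ s′ ∈ Field.Carrier K′ ] ρ′ i ≡ just s′ × Field._≈_ K′ s′ (Hom.fun ψ s)

  specialise : ∀ {K K′} → Embedding K K′ → Assignment K′ n → Hom (ring K) (ring K′)
  specialise {K′ = K′} ψ ρ′ = substitution ψ (point K′ ρ′)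

  -- A variable assigned by `ρ` has already become a constant and only gets embedded, so restricting
  -- in two stages is the same as restricting by `ρ′` at once.
  specialise-point : ∀ {K K′} {ψ : Embedding K K′} {ρ ρ′} → Agrees {K} {K′} ψ ρ ρ′ →
    ∀ i → Ring._≈_ K′ (Hom.fun (specialise {K} {K′} ψ ρ′) (point K ρ i)) (point K′ ρ′ i)
  specialise-point {K} {K′} {ψ} {ρ} {ρ′} agrees i with ρ i | agrees i
  ... | nothing | _ = subst-var ψ _ i
  ... | just s  | found with found s ≡.refl
  ...   | s′ , eq , s′≈ψs = trans (subst-const ψ _ s) (trans (constant.cong (Field.sym K′ s′≈ψs)) (reflexive (≡.sym (point-just {K′} {ρ′} eq))))
    where
    open Ring K′
    module constant = Hom (DegreeAlgebra.constant (algebra K′))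

  linear : ∀ K → Assignment K n → Fin n → (a b : Field.Carrier K) → Ring.Carrier K
  linear K ρ i a b = 𝕔 a * point K ρ i + 𝕔 b
    where open Ring K

  specialise-linear : ∀ {K K′} {ψ : Embedding K K′} {ρ ρ′} → Agrees {K} {K′} ψ ρ ρ′ → ∀ i a b →
    Ring._≈_ K′ (Hom.fun (specialise {K} {K′} ψ ρ′) (linear K ρ i a b)) (linear K′ ρ′ i (Hom.fun ψ a) (Hom.fun ψ b))
  specialise-linear {K} {K′} {ψ} {ρ} {ρ′} agrees i a b = trans (+-homo _ _) (+-cong
    (trans (*-homo _ _) (*-cong (subst-const ψ _ a) (specialise-point {K} {K′} {ψ} {ρ} {ρ′} agrees i))) (subst-const ψ _ b))
    where
    open Ring K′
    open Hom (specialise {K} {K′} ψ ρ′)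

  linear-assigned : ∀ {K ρ i s} → ρ i ≡ just s → ∀ a b →
    Ring._≈_ K (linear K ρ i a b) (Ring.𝕔 K (Field._+_ K (Field._*_ K a s) b))
  linear-assigned {K} {ρ} eq a b = trans (+-congʳ (trans (*-congˡ (reflexive (point-just {K} {ρ} eq))) (sym (𝕔-* _ _)))) (sym (𝕔-+ _ _))
    where
    open Ring K
    open Hom (DegreeAlgebra.constant (algebra K)) using () renaming (+-homo to 𝕔-+; *-homo to 𝕔-*)

  -- Two values are needed when two entries of a row, or two rows, involve different variables. A
  -- proper field extension only ever comes with a single value.
  record Specialisation (K : Field c ℓ) (ρ : Assignment K n) : Set (Level.suc (c ⊔ ℓ)) where
    field
      field′     : Field c ℓ
      embedding  : Embedding K field′
      assignment : Assignment field′ n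
      agrees     : Agrees {K} {field′} embedding ρ assignment
      assigned   : List (Fin n)
      at-most-2  : length assigned ≤ 2
      unchanged  : ∀ i → i ∈ assigned ⊎ (ρ i ≡ nothing → assignment i ≡ nothing)

    module Target = Ring field′
    embed : Field.Carrier K → Field.Carrier field′
    embed = Hom.fun embedding
    homomorphism : Hom (ring K) (ring field′)
    homomorphism = specialise {K} {field′} embedding assignment
    apply : Ring.Carrier K → Target.Carrier
    apply = Hom.fun homomorphism
    IsZero : Field.Carrier field′ → Set ℓ
    IsZero e = Field._≈_ field′ e (Field.0# field′)
    valueAt : (a b : Field.Carrier K) → Field.Carrier field′ → Target.Carrier
    valueAt a b s = Target.𝕔 (Field._+_ field′ (Field._*_ field′ (embed a) s) (embed b))

  infix 4 _⊢_↦_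
  _⊢_↦_ : ∀ {K ρ} (σ : Specialisation K ρ) → Ring.Carrier K → Ring.Carrier (Specialisation.field′ σ) → Set ℓ
  σ ⊢ x ↦ y = Ring._≈_ field′ (apply x) y
    where open Specialisation σ

  assign : ∀ {K K′} → Embedding K K′ → Assignment K n → Fin n → Field.Carrier K′ → Assignment K′ n
  assign ψ ρ i s i′ with i′ Fin.≟ i
  ... | yes _ = just s
  ... | no _  = Maybe.map (Hom.fun ψ) (ρ i′)

  assign-same : ∀ {K K′} (ψ : Embedding K K′) ρ i s → assign {K} {K′} ψ ρ i s i ≡ just s
  assign-same ψ ρ i s with i Fin.≟ i
  ... | yes _  = ≡.refl
  ... | no i≢i = ⊥-elim (i≢i ≡.refl)

  assign-other : ∀ {K K′} (ψ : Embedding K K′) ρ i s {i′} → ¬ i′ ≡ i →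
                 assign {K} {K′} ψ ρ i s i′ ≡ Maybe.map (Hom.fun ψ) (ρ i′)
  assign-other ψ ρ i s {i′} i′≢i with i′ Fin.≟ i
  ... | yes eq = ⊥-elim (i′≢i eq)
  ... | no _   = ≡.refl

  assign-agrees : ∀ {K K′} (ψ : Embedding K K′) ρ i s → ρ i ≡ nothing → Agrees {K} {K′} ψ ρ (assign {K} {K′} ψ ρ i s)
  assign-agrees {K′ = K′} ψ ρ i s free i′ s′ eq with i′ Fin.≟ i
  ... | yes ≡.refl with ≡.trans (≡.sym free) eq
  ...   | ()
  assign-agrees {K′ = K′} ψ ρ i s free i′ s′ eq | no _ =
    Hom.fun ψ s′ , ≡.cong (Maybe.map (Hom.fun ψ)) eq , Field.refl K′

  assign-unchanged : ∀ {K K′} (ψ : Embedding K K′) ρ i s i′ → i′ ≡ i ⊎ (ρ i′ ≡ nothing → assign {K} {K′} ψ ρ i s i′ ≡ nothing)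
  assign-unchanged ψ ρ i s i′ with i′ Fin.≟ i
  ... | yes eq = inj₁ eq
  ... | no _   = inj₂ (≡.cong (Maybe.map (Hom.fun ψ)))

  agrees-refl : ∀ {K} {ρ : Assignment K n} → Agrees {K} {K} (idᵉ {K}) ρ ρ
  agrees-refl {K} i s eq = s , eq , Field.refl K

  module _ {K : Field c ℓ} {ρ : Assignment K n} where

    none : Specialisation K ρ
    none = record
      { field′ = K ; embedding = idᵉ {K} ; assignment = ρ ; agrees = agrees-refl {K}
      ; assigned = [] ; at-most-2 = z≤n ; unchanged = λ _ → inj₂ λ eq → eq }

    one : ∀ {K′} → Embedding K K′ → ∀ i → ρ i ≡ nothing → Field.Carrier K′ → Specialisation K ρ
    one {K′} ψ i free s = record
      { field′ = K′ ; embedding = ψ ; assignment = assign {K} {K′} ψ ρ i s ; agrees = assign-agrees {K} {K′} ψ ρ i s free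
      ; assigned = i ∷ [] ; at-most-2 = s≤s z≤n
      ; unchanged = λ i′ → map₁ here (assign-unchanged {K} {K′} ψ ρ i s i′) }

    private
      id = idᵉ {K}

    two : ∀ i → ρ i ≡ nothing → Field.Carrier K → ∀ i′ → ρ i′ ≡ nothing → ¬ i′ ≡ i → Field.Carrier K → Specialisation K ρ
    two i free s i′ free′ i′≢i s′ = record
      { field′ = K ; embedding = id ; assignment = ρ₂
      ; agrees = λ j x eq → let (y , eq₁ , y≈x) = assign-agrees {K} {K} id ρ i s free j x eq
                                (z , eq₂ , z≈y) = assign-agrees {K} {K} id ρ₁ i′ s′ free₁ j y eq₁
                            in z , eq₂ , Field.trans K z≈y y≈x
      ; assigned = i ∷ i′ ∷ [] ; at-most-2 = s≤s (s≤s z≤n)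
      ; unchanged = λ j → merge j (assign-unchanged {K} {K} id ρ i s j) (assign-unchanged {K} {K} id ρ₁ i′ s′ j) }
      where
      ρ₁ = assign {K} {K} id ρ i s
      ρ₂ = assign {K} {K} id ρ₁ i′ s′
      free₁ : ρ₁ i′ ≡ nothing
      free₁ = ≡.trans (assign-other {K} {K} id ρ i s i′≢i) (≡.cong (Maybe.map _) free′)
      merge : ∀ j → j ≡ i ⊎ (ρ j ≡ nothing → ρ₁ j ≡ nothing) → j ≡ i′ ⊎ (ρ₁ j ≡ nothing → ρ₂ j ≡ nothing) →
              j ∈ i ∷ i′ ∷ [] ⊎ (ρ j ≡ nothing → ρ₂ j ≡ nothing)
      merge j (inj₁ eq) _         = inj₁ (here eq)
      merge j (inj₂ _) (inj₁ eq)  = inj₁ (there (here eq))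
      merge j (inj₂ f) (inj₂ g)   = inj₂ (λ eq → g (f eq))

    two-first : ∀ i free s i′ free′ (i′≢i : ¬ i′ ≡ i) s′ →
      Specialisation.assignment (two i free s i′ free′ i′≢i s′) i ≡ just s
    two-first i free s i′ free′ i′≢i s′ =
      ≡.trans (assign-other {K} {K} id (assign {K} {K} id ρ i s) i′ s′ (λ eq → i′≢i (≡.sym eq)))
        (≡.cong (Maybe.map _) (assign-same {K} {K} id ρ i s))

-- Classification of weak matrices: shear or degenerate.

module Classification {c ℓ n} (model : PolynomialModel c ℓ n) (K : Field c ℓ) (ρ : Assignment K n) where
  open PolynomialModel model
  open Specialisations model
  open Ring K
  private
    module K = Field K
    module S = IntegerRingSolver (ring K)
  open FieldProperties K
  open Plane K
  open IntegerRingSolver K.commutativeRing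
  open Hom (DegreeAlgebra.constant (algebra K)) using () renaming (cong to 𝕔-cong; +-homo to 𝕔-+; *-homo to 𝕔-*; 0-homo to 𝕔-0; 1-homo to 𝕔-1)

  data EntryForm (x : Carrier) : Set (c ⊔ ℓ) where
    fixed : ∀ e → x ≈ 𝕔 e → EntryForm x
    line  : ∀ i → ρ i ≡ nothing → ∀ a b → ¬ a K.≈ K.0# → x ≈ linear K ρ i a b → EntryForm x

  entry-form : ∀ {x} i a b → x ≈ linear K ρ i a b → ¬ ¬ EntryForm x
  entry-form {x} i a b eq k = cases (ρ i) ≡.refl
    where
    cases : ∀ r → ρ i ≡ r → ⊥
    cases (just s) assigned = k (fixed (a K.* s K.+ b) (trans eq (linear-assigned {K} {ρ} assigned a b)))
    cases nothing free = ¬¬-excluded-middle λ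
      { (yes a≈0) → k (fixed b (trans eq (trans (+-congʳ (trans (*-congʳ (trans (𝕔-cong a≈0) 𝕔-0)) (zeroˡ _))) (+-identityˡ _))))
      ; (no a≉0)  → k (line i free a b a≉0 eq) }

  fixed⇒linear : ∀ {x e} i → x ≈ 𝕔 e → x ≈ linear K ρ i K.0# e
  fixed⇒linear i eq = trans eq (sym (trans (+-congʳ (trans (*-congʳ 𝕔-0) (zeroˡ _))) (+-identityˡ _)))

  apply-fixed : ∀ (σ : Specialisation K ρ) {x e} → x ≈ 𝕔 e → σ ⊢ x ↦ Specialisation.Target.𝕔 σ (Specialisation.embed σ e)
  apply-fixed σ {x} {e} eq = Target.trans (Hom.cong homomorphism eq) (subst-const embedding _ e)
    where open Specialisation σ

  apply-line : ∀ (σ : Specialisation K ρ) {x i a b s} → x ≈ linear K ρ i a b → Specialisation.assignment σ i ≡ just s →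
    σ ⊢ x ↦ Specialisation.valueAt σ a b s
  apply-line σ {x} {i} {a} {b} eq assigned = Target.trans (Hom.cong homomorphism eq)
    (Target.trans (specialise-linear {K} {field′} {embedding} {ρ} {assignment} agrees i a b)
      (linear-assigned {field′} {assignment} assigned (embed a) (embed b)))
    where open Specialisation σ hiding (assigned)

  -- Apart from `zeroable`, these are rows without zeros: a nonzero constant, or `a x + b` with `a`
  -- and `b` independent, which vanishes for no `x` in any extension.
  data RowForm (x : Fin 2 → Carrier) : Set (Level.suc (c ⊔ ℓ)) where
    zeroable : (σ : Specialisation K ρ) → (∀ j → σ ⊢ x j ↦ Specialisation.Target.0# σ) → RowForm x
    fixed    : ∀ b → ¬ Vanishes b → (∀ j → x j ≈ 𝕔 (b j)) → RowForm x
    line     : ∀ i → ρ i ≡ nothing → ∀ a b → ¬ a ∧ b K.≈ K.0# → (∀ j → x j ≈ linear K ρ i (a j) (b j)) → RowForm x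

  private
    root : ∀ a b → ¬ a K.≈ K.0# → Σ[ s ∈ K.Carrier ] a K.* s K.+ b K.≈ K.0#
    root a b a≉0 = let (a⁻¹ , aa⁻¹≈1) = K.inverse a a≉0 in K.- (a⁻¹ K.* b) ,
      K.trans (solve 3 (λ a a⁻¹ b → a :* :- (a⁻¹ :* b) :+ b := b :- a :* a⁻¹ :* b) K.refl a a⁻¹ b)
        (K.trans (K.+-congˡ (K.-‿cong (K.*-congʳ aa⁻¹≈1))) (solve 1 (λ b → b :- con (1 , 0) :* b := con (0 , 0)) K.refl b))

    vanish : ∀ (σ : Specialisation K ρ) {y e} → σ ⊢ y ↦ Specialisation.Target.𝕔 σ e →
             Specialisation.IsZero σ e → σ ⊢ y ↦ Specialisation.Target.0# σ
    vanish σ eq e≈0 = Target.trans eq (Target.trans (Hom.cong const e≈0) (Hom.0-homo const))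
      where
      open Specialisation σ
      const = DegreeAlgebra.constant (algebra field′)

  row-form : ∀ x → EntryForm (x 0F) → EntryForm (x 1F) → ¬ ¬ RowForm x
  row-form x (fixed e₀ eq₀) (fixed e₁ eq₁) k = ¬¬-excluded-middle λ
    { (no e≉0)           → k (fixed ⟨ e₀ , e₁ ⟩ e≉0 λ { 0F → eq₀ ; 1F → eq₁ })
    ; (yes (e₀≈0 , e₁≈0)) → k (zeroable none λ
        { 0F → vanish none (apply-fixed none eq₀) e₀≈0 ; 1F → vanish none (apply-fixed none eq₁) e₁≈0 }) }
  row-form x (fixed e eq₀) (line i free a b a≉0 eq₁) k = ¬¬-excluded-middle λ
    { (no e≉0)  → k (line i free ⟨ K.0# , a ⟩ ⟨ e , b ⟩
        (λ eq → *-≉0 a≉0 e≉0 (K.trans (solve 3 (λ a b e → a :* e := :- (con (0 , 0) :* b :- a :* e)) K.refl a b e)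
          (K.trans (K.-‿cong eq) (solve 0 (:- con (0 , 0) := con (0 , 0)) K.refl))))
        λ { 0F → fixed⇒linear i eq₀ ; 1F → eq₁ })
    ; (yes e≈0) → let (s , as+b≈0) = root a b a≉0
                      σ = one (idᵉ {K}) i free s in
        k (zeroable σ λ
          { 0F → vanish σ (apply-fixed σ eq₀) e≈0
          ; 1F → vanish σ (apply-line σ eq₁ (assign-same {K} {K} (idᵉ {K}) ρ i s)) as+b≈0 }) }
  row-form x (line i free a b a≉0 eq₀) (fixed e eq₁) k = ¬¬-excluded-middle λ
    { (no e≉0)  → k (line i free ⟨ a , K.0# ⟩ ⟨ b , e ⟩
        (λ eq → *-≉0 a≉0 e≉0 (K.trans (solve 3 (λ a b e → a :* e := a :* e :- con (0 , 0) :* b) K.refl a b e) eq))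
        λ { 0F → eq₀ ; 1F → fixed⇒linear i eq₁ })
    ; (yes e≈0) → let (s , as+b≈0) = root a b a≉0
                      σ = one (idᵉ {K}) i free s in
        k (zeroable σ λ
          { 1F → vanish σ (apply-fixed σ eq₁) e≈0
          ; 0F → vanish σ (apply-line σ eq₀ (assign-same {K} {K} (idᵉ {K}) ρ i s)) as+b≈0 }) }
  row-form x (line i free a b a≉0 eq₀) (line i′ free′ a′ b′ a′≉0 eq₁) k with i′ Fin.≟ i
  ... | no i′≢i =
    let (s , as+b≈0)   = root a b a≉0
        (s′ , as′+b≈0) = root a′ b′ a′≉0
        σ = two i free s i′ free′ i′≢i s′ in
    k (zeroable σ λ
      { 0F → vanish σ (apply-line σ eq₀ (two-first i free s i′ free′ i′≢i s′)) as+b≈0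
      ; 1F → vanish σ (apply-line σ eq₁ (assign-same {K} {K} (idᵉ {K}) (assign {K} {K} (idᵉ {K}) ρ i s) i′ s′)) as′+b≈0 })
  ... | yes ≡.refl = ¬¬-excluded-middle λ
    { (no det≉0)  → k (line i free ⟨ a , a′ ⟩ ⟨ b , b′ ⟩ det≉0 λ { 0F → eq₀ ; 1F → eq₁ })
    -- Proportional entries have the same root, so one value annihilates the whole row.
    ; (yes det≈0) →
        let (s , as+b≈0) = root a b a≉0
            σ = one (idᵉ {K}) i free s
            same = assign-same {K} {K} (idᵉ {K}) ρ i s in
        k (zeroable σ λ
          { 0F → vanish σ (apply-line σ eq₀ same) as+b≈0
          ; 1F → vanish σ (apply-line σ eq₁ same) (*-cancel-0ʳ a≉0 (K.trans
              (solve 5 (λ a b a′ b′ s → a :* (a′ :* s :+ b′) := a′ :* (a :* s :+ b) :+ (a :* b′ :- a′ :* b)) K.refl a b a′ b′ s)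
              (K.trans (K.+-cong (K.*-congˡ as+b≈0) det≈0) (solve 1 (λ a → a :* con (0 , 0) :+ con (0 , 0) := con (0 , 0)) K.refl a′)))) }) }

  -- `G` is the invertible change of rows, and the shear has rows `a` and `ε x a + b`. Constant
  -- matrices are included by `ε = 0`. Since `point` may itself be a constant, the notion is stable
  -- under further assignments.
  record Shear (M : Fin 2 → Fin 2 → Carrier) : Set (c ⊔ ℓ) where
    field
      ε      : K.Carrier
      index  : Fin n
      G      : Fin 2 → Fin 2 → K.Carrier
      a b    : Fin 2 → K.Carrier
      G≉0    : ¬ G 0F ∧ G 1F K.≈ K.0#
      a∧b≉0  : ¬ a ∧ b K.≈ K.0#
      expand : ∀ k j → M k j ≈ 𝕔 (G k 0F) * 𝕔 (a j) + 𝕔 (G k 1F) * (𝕔 ε * point K ρ index * 𝕔 (a j) + 𝕔 (b j))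

  -- The left factor of the rank-one factorisation is constant, whereas the pivot row may still
  -- contain free variables. Thanks to the constant factor, the part of the program before the
  -- matrix can end in a constant vector.
  record Degenerate (M : Fin 2 → Fin 2 → Carrier) : Set (Level.suc (c ⊔ ℓ)) where
    field
      σ : Specialisation K ρ
    open Specialisation σ public
    field
      pivot  : Fin 2
      column : Fin 2 → Field.Carrier field′
      rank-1 : ∀ l j → apply (M l j) Target.≈ Target.𝕔 (column l) Target.* apply (M pivot j)

  private
    swap : Fin 2 → Fin 2
    swap 0F = 1F
    swap 1F = 0F

    shear-swap : ∀ {M} → Shear (M ∘ swap) → Shear M
    shear-swap {M} sh = record
      { ε = ε ; index = index ; G = G ∘ swap ; a = a ; b = b
      ; G≉0 = λ eq → G≉0 (K.trans (solve 4 (λ x y z w → x :* w :- y :* z := :- (z :* y :- w :* x)) K.refl (G 0F 0F) (G 0F 1F) (G 1F 0F) (G 1F 1F))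
          (K.trans (K.-‿cong eq) (solve 0 (:- con (0 , 0) := con (0 , 0)) K.refl)))
      ; a∧b≉0 = a∧b≉0
      ; expand = λ { 0F → expand 1F ; 1F → expand 0F } }
      where open Shear sh

    degenerate-swap : ∀ {M} → Degenerate (M ∘ swap) → Degenerate M
    degenerate-swap d = record
      { σ = σ ; pivot = swap pivot ; column = column ∘ swap ; rank-1 = λ { 0F → rank-1 1F ; 1F → rank-1 0F } }
      where open Degenerate d

    zero-row : ∀ {M} (σ : Specialisation K ρ) → (∀ j → σ ⊢ M 0F j ↦ Specialisation.Target.0# σ) → Degenerate M
    zero-row σ row≈0 = record
      { σ = σ ; pivot = 1F ; column = ⟨ F.0# , F.1# ⟩
      ; rank-1 = λ
          { 0F j → Target.trans (row≈0 j) (Target.sym (Target.trans (Target.*-congʳ (Hom.0-homo const)) (Target.zeroˡ _)))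
          ; 1F j → Target.sym (Target.trans (Target.*-congʳ (Hom.1-homo const)) (Target.*-identityˡ _)) } }
      where
      open Specialisation σ
      module F = Field field′
      const = DegreeAlgebra.constant (algebra field′)

    singular : ∀ {M} (σ : Specialisation K ρ) (u v : Fin 2 → Field.Carrier (Specialisation.field′ σ)) →
      (∀ j → σ ⊢ M 0F j ↦ Specialisation.Target.𝕔 σ (u j)) → (∀ j → σ ⊢ M 1F j ↦ Specialisation.Target.𝕔 σ (v j)) →
      ¬ Plane.Vanishes (Specialisation.field′ σ) u → Specialisation.IsZero σ (Plane._∧_ (Specialisation.field′ σ) u v) → ¬ ¬ Degenerate M
    singular σ u v row₀ row₁ u≉0 u∧v≈0 k = Plane.parallel field′ {u} {v} u≉0 u∧v≈0 λ { (μ , v≈μu) → k (record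
      { σ = σ ; pivot = 0F ; column = ⟨ F.1# , μ ⟩
      ; rank-1 = λ
          { 0F j → Target.sym (Target.trans (Target.*-congʳ (Hom.1-homo const)) (Target.*-identityˡ _))
          ; 1F j → Target.trans (row₁ j) (Target.trans (Hom.cong const (v≈μu j)) (Target.trans (Hom.*-homo const _ _)
                     (Target.*-congˡ (Target.sym (row₀ j))))) } }) }
      where
      open Specialisation σ
      module F = Field field′
      const = DegreeAlgebra.constant (algebra field′)

    scaled-line : ∀ (i : Fin n) g g′ a b → 𝕔 g * 𝕔 a + 𝕔 g′ * (𝕔 K.1# * point K ρ i * 𝕔 a + 𝕔 b) ≈
                  linear K ρ i (g′ K.* a) (g K.* a K.+ g′ K.* b)
    scaled-line i g g′ a b = trans
      (+-congˡ (*-congˡ (+-congʳ (*-congʳ (trans (*-congʳ 𝕔-1) (*-identityˡ _))))))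
      (trans (S.solve 5 (λ g g′ p a b → g S.:* a S.:+ g′ S.:* (p S.:* a S.:+ b) S.:= g′ S.:* a S.:* p S.:+ (g S.:* a S.:+ g′ S.:* b))
        refl (𝕔 g) (𝕔 g′) (point K ρ i) (𝕔 a) (𝕔 b))
        (sym (+-cong (*-congʳ (𝕔-* g′ a)) (trans (𝕔-+ _ _) (+-cong (𝕔-* g a) (𝕔-* g′ b))))))

    linear-cong : ∀ i {a a′ b b′} → a K.≈ a′ → b K.≈ b′ → linear K ρ i a b ≈ linear K ρ i a′ b′
    linear-cong i a≈ b≈ = +-cong (*-congʳ (𝕔-cong a≈)) (𝕔-cong b≈)

    Result : (Fin 2 → Fin 2 → Carrier) → Set (Level.suc (c ⊔ ℓ))
    Result M = Shear M ⊎ Degenerate M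

    swap-result : ∀ {M} → Result (M ∘ swap) → Result M
    swap-result (inj₁ sh) = inj₁ (shear-swap sh)
    swap-result (inj₂ d)  = inj₂ (degenerate-swap d)

    module _ {M : Fin 2 → Fin 2 → Carrier} (i₀ : Fin n) where

      -- An invertible constant matrix is its own `G`, with the unit vectors as `a` and `b`.
      fixed-fixed : ∀ u v → ¬ Vanishes u → (∀ j → M 0F j ≈ 𝕔 (u j)) → (∀ j → M 1F j ≈ 𝕔 (v j)) → ¬ ¬ Result M
      fixed-fixed u v u≉0 row₀ row₁ k = ¬¬-excluded-middle λ
        { (yes det≈0) → singular {M} none u v (λ j → apply-fixed none (row₀ j)) (λ j → apply-fixed none (row₁ j)) u≉0 det≈0 (k ∘ inj₂)
        ; (no det≉0)  → k (inj₁ (record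
            { ε = K.0# ; index = i₀ ; G = ⟨ u , v ⟩ ; a = e₀ ; b = e₁ ; G≉0 = det≉0
            ; a∧b≉0 = λ eq → K.1≉0 (K.trans (solve 0 (con (1 , 0) := con (1 , 0) :* con (1 , 0) :- con (0 , 0) :* con (0 , 0)) K.refl) eq)
            ; expand = λ { 0F j → trans (row₀ j) (expand u j) ; 1F j → trans (row₁ j) (expand v j) } })) }
        where
        e₀ = ⟨ K.1# , K.0# ⟩
        e₁ = ⟨ K.0# , K.1# ⟩
        expand : ∀ u j → 𝕔 (u j) ≈ 𝕔 (u 0F) * 𝕔 (e₀ j) + 𝕔 (u 1F) * (𝕔 K.0# * point K ρ i₀ * 𝕔 (e₀ j) + 𝕔 (e₁ j))
        expand u 0F = sym (trans (+-cong (*-congˡ 𝕔-1) (*-congˡ (+-cong (*-congʳ (*-congʳ 𝕔-0)) 𝕔-0)))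
          (S.solve 4 (λ x y p z → x S.:* S.con (1 , 0) S.:+ y S.:* (S.con (0 , 0) S.:* p S.:* z S.:+ S.con (0 , 0)) S.:= x) refl (𝕔 (u 0F)) (𝕔 (u 1F)) (point K ρ i₀) _))
        expand u 1F = sym (trans (+-cong (*-congˡ 𝕔-0) (*-congˡ (+-cong (*-congʳ (*-congʳ 𝕔-0)) 𝕔-1)))
          (S.solve 4 (λ x y p z → x S.:* S.con (0 , 0) S.:+ y S.:* (S.con (0 , 0) S.:* p S.:* z S.:+ S.con (1 , 0)) S.:= y) refl (𝕔 (u 0F)) (𝕔 (u 1F)) (point K ρ i₀) _))

      -- The determinant `(u ∧ a) x + u ∧ b` has a root unless `u ∧ a` vanishes. In that case
      -- `u = μ a`, and the matrix is `diag(μ, 1)` times a shear.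
      fixed-line : ∀ u → ¬ Vanishes u → (∀ j → M 0F j ≈ 𝕔 (u j)) →
                   ∀ i → ρ i ≡ nothing → ∀ a b → ¬ a ∧ b K.≈ K.0# → (∀ j → M 1F j ≈ linear K ρ i (a j) (b j)) → ¬ ¬ Result M
      fixed-line u u≉0 row₀ i free a b a∧b≉0 row₁ k = ¬¬-excluded-middle λ
        { (no u∧a≉0) →
            let (s , s-root) = root (u ∧ a) (u ∧ b) u∧a≉0
                σ = one (idᵉ {K}) i free s in
            singular {M} σ u (λ j → a j K.* s K.+ b j) (λ j → apply-fixed σ (row₀ j))
              (λ j → apply-line σ (row₁ j) (assign-same {K} {K} (idᵉ {K}) ρ i s)) u≉0
              (K.trans (solve 7 (λ u₀ u₁ a₀ a₁ b₀ b₁ s → u₀ :* (a₁ :* s :+ b₁) :- u₁ :* (a₀ :* s :+ b₀) :=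
                (u₀ :* a₁ :- u₁ :* a₀) :* s :+ (u₀ :* b₁ :- u₁ :* b₀)) K.refl (u 0F) (u 1F) (a 0F) (a 1F) (b 0F) (b 1F) s) s-root)
              (k ∘ inj₂)
        ; (yes u∧a≈0) →
            let (μ , u≈μa) = multiple a b a∧b≉0 u (K.trans (solve 4 (λ u₀ u₁ a₀ a₁ → a₀ :* u₁ :- a₁ :* u₀ := :- (u₀ :* a₁ :- u₁ :* a₀)) K.refl (u 0F) (u 1F) (a 0F) (a 1F))
                  (K.trans (K.-‿cong u∧a≈0) (solve 0 (:- con (0 , 0) := con (0 , 0)) K.refl)))
                μ≉0 = λ μ≈0 → u≉0 (K.trans (u≈μa 0F) (K.trans (K.*-congʳ μ≈0) (K.zeroˡ _)) , K.trans (u≈μa 1F) (K.trans (K.*-congʳ μ≈0) (K.zeroˡ _)))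
            in k (inj₁ (record
              { ε = K.1# ; index = i ; G = ⟨ ⟨ μ , K.0# ⟩ , ⟨ K.0# , K.1# ⟩ ⟩ ; a = a ; b = b
              ; G≉0 = λ eq → μ≉0 (K.trans (solve 1 (λ μ → μ := μ :* con (1 , 0) :- con (0 , 0) :* con (0 , 0)) K.refl μ) eq)
              ; a∧b≉0 = a∧b≉0
              ; expand = λ
                  { 0F j → trans (fixed⇒linear i (row₀ j)) (trans (linear-cong i
                      (solve 1 (λ x → con (0 , 0) := con (0 , 0) :* x) K.refl (a j))
                      (K.trans (u≈μa j) (solve 3 (λ μ x y → μ :* x := μ :* x :+ con (0 , 0) :* y) K.refl μ (a j) (b j)))) (sym (scaled-line i _ _ _ _)))
                  ; 1F j → trans (row₁ j) (trans (linear-cong i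
                      (solve 1 (λ x → x := con (1 , 0) :* x) K.refl (a j))
                      (solve 2 (λ x y → y := con (0 , 0) :* x :+ con (1 , 0) :* y) K.refl (a j) (b j))) (sym (scaled-line i _ _ _ _))) } })) }

      -- The first variable gets a value for which the determinant is nonconstant in the second,
      -- which then solves a linear equation. The values 0 and 1 suffice, even over the field of two
      -- elements: if both failed, `a′` would be parallel to both `a` and `b`, hence zero.
      line-line-≢ : ∀ i → ρ i ≡ nothing → ∀ a b → ¬ a ∧ b K.≈ K.0# → (∀ j → M 0F j ≈ linear K ρ i (a j) (b j)) →
                    ∀ i′ → ρ i′ ≡ nothing → ∀ a′ b′ → ¬ a′ ∧ b′ K.≈ K.0# → (∀ j → M 1F j ≈ linear K ρ i′ (a′ j) (b′ j)) →
                    ¬ i′ ≡ i → ¬ ¬ Result M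
      line-line-≢ i free a b a∧b≉0 row₀ i′ free′ a′ b′ a′∧b′≉0 row₁ i′≢i k = ¬¬-excluded-middle λ
        { (no b∧a′≉0)  → at K.0# (λ eq → b∧a′≉0 (K.trans eq′ eq))
        ; (yes b∧a′≈0) → ¬¬-excluded-middle λ
          { (no a∧a′≉0)  → at K.1# (λ eq → a∧a′≉0 (K.trans (K.sym (K.trans (K.+-congˡ b∧a′≈0) (K.+-identityʳ _))) (K.trans eq″ eq)))
          ; (yes a∧a′≈0) → ∧≉0⇒nonvanishingˡ a′ b′ a′∧b′≉0 (both a∧a′≈0 b∧a′≈0 0F , both a∧a′≈0 b∧a′≈0 1F) } }
        where
        eq′ : b ∧ a′ K.≈ (λ j → a j K.* K.0# K.+ b j) ∧ a′
        eq′ = solve 6 (λ a₀ a₁ b₀ b₁ c₀ c₁ → b₀ :* c₁ :- b₁ :* c₀ :=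
          (a₀ :* con (0 , 0) :+ b₀) :* c₁ :- (a₁ :* con (0 , 0) :+ b₁) :* c₀) K.refl (a 0F) (a 1F) (b 0F) (b 1F) (a′ 0F) (a′ 1F)
        eq″ : a ∧ a′ K.+ b ∧ a′ K.≈ (λ j → a j K.* K.1# K.+ b j) ∧ a′
        eq″ = solve 6 (λ a₀ a₁ b₀ b₁ c₀ c₁ → (a₀ :* c₁ :- a₁ :* c₀) :+ (b₀ :* c₁ :- b₁ :* c₀) :=
          (a₀ :* con (1 , 0) :+ b₀) :* c₁ :- (a₁ :* con (1 , 0) :+ b₁) :* c₀) K.refl (a 0F) (a 1F) (b 0F) (b 1F) (a′ 0F) (a′ 1F)
        both : a ∧ a′ K.≈ K.0# → b ∧ a′ K.≈ K.0# → ∀ j → a′ j K.≈ K.0#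
        both a∧a′≈0 b∧a′≈0 j with coordinates a b a∧b≉0 a′
        ... | e , _ , eq = K.trans (eq j) (K.trans (K.+-cong
            (K.*-congʳ (K.*-congʳ (K.trans (solve 4 (λ x y z w → x :* w :- y :* z := :- (z :* y :- w :* x)) K.refl (a′ 0F) (a′ 1F) (b 0F) (b 1F)) (K.-‿cong b∧a′≈0))))
            (K.*-congʳ (K.*-congʳ a∧a′≈0)))
            (solve 3 (λ e a b → :- con (0 , 0) :* e :* a :+ con (0 , 0) :* e :* b := con (0 , 0)) K.refl e (a j) (b j)))
        at : ∀ s → ¬ (λ j → a j K.* s K.+ b j) ∧ a′ K.≈ K.0# → ⊥
        at s u∧a′≉0 = singular {M} σ u (λ j → a′ j K.* t K.+ b′ j)
          (λ j → apply-line σ (row₀ j) (two-first i free s i′ free′ i′≢i t))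
          (λ j → apply-line σ (row₁ j) (assign-same {K} {K} (idᵉ {K}) (assign {K} {K} (idᵉ {K}) ρ i s) i′ t))
          (∧≉0⇒nonvanishingˡ u a′ u∧a′≉0)
          (K.trans (solve 7 (λ u₀ u₁ a₀ a₁ b₀ b₁ s → u₀ :* (a₁ :* s :+ b₁) :- u₁ :* (a₀ :* s :+ b₀) :=
            (u₀ :* a₁ :- u₁ :* a₀) :* s :+ (u₀ :* b₁ :- u₁ :* b₀)) K.refl (u 0F) (u 1F) (a′ 0F) (a′ 1F) (b′ 0F) (b′ 1F) t) t-root)
          (k ∘ inj₂)
          where
          u : Fin 2 → K.Carrier
          u j = a j K.* s K.+ b j
          t = proj₁ (root (u ∧ a′) (u ∧ b′) u∧a′≉0)
          t-root = proj₂ (root (u ∧ a′) (u ∧ b′) u∧a′≉0)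
          σ = two i free s i′ free′ i′≢i t

      -- The determinant is `A x² + B x + C`. At a root the matrix is singular, and its first row
      -- `u` is nonzero because `u ∧ a = - (a ∧ b)`. Otherwise `A = B = 0`: the first gives
      -- `a′ = ν a`, the second `b′ = μ a + ν b`, and `C ≠ 0` makes `μ` nonzero, so `G` has the rows
      -- `(0, 1)` and `(μ, ν)`.
      line-line-≡ : ∀ i → ρ i ≡ nothing → ∀ a b → ¬ a ∧ b K.≈ K.0# → (∀ j → M 0F j ≈ linear K ρ i (a j) (b j)) →
                    ∀ a′ b′ → (∀ j → M 1F j ≈ linear K ρ i (a′ j) (b′ j)) → ¬ ¬ Result M
      line-line-≡ i free a b a∧b≉0 row₀ a′ b′ row₁ k = root-or-constant K A B C λ
        { (inj₁ r) → at-root r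
        ; (inj₂ (A≈0 , B≈0 , C≉0)) → constant-det A≈0 B≈0 C≉0 }
        where
        A B C : K.Carrier
        A = a ∧ a′
        B = a ∧ b′ K.+ b ∧ a′
        C = b ∧ b′
        at-root : QuadraticRoot K A B C → ⊥
        at-root r = singular {M} σ u v (λ j → apply-line σ (row₀ j) same) (λ j → apply-line σ (row₁ j) same)
          (Plane.∧≉0⇒nonvanishingˡ (QuadraticRoot.extension r) u (embed ∘ a) u∧a≉0) u∧v≈0 (k ∘ inj₂)
          where
          module E = Field (QuadraticRoot.extension r)
          module T = IntegerRingSolver E.commutativeRing
          open QuadraticRoot r using (root-equation) renaming (embedding to ψ; root to θ)
          open Hom ψ using (+-homo; *-homo; -‿homo) renaming (fun to embed; cong to embed-cong)
          open Plane (QuadraticRoot.extension r) using () renaming (_∧_ to _∧′_)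
          σ = one {ρ = ρ} ψ i free θ
          same = assign-same {K} {QuadraticRoot.extension r} ψ ρ i θ
          u v : Fin 2 → E.Carrier
          u j = embed (a j) E.* θ E.+ embed (b j)
          v j = embed (a′ j) E.* θ E.+ embed (b′ j)
          embed-∧ : ∀ x y → embed (x ∧ y) E.≈ (embed ∘ x) ∧′ (embed ∘ y)
          embed-∧ x y = E.trans (+-homo _ _) (E.+-cong (*-homo _ _) (E.trans (-‿homo _) (E.-‿cong (*-homo _ _))))
          u∧a≉0 : ¬ u ∧′ (embed ∘ a) E.≈ E.0#
          u∧a≉0 eq = Hom-reflects-≉0 a∧b≉0 (E.trans (embed-∧ a b)
            (E.trans (T.solve 5 (λ a₀ a₁ b₀ b₁ θ → a₀ T.:* b₁ T.:- a₁ T.:* b₀ T.:=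
              T.:- ((a₀ T.:* θ T.:+ b₀) T.:* a₁ T.:- (a₁ T.:* θ T.:+ b₁) T.:* a₀)) E.refl (embed (a 0F)) (embed (a 1F)) (embed (b 0F)) (embed (b 1F)) θ)
              (E.trans (E.-‿cong eq) (T.solve 0 (T.:- T.con (0 , 0) T.:= T.con (0 , 0)) E.refl))))
            where
            Hom-reflects-≉0 : ∀ {x} → ¬ x K.≈ K.0# → ¬ embed x E.≈ E.0#
            Hom-reflects-≉0 {x} x≉0 ψx≈0 = let (y , xy≈1) = K.inverse x x≉0 in E.1≉0
              (E.trans (E.sym (E.trans (embed-cong xy≈1) (Hom.1-homo ψ))) (E.trans (*-homo x y) (E.trans (E.*-congʳ ψx≈0) (E.zeroˡ _))))
          u∧v≈0 : u ∧′ v E.≈ E.0#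
          u∧v≈0 = E.trans (T.solve 9 (λ a₀ a₁ b₀ b₁ c₀ c₁ d₀ d₁ θ →
              (a₀ T.:* θ T.:+ b₀) T.:* (c₁ T.:* θ T.:+ d₁) T.:- (a₁ T.:* θ T.:+ b₁) T.:* (c₀ T.:* θ T.:+ d₀) T.:=
              (a₀ T.:* c₁ T.:- a₁ T.:* c₀) T.:* (θ T.:* θ) T.:+
              ((a₀ T.:* d₁ T.:- a₁ T.:* d₀) T.:+ (b₀ T.:* c₁ T.:- b₁ T.:* c₀)) T.:* θ T.:+ (b₀ T.:* d₁ T.:- b₁ T.:* d₀))
              E.refl (embed (a 0F)) (embed (a 1F)) (embed (b 0F)) (embed (b 1F)) (embed (a′ 0F)) (embed (a′ 1F)) (embed (b′ 0F)) (embed (b′ 1F)) θ)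
            (E.trans (E.sym (E.+-cong (E.+-cong (E.*-congʳ (embed-∧ a a′))
              (E.*-congʳ (E.trans (+-homo _ _) (E.+-cong (embed-∧ a b′) (embed-∧ b a′))))) (embed-∧ b b′))) root-equation)
        constant-det : A K.≈ K.0# → B K.≈ K.0# → ¬ C K.≈ K.0# → ⊥
        constant-det A≈0 B≈0 C≉0 with multiple a b a∧b≉0 a′ A≈0 | coordinates a b a∧b≉0 b′
        ... | ν , a′≈νa | e , de≈1 , b′≈ = k (inj₁ (record
          { ε = K.1# ; index = i ; G = ⟨ ⟨ K.0# , K.1# ⟩ , ⟨ μ , ν ⟩ ⟩ ; a = a ; b = b
          ; G≉0 = λ eq → μ≉0 (K.trans (solve 2 (λ μ ν → μ := :- (con (0 , 0) :* ν :- con (1 , 0) :* μ)) K.refl μ ν)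
              (K.trans (K.-‿cong eq) (solve 0 (:- con (0 , 0) := con (0 , 0)) K.refl)))
          ; a∧b≉0 = a∧b≉0
          ; expand = λ
              { 0F j → trans (row₀ j) (trans (linear-cong i
                  (solve 1 (λ x → x := con (1 , 0) :* x) K.refl (a j))
                  (solve 2 (λ x y → y := con (0 , 0) :* x :+ con (1 , 0) :* y) K.refl (a j) (b j))) (sym (scaled-line i _ _ _ _)))
              ; 1F j → trans (row₁ j) (trans (linear-cong i (a′≈νa j)
                  (K.trans (b′≈ j) (K.+-congˡ (K.*-congʳ ν≈)))) (sym (scaled-line i _ _ _ _))) } }))
          where
          μ = (b′ ∧ b) K.* e
          μ≉0 : ¬ μ K.≈ K.0#
          μ≉0 = *-≉0 (λ eq → C≉0 (K.trans (solve 4 (λ x y z w → x :* w :- y :* z := :- (z :* y :- w :* x)) K.refl (b 0F) (b 1F) (b′ 0F) (b′ 1F))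
              (K.trans (K.-‿cong eq) (solve 0 (:- con (0 , 0) := con (0 , 0)) K.refl))))
            (λ e≈0 → K.1≉0 (K.trans (K.sym de≈1) (K.trans (K.*-congˡ e≈0) (K.zeroʳ _))))
          -- B = 0 says a ∧ b′ = - b ∧ a′ = ν (a ∧ b).
          ν≈ : (a ∧ b′) K.* e K.≈ ν
          ν≈ = K.trans (K.*-congʳ a∧b′≈) (K.trans (K.*-assoc ν (a ∧ b) e) (K.trans (K.*-congˡ de≈1) (K.*-identityʳ ν)))
            where
            a∧b′≈ : a ∧ b′ K.≈ ν K.* (a ∧ b)
            a∧b′≈ = K.trans (solve 2 (λ x y → x := (x :+ y) :- y) K.refl (a ∧ b′) (b ∧ a′))
              (K.trans (K.+-cong B≈0 (K.-‿cong (∧-cong {u = b} (λ _ → K.refl) a′≈νa)))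
                (solve 5 (λ a₀ a₁ b₀ b₁ ν → con (0 , 0) :- (b₀ :* (ν :* a₁) :- b₁ :* (ν :* a₀)) := ν :* (a₀ :* b₁ :- a₁ :* b₀))
                  K.refl (a 0F) (a 1F) (b 0F) (b 1F) ν))

  matrix-form : Fin n → ∀ M → RowForm (M 0F) → RowForm (M 1F) → ¬ ¬ (Shear M ⊎ Degenerate M)
  matrix-form i₀ M (zeroable σ row≈0) _ k = k (inj₂ (zero-row σ row≈0))
  matrix-form i₀ M (fixed _ _ _) (zeroable σ row≈0) k = k (inj₂ (degenerate-swap (zero-row σ row≈0)))
  matrix-form i₀ M (line _ _ _ _ _ _) (zeroable σ row≈0) k = k (inj₂ (degenerate-swap (zero-row σ row≈0)))
  matrix-form i₀ M (fixed u u≉0 row₀) (fixed v _ row₁) = fixed-fixed {M} i₀ u v u≉0 row₀ row₁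
  matrix-form i₀ M (fixed u u≉0 row₀) (line i free a b a∧b≉0 row₁) = fixed-line {M} i₀ u u≉0 row₀ i free a b a∧b≉0 row₁
  matrix-form i₀ M (line i free a b a∧b≉0 row₀) (fixed u u≉0 row₁) k =
    fixed-line {M ∘ swap} i₀ u u≉0 row₁ i free a b a∧b≉0 row₀ (k ∘ swap-result)
  matrix-form i₀ M (line i free a b a∧b≉0 row₀) (line i′ free′ a′ b′ a′∧b′≉0 row₁) with i′ Fin.≟ i
  ... | yes ≡.refl = line-line-≡ {M} i₀ i free a b a∧b≉0 row₀ a′ b′ row₁
  ... | no i′≢i    = line-line-≢ {M} i₀ i free a b a∧b≉0 row₀ i′ free′ a′ b′ a′∧b′≉0 row₁ i′≢i

-- Matrix products and the induction along the program.

module MatrixProducts {a b w} (A : CommutativeRing a b) {W : Set w} (label : W → CommutativeRing.Carrier A) where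
  open CommutativeRing A
  open PlaneVectors A public using (_⋆_; _∙_)
  private module S = IntegerRingSolver A

  matrix : (Fin 2 → Fin 2 → W) → Fin 2 → Fin 2 → Carrier
  matrix M k j = label (M k j)

  -- The closing vector `(1, 0)` selects the first vertex of the last layer, the sink.
  column : List (Fin 2 → Fin 2 → W) → Fin 2 → Carrier
  column []       = ⟨ 1# , 0# ⟩
  column (M ∷ Ms) = λ k → matrix M k ∙ column Ms

  row : (Fin 2 → Carrier) → List (Fin 2 → Fin 2 → W) → Fin 2 → Carrier
  row r []       = r
  row r (M ∷ Ms) = row (r ⋆ matrix M) Ms

  ⋆-∙ : ∀ r M u → (r ⋆ M) ∙ u ≈ r ∙ (λ k → M k ∙ u)
  ⋆-∙ r M u = S.solve 8 (λ r₀ r₁ a b c d u₀ u₁ →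
    (r₀ S.:* a S.:+ r₁ S.:* c) S.:* u₀ S.:+ (r₀ S.:* b S.:+ r₁ S.:* d) S.:* u₁ S.:=
    r₀ S.:* (a S.:* u₀ S.:+ b S.:* u₁) S.:+ r₁ S.:* (c S.:* u₀ S.:+ d S.:* u₁)) refl
    (r 0F) (r 1F) (M 0F 0F) (M 0F 1F) (M 1F 0F) (M 1F 1F) (u 0F) (u 1F)

  ∙-congʳ : ∀ r {u u′} → (∀ k → u k ≈ u′ k) → r ∙ u ≈ r ∙ u′
  ∙-congʳ r eq = +-cong (*-congˡ (eq 0F)) (*-congˡ (eq 1F))

  row-column : ∀ r Ms Ns → row r Ms ∙ column Ns ≈ r ∙ column (Ms ++ Ns)
  row-column r []       Ns = refl
  row-column r (M ∷ Ms) Ns = trans (row-column (r ⋆ matrix M) Ms Ns) (⋆-∙ r (matrix M) (column (Ms ++ Ns)))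

  row-++ : ∀ r Ms Ns → row r (Ms ++ Ns) ≡ row (row r Ms) Ns
  row-++ r []       Ns = ≡.refl
  row-++ r (M ∷ Ms) Ns = row-++ (r ⋆ matrix M) Ms Ns

  ∙-scaleˡ : ∀ r (u : Fin 2 → Carrier) g → r ∙ (λ l → u l * g) ≈ (r ∙ u) * g
  ∙-scaleˡ r u g = S.solve 5 (λ r₀ r₁ u₀ u₁ g → r₀ S.:* (u₀ S.:* g) S.:+ r₁ S.:* (u₁ S.:* g) S.:=
    (r₀ S.:* u₀ S.:+ r₁ S.:* u₁) S.:* g) refl (r 0F) (r 1F) (u 0F) (u 1F) g

-- A family of polynomials p|ρ, compatible with specialisation, that stay irreducible and are not of
-- the form f g + γ with f and g affine as long as at most six variables are assigned.
record RobustTarget {c ℓ n} (model : PolynomialModel c ℓ n) : Set (Level.suc (c ⊔ ℓ)) where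
  open PolynomialModel model
  open Specialisations model
  field
    target      : ∀ K → Assignment K n → Ring.Carrier K
    compatible  : ∀ {K K′} {ψ : Embedding K K′} {ρ ρ′} → Agrees {K} {K′} ψ ρ ρ′ →
                  Ring._≈_ K′ (Hom.fun (specialise {K} {K′} ψ ρ′) (target K ρ)) (target K′ ρ′)
    not-product : ∀ {K ρ D} → Supported {K = K} ρ D → length D ≤ 6 → ∀ {f g} γ →
                  DegreeAlgebra.DegreeAtMost (algebra K) 1 f → DegreeAlgebra.DegreeAtMost (algebra K) 1 g →
                  ¬ Ring._≈_ K (target K ρ) (Ring._+_ K (Ring._*_ K f g) (Ring.𝕔 K γ))
    quadratic   : ∀ {K ρ D} → Supported {K = K} ρ D → length D ≤ 6 →
                  ∀ {d} → DegreeAlgebra.HasDegree (algebra K) d (target K ρ) → d ≡ 2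
    irreducible : ∀ {K ρ D} → Supported {K = K} ρ D → length D ≤ 6 → ∀ f g → Ring._≈_ K (target K ρ) (Ring._*_ K f g) →
                  ¬ ¬ ((Σ[ a ∈ Field.Carrier K ] Ring._≈_ K f (Ring.𝕔 K a)) ⊎ (Σ[ a ∈ Field.Carrier K ] Ring._≈_ K g (Ring.𝕔 K a)))

module WeakMatrices {c ℓ n} (model : PolynomialModel c ℓ n) (F : Field c ℓ) where
  open PolynomialModel model
  open Specialisations model

  WeakMatrix : Set c
  WeakMatrix = Fin 2 → Fin 2 → Fin n × Field.Carrier F × Field.Carrier F

  module Programs (K : Field c ℓ) (φ : Field.Carrier F → Field.Carrier K) (ρ : Assignment K n) where
    open Ring K

    label : Fin n × Field.Carrier F × Field.Carrier F → Carrier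
    label (i , α , β) = linear K ρ i (φ α) (φ β)

    open MatrixProducts (ring K) label public

module WidthTwo {c ℓ n} (model : PolynomialModel c ℓ n) (robust : RobustTarget model) (F : Field c ℓ) where
  open PolynomialModel model
  open Specialisations model
  open RobustTarget robust
  open Classification model using (Shear; Degenerate; matrix-form; row-form; entry-form)

  open WeakMatrices model F

  module Shears (K : Field c ℓ) (φ : Field.Carrier F → Field.Carrier K) (ρ : Assignment K n) where
    open Ring K
    open Programs K φ ρ
    open Continuants K (algebra K) using (State; state-const; state-shear; state-misses)
    open Hom (DegreeAlgebra.constant (algebra K)) using () renaming (cong to 𝕔-cong; *-homo to 𝕔-*)

    row-state : ∀ r Ms → All (Shear K ρ ∘ matrix) Ms → State r → ¬ ¬ State (row r Ms)
    row-state r []       []       st k = k st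
    row-state r (M ∷ Ms) (sh ∷ s) st k =
      state-shear G a b G≉0 a∧b≉0 affine
        (λ j → +-cong (*-congˡ {r 0F} (expand 0F j)) (*-congˡ {r 1F} (expand 1F j))) st
        λ st′ → row-state (r ⋆ matrix M) Ms s st′ k
      where
      open Shear K ρ sh
      open DegreeAlgebra (algebra K) using (DegreeAtMost; atMost-*; atMost-const)
      affine : DegreeAtMost 1 (𝕔 ε * point K ρ index)
      affine = atMost-* (atMost-const ε) (affine-point K ρ index)

    -- The invariant `State` starts at the constant vector `v` and passes every shear;
    -- `state-misses` then excludes every constant combination of the result.
    shears-miss-target : ∀ {D} → Supported {K = K} ρ D → length D ≤ 6 → ∀ v Ms → All (Shear K ρ ∘ matrix) Ms → ∀ u →
      ¬ target K ρ ≈ row (𝕔 ∘ v) Ms ∙ (𝕔 ∘ u)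
    shears-miss-target supported D≤6 v Ms shears u eq = state-const v λ st → row-state (𝕔 ∘ v) Ms shears st λ st′ →
      state-misses (λ {f} {g} → not-product supported D≤6 {f} {g}) (quadratic supported D≤6) u st′ eq

  module _ {K K′ : Field c ℓ} (φ : Field.Carrier F → Field.Carrier K) {ψ : Embedding K K′} {ρ : Assignment K n} {ρ′ : Assignment K′ n}
           (agrees : Agrees {K} {K′} ψ ρ ρ′) where
    private
      module K = Field K
      module K′ = Field K′
      module P = Programs K φ ρ
      module P′ = Programs K′ (Hom.fun ψ ∘ φ) ρ′
      θ : Hom (ring K) (ring K′)
      θ = specialise {K} {K′} ψ ρ′
    open Ring K′
    open Hom θ using () renaming (fun to apply; cong to apply-cong; +-homo to apply-+; *-homo to apply-*; 0-homo to apply-0; 1-homo to apply-1)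
    open Hom ψ using () renaming (fun to embed; cong to embed-cong; +-homo to embed-+; *-homo to embed-*; -‿homo to embed-neg; 1-homo to embed-1)

    specialise-matrix : ∀ M k j → apply (P.matrix M k j) ≈ P′.matrix M k j
    specialise-matrix M k j = specialise-linear {K} {K′} {ψ} {ρ} {ρ′} agrees _ _ _

    specialise-∙ : ∀ {r u r′ u′} → (∀ j → apply (r j) ≈ r′ j) → (∀ j → apply (u j) ≈ u′ j) → apply (r P.∙ u) ≈ r′ P′.∙ u′
    specialise-∙ r≈ u≈ = trans (apply-+ _ _) (+-cong
      (trans (apply-* _ _) (*-cong (r≈ 0F) (u≈ 0F))) (trans (apply-* _ _) (*-cong (r≈ 1F) (u≈ 1F))))

    specialise-column : ∀ Ms k → apply (P.column Ms k) ≈ P′.column Ms k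
    specialise-column []       0F = apply-1
    specialise-column []       1F = apply-0
    specialise-column (M ∷ Ms) k  = specialise-∙ (specialise-matrix M k) (specialise-column Ms)

    specialise-row : ∀ {r r′} Ms → (∀ j → apply (r j) ≈ r′ j) → ∀ k → apply (P.row r Ms k) ≈ P′.row r′ Ms k
    specialise-row []       r≈ k = r≈ k
    specialise-row (M ∷ Ms) r≈ k = specialise-row Ms (λ j → specialise-∙ r≈ (λ l → specialise-matrix M l j)) k

    embed-≉0 : ∀ {x} → ¬ x K.≈ K.0# → ¬ embed x K′.≈ K′.0#
    embed-≉0 {x} x≉0 ψx≈0 = let (y , xy≈1) = K.inverse x x≉0 in K′.1≉0
      (K′.trans (K′.sym (K′.trans (embed-cong xy≈1) embed-1)) (K′.trans (embed-* x y) (K′.trans (K′.*-congʳ ψx≈0) (K′.zeroˡ _))))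

    embed-∧ : ∀ x y → embed (Plane._∧_ K x y) K′.≈ Plane._∧_ K′ (embed ∘ x) (embed ∘ y)
    embed-∧ x y = K′.trans (embed-+ _ _) (K′.+-cong (embed-* _ _) (K′.trans (embed-neg _) (K′.-‿cong (embed-* _ _))))

    specialise-const : ∀ x → apply (Ring.𝕔 K x) ≈ 𝕔 (embed x)
    specialise-const = subst-const ψ _

    -- The variable of the shear may be among the newly assigned ones, which `Shear` permits. Both
    -- determinants stay nonzero because homomorphisms of fields are injective.
    specialise-shear : ∀ M → Shear K ρ (P.matrix M) → Shear K′ ρ′ (P′.matrix M)
    specialise-shear M sh = record
      { ε = embed ε ; index = index ; G = λ k → embed ∘ G k ; a = embed ∘ a ; b = embed ∘ b
      ; G≉0 = λ eq → embed-≉0 G≉0 (K′.trans (embed-∧ (G 0F) (G 1F)) eq)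
      ; a∧b≉0 = λ eq → embed-≉0 a∧b≉0 (K′.trans (embed-∧ a b) eq)
      ; expand = λ k j → trans (sym (specialise-matrix M k j)) (trans (apply-cong (expand k j))
          (trans (apply-+ _ _) (+-cong
            (trans (apply-* _ _) (*-cong (const (G k 0F)) (const (a j))))
            (trans (apply-* _ _) (*-cong (const (G k 1F)) (trans (apply-+ _ _) (+-cong
              (trans (apply-* _ _) (*-cong (trans (apply-* _ _) (*-cong (const ε)
                (specialise-point {K} {K′} {ψ} {ρ} {ρ′} agrees index))) (const (a j))))
              (const (b j)))))))))
      }
      where
      open Shear K ρ sh
      const = specialise-const

  open DecMembership (Fin._≟_ {n}) using (_∈?_)

  variables : WeakMatrix → List (Fin n)
  variables M = proj₁ (M 0F 0F) ∷ proj₁ (M 0F 1F) ∷ proj₁ (M 1F 0F) ∷ proj₁ (M 1F 1F) ∷ []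

  variable∈ : ∀ M k j → proj₁ (M k j) ∈ variables M
  variable∈ M 0F 0F = here ≡.refl
  variable∈ M 0F 1F = there (here ≡.refl)
  variable∈ M 1F 0F = there (there (here ≡.refl))
  variable∈ M 1F 1F = there (there (there (here ≡.refl)))

  matrix-form-of : ∀ K φ ρ M → ¬ ¬ (Shear K ρ (Programs.matrix K φ ρ M) ⊎ Degenerate K ρ (Programs.matrix K φ ρ M))
  matrix-form-of K φ ρ M k =
    form 0F λ row₀ → form 1F λ row₁ → matrix-form K ρ (proj₁ (M 0F 0F)) (matrix M) row₀ row₁ k
    where
    open Programs K φ ρ
    form : ∀ l → ¬ ¬ Classification.RowForm model K ρ (matrix M l)
    form l k = entry-form K ρ _ _ _ (Ring.refl K) λ e₀ → entry-form K ρ _ _ _ (Ring.refl K) λ e₁ →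
      row-form K ρ (matrix M l) e₀ e₁ k

  restrict : ∀ {K : Field c ℓ} → List (Fin n) → Assignment K n → Assignment K n
  restrict D ρ i with i ∈? D
  ... | yes _ = ρ i
  ... | no _  = nothing

  -- Variables of `D` that `ρ` leaves free get the arbitrary value 0, so that a matrix with all its
  -- variables in `D` becomes constant.
  totalise : ∀ {K : Field c ℓ} → List (Fin n) → Assignment K n → Assignment K n
  totalise {K} D ρ i with i ∈? D
  ... | yes _ = just (maybe (λ s → s) (Field.0# K) (ρ i))
  ... | no _  = nothing

  module _ {K : Field c ℓ} (D : List (Fin n)) (ρ : Assignment K n) where
    restrict-∈ : ∀ {i} → i ∈ D → restrict {K} D ρ i ≡ ρ i
    restrict-∈ {i} i∈D with i ∈? D
    ... | yes _   = ≡.refl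
    ... | no i∉D  = ⊥-elim (i∉D i∈D)

    totalise-∈ : ∀ {i} → i ∈ D → Σ[ s ∈ Field.Carrier K ] totalise {K} D ρ i ≡ just s
    totalise-∈ {i} i∈D with i ∈? D
    ... | yes _   = _ , ≡.refl
    ... | no i∉D  = ⊥-elim (i∉D i∈D)

    restrict-supported : Supported {K = K} (restrict {K} D ρ) D
    restrict-supported i with i ∈? D
    ... | yes i∈D = inj₁ i∈D
    ... | no _    = inj₂ ≡.refl

    totalise-supported : Supported {K = K} (totalise {K} D ρ) D
    totalise-supported i with i ∈? D
    ... | yes i∈D = inj₁ i∈D
    ... | no _    = inj₂ ≡.refl

    restrict-agrees : Agrees {K} {K} (idᵉ {K}) (restrict {K} D ρ) ρ
    restrict-agrees i s eq with i ∈? D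
    ... | yes _ = s , eq , Field.refl K
    restrict-agrees i s () | no _

    restrict-totalise : Agrees {K} {K} (idᵉ {K}) (restrict {K} D ρ) (totalise {K} D ρ)
    restrict-totalise i s eq with i ∈? D
    ... | yes _ = s , ≡.cong (λ r → just (maybe (λ s → s) (Field.0# K) r)) eq , Field.refl K
    restrict-totalise i s () | no _

  module _ (Ms : List WeakMatrix)
           (computes : ∀ K (φ : Embedding F K) ρ → Ring._≈_ K (target K ρ) (Programs.column K (Hom.fun φ) ρ Ms 0F)) where

    private
      e₀ : ∀ K → Fin 2 → Ring.Carrier K
      e₀ K = ⟨ Ring.1# K , Ring.0# K ⟩

      -- The program can be cut anywhere and under any assignment, in particular under one that
      -- forgets earlier values.
      factor : ∀ K (φ : Embedding F K) ρ pre rest → pre ++ rest ≡ Ms →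
        Ring._≈_ K (target K ρ) (Programs._∙_ K (Hom.fun φ) ρ (Programs.row K (Hom.fun φ) ρ (e₀ K) pre) (Programs.column K (Hom.fun φ) ρ rest))
      factor K φ ρ pre rest ≡.refl = trans (computes K φ ρ)
        (sym (trans (row-column (e₀ K) pre rest) (trans (+-cong (*-identityˡ _) (zeroˡ _)) (+-identityʳ _))))
        where
        open Ring K
        open Programs K (Hom.fun φ) ρ

      -- Every weak matrix of the list is a shear or degenerates to rank one after assigning at most two
      -- more variables, and then the target, being irreducible, is computed by what comes before or
      -- after it.  In the former case only shears are left; in the latter case the remaining program
      -- is shorter, and all variables of the matrix may be assigned.
      refute : ∀ rest pre → pre ++ rest ≡ Ms → ∀ K (φ : Embedding F K) ρ D → Supported {K = K} ρ D → length D ≤ 4 →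
        ∀ v mid → All (Shear K ρ ∘ Programs.matrix K (Hom.fun φ) ρ) mid →
        ¬ Ring._≈_ K (target K ρ) (Programs._∙_ K (Hom.fun φ) ρ
            (Programs.row K (Hom.fun φ) ρ (Ring.𝕔 K ∘ v) mid) (Programs.column K (Hom.fun φ) ρ rest))
      refute [] pre _ K φ ρ D supported D≤4 v mid shears eq =
        Shears.shears-miss-target K (Hom.fun φ) ρ supported (ℕ.≤-trans D≤4 (ℕ.m≤m+n 4 2)) v mid shears ⟨ K.1# , K.0# ⟩
          (trans eq (∙-congʳ (row (𝕔 ∘ v) mid) {⟨ 1# , 0# ⟩} {𝕔 ∘ ⟨ K.1# , K.0# ⟩} λ { 0F → sym 1-homo ; 1F → sym 0-homo }))
        where
        module K = Field K
        open Ring K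
        open Programs K (Hom.fun φ) ρ
        open Hom (DegreeAlgebra.constant (algebra K)) using (0-homo; 1-homo)
      refute (M ∷ rest) pre pre++rest K φ ρ D supported D≤4 v mid shears eq =
        matrix-form-of K (Hom.fun φ) ρ M λ { (inj₁ shear) → append shear ; (inj₂ degenerate) → split degenerate }
        where
        pre′ : (pre ++ [ M ]) ++ rest ≡ Ms
        pre′ = ≡.trans (List.++-assoc pre [ M ] rest) pre++rest

        append : Shear K ρ (Programs.matrix K (Hom.fun φ) ρ M) → ⊥
        append shear = refute rest (pre ++ [ M ]) pre′ K φ ρ D supported D≤4 v (mid ++ [ M ]) (All.++⁺ shears (shear ∷ []))
          (trans eq (trans (sym (⋆-∙ (row (𝕔 ∘ v) mid) (matrix M) (column rest)))
            (reflexive (≡.cong (_∙ column rest) (≡.sym (row-++ (𝕔 ∘ v) mid [ M ]))))))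
          where
          open Ring K
          open Programs K (Hom.fun φ) ρ

        split : Degenerate K ρ (Programs.matrix K (Hom.fun φ) ρ M) → ⊥
        split degenerate = irreducible restricted (ℕ.m≤m+n 4 2) f g factored λ
          { (inj₁ (γ , f≈γ)) → prefix-constant γ f≈γ
          ; (inj₂ (γ , g≈γ)) → suffix-constant γ g≈γ }
          where
          open Degenerate K ρ degenerate using (pivot; rank-1; assigned; at-most-2; unchanged)
            renaming (field′ to K′; embedding to ψ; assignment to ρ′; agrees to ρ⊑ρ′; column to u)
          open Ring K′
          module K′ = Field K′
          module C = Hom (DegreeAlgebra.constant (algebra K′))
          φ′ = ψ ∘ʰ φ
          V = variables M
          -- Only variables of `M` stay assigned, so irreducibility is applied with at most four
          -- values, whatever `D` was.
          σ = restrict {K′} V ρ′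
          τ = totalise {K′} V ρ′
          restricted = restrict-supported {K′} V ρ′
          module P = Programs K′ (Hom.fun φ′)
          module Pρ′ = Programs K′ (Hom.fun φ′) ρ′
          module Pσ = Programs K′ (Hom.fun φ′) σ
          module Pτ = Programs K′ (Hom.fun φ′) τ
          σ⊑ρ′ = restrict-agrees {K′} V ρ′
          σ⊑τ = restrict-totalise {K′} V ρ′

          -- `M` mentions only variables in `V`, where `σ` and `ρ′` agree, so the rank-one
          -- factorisation survives the forgetting.
          same-label : ∀ l j → Pσ.matrix M l j ≡ Pρ′.matrix M l j
          same-label l j = ≡.cong (λ r → 𝕔 _ * maybe 𝕔 (var K′ _) r + 𝕔 _) (restrict-∈ {K′} V ρ′ (variable∈ M l j))

          rank-1-ρ′ : ∀ l j → Pρ′.matrix M l j ≈ 𝕔 (u l) * Pρ′.matrix M pivot j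
          rank-1-ρ′ l j = trans (sym (specialise-matrix {K} {K′} (Hom.fun φ) ρ⊑ρ′ M l j))
            (trans (rank-1 l j) (*-congˡ (specialise-matrix {K} {K′} (Hom.fun φ) ρ⊑ρ′ M pivot j)))

          rank-1-σ : ∀ l j → Pσ.matrix M l j ≈ 𝕔 (u l) * Pσ.matrix M pivot j
          rank-1-σ l j = trans (reflexive (same-label l j)) (trans (rank-1-ρ′ l j) (*-congˡ (reflexive (≡.sym (same-label pivot j)))))

          f g : Carrier
          f = Pσ.row (e₀ K′) pre Pσ.∙ (𝕔 ∘ u)
          g = Pσ.column (M ∷ rest) pivot

          pull : ∀ l x y z w s t → x ≈ 𝕔 (u l) * z → y ≈ 𝕔 (u l) * w → x * s + y * t ≈ 𝕔 (u l) * (z * s + w * t)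
          pull l x y z w s t x≈ y≈ = trans (+-cong (*-congʳ x≈) (*-congʳ y≈))
            (trans (+-cong (*-assoc _ _ _) (*-assoc _ _ _)) (sym (distribˡ _ _ _)))

          column-rank-1 : ∀ ρ″ → (∀ l j → P.matrix ρ″ M l j ≈ 𝕔 (u l) * P.matrix ρ″ M pivot j) →
            ∀ l → P.column ρ″ (M ∷ rest) l ≈ 𝕔 (u l) * P.column ρ″ (M ∷ rest) pivot
          column-rank-1 ρ″ r1 l = pull l _ _ _ _ _ _ (r1 l 0F) (r1 l 1F)

          factored : target K′ σ ≈ f * g
          factored = trans (factor K′ φ′ σ pre (M ∷ rest) pre++rest)
            (trans (Pσ.∙-congʳ (Pσ.row (e₀ K′) pre) (column-rank-1 σ rank-1-σ)) (Pσ.∙-scaleˡ (Pσ.row (e₀ K′) pre) (𝕔 ∘ u) g))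

          -- `ρ′` extends `σ`, so `g` is constant under it as well. From `M` on the program is then
          -- the constant vector `u γ`, and only the shears `mid` remain, with the variables of `D`
          -- and at most two new ones assigned.
          suffix-constant : ∀ γ → g ≈ 𝕔 γ → ⊥
          suffix-constant γ g≈γ = Shears.shears-miss-target K′ (Hom.fun φ′) ρ′ {D ++ assigned} supported′ D≤6 (Hom.fun ψ ∘ v) mid
            (All.map (λ {N} → specialise-shear {K} {K′} (Hom.fun φ) {ψ} {ρ} {ρ′} ρ⊑ρ′ N) shears) (λ l → u l K′.* γ)
            (trans (sym (compatible {K} {K′} {ψ} {ρ} {ρ′} ρ⊑ρ′)) (trans (Hom.cong (specialise {K} {K′} ψ ρ′) eq)
              (trans (specialise-∙ {K} {K′} (Hom.fun φ) ρ⊑ρ′ (specialise-row {K} {K′} (Hom.fun φ) ρ⊑ρ′ mid (specialise-const {K} {K′} (Hom.fun φ) ρ⊑ρ′ ∘ v))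
                  (specialise-column {K} {K′} (Hom.fun φ) ρ⊑ρ′ (M ∷ rest)))
                (Pρ′.∙-congʳ (Pρ′.row (𝕔 ∘ Hom.fun ψ ∘ v) mid) λ l → trans (column-rank-1 ρ′ rank-1-ρ′ l)
                  (trans (*-congˡ g-ρ′≈γ) (sym (C.*-homo _ _)))))))
            where
            g-ρ′≈γ : Pρ′.column (M ∷ rest) pivot ≈ 𝕔 γ
            g-ρ′≈γ = trans (sym (specialise-column {K′} {K′} (Hom.fun φ′) σ⊑ρ′ (M ∷ rest) pivot))
              (trans (Hom.cong (specialise {K′} {K′} (idᵉ {K′}) ρ′) g≈γ) (specialise-const {K′} {K′} (Hom.fun φ′) σ⊑ρ′ γ))
            D≤6 : length (D ++ assigned) ≤ 6
            D≤6 = ℕ.≤-trans (ℕ.≤-reflexive (List.length-++ D)) (ℕ.+-mono-≤ D≤4 at-most-2)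
            supported′ : Supported {K = K′} ρ′ (D ++ assigned)
            supported′ i with unchanged i | supported i
            ... | inj₁ i∈assigned | _         = inj₁ (∈.∈-++⁺ʳ D i∈assigned)
            ... | inj₂ _          | inj₁ i∈D  = inj₁ (∈.∈-++⁺ˡ i∈D)
            ... | inj₂ still-free | inj₂ free = inj₂ (still-free free)

          -- Under `σ` the target is `γ g`. Assigning all of `V` turns the pivot row of `M` into a
          -- constant vector, from which `rest` starts afresh: no shears yet, and `V` in place of
          -- the old `D`.
          prefix-constant : ∀ γ → f ≈ 𝕔 γ → ⊥
          prefix-constant γ f≈γ = refute rest (pre ++ [ M ]) pre′ K′ φ′ τ V (totalise-supported {K′} V ρ′) ℕ.≤-refl
            (λ j → γ K′.* value j) [] []
            (trans (sym (compatible {K′} {K′} {idᵉ {K′}} {σ} {τ} σ⊑τ)) (trans (Hom.cong θ (trans factored (*-congʳ f≈γ)))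
              (trans (Hom.*-homo θ _ _) (trans (*-cong (specialise-const {K′} {K′} (Hom.fun φ′) σ⊑τ γ) (specialise-column {K′} {K′} (Hom.fun φ′) σ⊑τ (M ∷ rest) pivot))
                (trans (distribˡ _ _ _) (+-cong (absorb 0F) (absorb 1F)))))))
            where
            θ = specialise {K′} {K′} (idᵉ {K′}) τ
            value : Fin 2 → K′.Carrier
            value j = Hom.fun φ′ (proj₁ (proj₂ (M pivot j))) K′.* proj₁ (totalise-∈ {K′} V ρ′ (variable∈ M pivot j))
                        K′.+ Hom.fun φ′ (proj₂ (proj₂ (M pivot j)))
            absorb : ∀ j → 𝕔 γ * (Pτ.matrix M pivot j * Pτ.column rest j) ≈ 𝕔 (γ K′.* value j) * Pτ.column rest j
            absorb j = trans (sym (*-assoc _ _ _)) (*-congʳ (trans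
              (*-congˡ (linear-assigned {K′} {τ} (proj₂ (totalise-∈ {K′} V ρ′ (variable∈ M pivot j))) _ _)) (sym (C.*-homo _ _))))

    not-computable : ⊥
    not-computable = refute Ms [] ≡.refl F (idᵉ {F}) (λ _ → nothing) [] (λ _ → inj₂ ≡.refl) z≤n
      ⟨ Field.1# F , Field.0# F ⟩ [] []
      (trans (computes F (idᵉ {F}) _) (sym (trans (+-cong (trans (*-congʳ 1-homo) (*-identityˡ _)) (trans (*-congʳ 0-homo) (zeroˡ _))) (+-identityʳ _))))
      where
      open Ring F
      open Hom (DegreeAlgebra.constant (algebra F)) using (0-homo; 1-homo)

-- Double sums, and the abstract interfaces instantiated with polynomials.

module SumsOverPairs {a b} (A : CommutativeRing a b) where
  open CommutativeRing A hiding (zero)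
  open Sums A

  ∑-+ : ∀ k {l} (t : Fin (k ℕ.+ l) → Carrier) → ∑ t ≈ ∑ (λ i → t (i ↑ˡ l)) + ∑ (λ i → t (k ↑ʳ i))
  ∑-+ zero    t = sym (+-identityˡ _)
  ∑-+ (suc k) {l} t = trans (reflexive (∑-suc {k ℕ.+ l} t)) (trans (+-congˡ (∑-+ k {l} (t ∘ suc)))
    (trans (sym (+-assoc _ _ _)) (+-congʳ (sym (reflexive (∑-suc (λ i → t (i ↑ˡ l))))))))

  ∑-combine : ∀ k l (t : Fin (k ℕ.* l) → Carrier) → ∑ t ≈ ∑ (λ (i : Fin k) → ∑ (λ (j : Fin l) → t (combine i j)))
  ∑-combine zero    l t = refl
  ∑-combine (suc k) l t = trans (∑-+ l {k ℕ.* l} t) (trans (+-congˡ (∑-combine k l (λ (i : Fin (k ℕ.* l)) → t (l ↑ʳ i))))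
    (sym (reflexive (∑-suc (λ (i : Fin (suc k)) → ∑ (λ (j : Fin l) → t (combine i j)))))))

polynomialAlgebra : ∀ {c ℓ} (K : Field c ℓ) → ℕ → DegreeAlgebra K
polynomialAlgebra K n = record
  { ring = polynomialRing ; constant = constant
  ; HasDegree = HasDegree ; DegreeAtMost = DegreeAtMost
  ; hasDegree-cong = hasDegree-cong ; hasDegree-const = hasDegree-const
  ; hasDegree-* = hasDegree-* ; hasDegree-+ = hasDegree-+ ; hasDegree⇒atMost = hasDegree⇒atMost
  ; atMost-cong = atMost-cong ; atMost-mono = atMost-mono ; atMost-const = atMost-const
  ; atMost-+ = atMost-+ ; atMost-* = atMost-* ; affine-cases = affine-cases }
  where
  open Degree K n
  open PolynomialRing K n

polynomialModel : ∀ c ℓ n → PolynomialModel c ℓ n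
polynomialModel c ℓ n = record
  { algebra = λ K → polynomialAlgebra K n
  ; var = λ K → Polynomials.var K
  ; atMost-var = λ K → Degree.atMost-var K n
  ; substitution = λ {K} {K′} ψ → Evaluation.evaluation K (PolynomialRing.polynomialRing K′ n) (PolynomialRing.constant K′ n ∘ʰ ψ)
  ; subst-const = λ {K} {K′} ψ → Evaluation.eval-const K (PolynomialRing.polynomialRing K′ n) (PolynomialRing.constant K′ n ∘ʰ ψ)
  ; subst-var = λ {K} {K′} ψ → Evaluation.eval-var K (PolynomialRing.polynomialRing K′ n) (PolynomialRing.constant K′ n ∘ʰ ψ)
  }

module _ {c ℓ a b} (K : Field c ℓ) (A : CommutativeRing a b) (θ : Hom (PolynomialRing.polynomialRing K 28) A) where
  open CommutativeRing A hiding (zero)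
  open Hom θ
  open Sums A using (∑; ∑-cong)
  open Polynomials K

  -- The common image of `p` and of its restrictions under homomorphisms, in terms of the images of
  -- the variables. Comparing both through it avoids expanding products in 28 variables.
  sumOfProducts : (Fin 28 → Carrier) → Carrier
  sumOfProducts e = row 0F * row 1F + row 2F * row 3F
    where
    row : Fin 4 → Carrier
    row r = ∑ (λ (j : Fin 7) → e (combine r j))

  private
    row-homo : ∀ (t : Fin 28 → Poly 28) (e : Fin 28 → Carrier) → (∀ i → fun (t i) ≈ e i) → ∀ (r : Fin 4) →
      fun (Σₚ (λ (j : Fin 7) → t (combine r j))) ≈ ∑ (λ (j : Fin 7) → e (combine r j))
    row-homo t e θ-t r = trans (∑-homo θ (λ (j : Fin 7) → t (combine r j))) (∑-cong (λ (j : Fin 7) → θ-t (combine r j)))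

    products-homo : ∀ u v w z {u′ v′ w′ z′} → fun u ≈ u′ → fun v ≈ v′ → fun w ≈ w′ → fun z ≈ z′ →
      fun (u *ₚ v +ₚ w *ₚ z) ≈ u′ * v′ + w′ * z′
    products-homo u v w z u≈ v≈ w≈ z≈ = trans (+-homo (u *ₚ v) (w *ₚ z))
      (+-cong (trans (*-homo u v) (*-cong u≈ v≈)) (trans (*-homo w z) (*-cong w≈ z≈)))

  target-homo : ∀ ρ e → (∀ i → fun (Restriction.point K ρ i) ≈ e i) → fun (Restriction.target K ρ) ≈ sumOfProducts e
  target-homo ρ e θ-point = products-homo (rowₚ 0F) (rowₚ 1F) (rowₚ 2F) (rowₚ 3F) (row 0F) (row 1F) (row 2F) (row 3F)
    where
    open Restriction K ρ
    row = row-homo point e θ-point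

  p-homo : ∀ e → (∀ i → fun (var i) ≈ e i) → Hom.fun θ (Theorem5p4Poly.p K) ≈ sumOfProducts e
  p-homo e θ-var = products-homo (rowSum (Fin.# 0)) (rowSum (Fin.# 1)) (rowSum (Fin.# 2)) (rowSum (Fin.# 3)) (row 0F) (row 1F) (row 2F) (row 3F)
    where
    open Theorem5p4Poly K
    row = row-homo var e θ-var

module _ {c ℓ : Level} where
  private
    model = polynomialModel c ℓ 28
  open PolynomialModel model using (ring)
  open Specialisations model

  robustTarget : RobustTarget model
  robustTarget = record
    { target = λ K ρ → Restriction.target K ρ
    ; compatible = λ {K} {K′} {ψ} {ρ} {ρ′} agrees →
        target-homo K (ring K′) (specialise {K} {K′} ψ ρ′) ρ (Restriction.point K′ ρ′) (specialise-point {K} {K′} {ψ} {ρ} {ρ′} agrees)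
    ; not-product = λ {K} {ρ} {D} supported D≤6 → RestrictedTarget.target-not-product K ρ (row-has-free-variable {K = K} {ρ} {D} supported D≤6)
    ; quadratic = λ {K} {ρ} {D} supported D≤6 → RestrictedTarget.target-degree K ρ (row-has-free-variable {K = K} {ρ} {D} supported D≤6)
    ; irreducible = λ {K} {ρ} {D} supported D≤6 → RestrictedTarget.target-irreducible K ρ (row-has-free-variable {K = K} {ρ} {D} supported D≤6)
    }

-- From weak programs of width two to lists of 2 × 2 matrices.

pad : ∀ {a} {A : Set a} {m} → (Fin m → A) → A → Fin 2 → A
pad {m = 0}           f z _  = z
pad {m = 1}           f z 0F = f 0F
pad {m = 1}           f z 1F = z
pad {m = suc (suc _)} f z 0F = f 0F
pad {m = suc (suc _)} f z 1F = f 1F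

pad-inject : ∀ {a} {A : Set a} {m} (f : Fin m → A) z (m≤2 : m ≤ 2) v → pad f z (Fin.inject≤ v m≤2) ≡ f v
pad-inject {m = 1} f z _ 0F = ≡.refl
pad-inject {m = 2} f z _ 0F = ≡.refl
pad-inject {m = 2} f z _ 1F = ≡.refl
pad-inject {m = suc (suc (suc _))} f z (s≤s (s≤s ())) _

width-bound : ∀ {a} {A : Set a} {w m} {L : Layers A m} → LayersWidth≤ w L → m ≤ w
width-bound (sinkLayer 1≤w)   = 1≤w
width-bound (nextLayer m≤w _) = m≤w

module WeakPrograms {c ℓ} (F : Field c ℓ) (n : ℕ) (i₀ : Fin n) where
  private module F = Field F
  open Polynomials F
  open PolynomialRing F n using (polynomialRing)
  open ABPs F

  -- A weak label always names a variable, so the label of a missing edge names `i₀` with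
  -- coefficient zero.
  zeroForm : WeakForm n
  zeroForm = i₀ , F.0# , F.0#

  padded : ∀ {m k} → (Fin m → Fin k → WeakForm n) → Fin 2 → Fin 2 → WeakForm n
  padded E l j = pad (λ v → pad (E v) zeroForm j) zeroForm l

  matrices : ∀ {m} → Layers (WeakForm n) m → List (Fin 2 → Fin 2 → WeakForm n)
  matrices sinkLayer         = []
  matrices (nextLayer k E L) = padded E ∷ matrices L

  module _ {a b} (A : CommutativeRing a b) (θ : Hom polynomialRing A) (label : WeakForm n → CommutativeRing.Carrier A)
           (label-value : ∀ w → CommutativeRing._≈_ A (Hom.fun θ ⟦ w ⟧ʷ) (label w))
           (label-zeroForm : CommutativeRing._≈_ A (label zeroForm) (CommutativeRing.0# A)) where
    open CommutativeRing A hiding (zero)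
    open Hom θ
    open Sums A using (∑; ∑-cong)
    open MatrixProducts A label

    ∑-pad : ∀ {k} (k≤2 : k ≤ 2) (f : Fin k → WeakForm n) (u : Fin 2 → Carrier) →
      ∑ (λ v → label (f v) * u (Fin.inject≤ v k≤2)) ≈ (λ j → label (pad f zeroForm j)) ∙ u
    ∑-pad {0} _ f u = sym (trans (+-cong (vanish 0F) (vanish 1F)) (+-identityʳ 0#))
      where
      vanish : ∀ j → label zeroForm * u j ≈ 0#
      vanish j = trans (*-congʳ label-zeroForm) (zeroˡ (u j))
    ∑-pad {1} (s≤s _) f u = +-congˡ (sym (trans (*-congʳ label-zeroForm) (zeroˡ (u 1F))))
    ∑-pad {2} (s≤s (s≤s _)) f u = +-congˡ (+-identityʳ (label (f 1F) * u 1F))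
    ∑-pad {suc (suc (suc _))} (s≤s (s≤s ())) f u

    -- Padding only adds edges labelled zero, and existing vertices keep their positions. Working
    -- with images under `θ` lets one induction serve every specialisation of the program.
    pathSum-value : ∀ {m} {L : Layers (WeakForm n) m} (width : LayersWidth≤ 2 L) (m≤2 : m ≤ 2) v →
      fun (pathSum ⟦_⟧ʷ L v) ≈ column (matrices L) (Fin.inject≤ v m≤2)
    pathSum-value (sinkLayer _) (s≤s _) 0F = 1-homo
    pathSum-value (nextLayer {k = k} {E} {L} _ width) m≤2 v =
      trans (∑-homo θ (λ w → ⟦ E v w ⟧ʷ *ₚ pathSum ⟦_⟧ʷ L w))
        (trans (∑-cong (λ w → trans (*-homo ⟦ E v w ⟧ʷ (pathSum ⟦_⟧ʷ L w))
            (*-cong (label-value (E v w)) (pathSum-value width (width-bound width) w))))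
          (trans (∑-pad (width-bound width) (E v) (column (matrices L)))
            (+-cong (*-congʳ (label-padded 0F)) (*-congʳ (label-padded 1F)))))
      where
      label-padded : ∀ j → label (pad (E v) zeroForm j) ≈ matrix (padded E) (Fin.inject≤ v m≤2) j
      label-padded j = reflexive (≡.cong label (≡.sym (pad-inject (λ v → pad (E v) zeroForm j) zeroForm m≤2 v)))

module WeakLabels {c ℓ} (F K : Field c ℓ) (n : ℕ) (φ : Hom (Field.commutativeRing F) (Field.commutativeRing K))
                  (e : Fin n → Polynomials.Poly K n) where
  private module F = Field F
  open Polynomials F
  open ABPs F
  open PolynomialRing K n using (polynomialRing; constant)
  open CommutativeRing polynomialRing hiding (zero)
  open Evaluation F polynomialRing (constant ∘ʰ φ) {n} using (evaluation; eval-const; eval-var)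
  open Hom (evaluation e)

  label : WeakForm n → Polynomials.Poly K n
  label (i , α , β) = Polynomials.constₚ K (Hom.fun φ α) * e i + Polynomials.constₚ K (Hom.fun φ β)

  label-value : ∀ w → fun ⟦ w ⟧ʷ ≈ label w
  label-value (i , α , β) = trans (+-homo (α ·ₚ var i) (constₚ β))
    (+-cong (trans (*-homo (constₚ α) (var i)) (*-cong (eval-const e α) (eval-var e i))) (eval-const e β))

  label-zero : ∀ i → label (i , F.0# , F.0#) ≈ 0#
  label-zero i = trans (+-cong (trans (*-congʳ const0) (zeroˡ (e i))) const0) (+-identityʳ 0#)
    where
    const0 : Polynomials.constₚ K (Hom.fun φ F.0#) ≈ 0#
    const0 = trans (Hom.cong constant (Hom.0-homo φ)) (Hom.0-homo constant)

column-value : ∀ {c ℓ n} (i₀ : Fin n) (F K : Field c ℓ) (φ : Hom (Field.commutativeRing F) (Field.commutativeRing K))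
  (ρ : Assignment K n) {P} → LayersWidth≤ 2 P →
  PolynomialRing._≋_ K n
    (Hom.fun (Specialisations.specialise (polynomialModel c ℓ n) {F} {K} φ ρ) (ABPs.value F (ABPs.⟦_⟧ʷ F) P))
    (WeakMatrices.Programs.column (polynomialModel c ℓ n) F K (Hom.fun φ) ρ (WeakPrograms.matrices F n i₀ P) 0F)
column-value {c} {ℓ} {n} i₀ F K φ ρ width =
  WeakPrograms.pathSum-value F n i₀ (PolynomialRing.polynomialRing K n) (specialise {F} {K} φ ρ)
    label label-value (label-zero i₀) width (s≤s z≤n) 0F
  where
  open Specialisations (polynomialModel c ℓ n)
  open WeakLabels F K n φ (point K ρ)

-- A program for `p` yields, after every assignment over every extension, a matrix product for the
-- restricted target, as `not-computable` requires.
weak-lower-bound : ∀ {c ℓ n} → Fin n → (robust : RobustTarget (polynomialModel c ℓ n)) (F : Field c ℓ) (p : Polynomials.Poly F n) →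
  (∀ K φ ρ → PolynomialRing._≋_ K n (Hom.fun (Specialisations.specialise (polynomialModel c ℓ n) {F} {K} φ ρ) p)
     (RobustTarget.target robust K ρ)) →
  ¬ ABPs.WeakABPWidth F 2 n p
weak-lower-bound {c} {ℓ} {n} i₀ robust F p p-value (P , width , value≈p) =
  not-computable (WeakPrograms.matrices F n i₀ P) λ K φ ρ →
    CommutativeRing.trans (PolynomialRing.polynomialRing K n)
      (CommutativeRing.sym (PolynomialRing.polynomialRing K n) (value-target K φ ρ)) (column-value i₀ F K φ ρ width)
  where
  open Specialisations (polynomialModel c ℓ n) using (Embedding; specialise)
  open WidthTwo (polynomialModel c ℓ n) robust F using (not-computable)
  value≋p : PolynomialRing._≋_ F n (ABPs.value F (ABPs.⟦_⟧ʷ F) P) p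
  value≋p = PolynomialRing.coefficientwise value≈p
  value-target : ∀ K (φ : Embedding F K) ρ → PolynomialRing._≋_ K n
    (Hom.fun (specialise {F} {K} φ ρ) (ABPs.value F (ABPs.⟦_⟧ʷ F) P)) (RobustTarget.target robust K ρ)
  value-target K φ ρ = CommutativeRing.trans (PolynomialRing.polynomialRing K n)
    (Hom.cong (specialise {F} {K} φ ρ) value≋p) (p-value K φ ρ)

-- The type repeats that of the hypothesis of weak-lower-bound literally, since otherwise the two are
-- compared by expanding p in 28 variables.
p-value : ∀ {c ℓ} (F K : Field c ℓ) (φ : Hom (Field.commutativeRing F) (Field.commutativeRing K)) (ρ : Assignment K 28) →
  PolynomialRing._≋_ K 28 (Hom.fun (Specialisations.specialise (polynomialModel c ℓ 28) {F} {K} φ ρ) (Theorem5p4Poly.p F))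
    (RobustTarget.target robustTarget K ρ)
p-value {c} {ℓ} F K φ ρ = p-homo F (PolynomialRing.polynomialRing K 28) (Specialisations.specialise (polynomialModel c ℓ 28) {F} {K} φ ρ)
  (Specialisations.point (polynomialModel c ℓ 28) K ρ)
  (Evaluation.eval-var F (PolynomialRing.polynomialRing K 28) (PolynomialRing.constant K 28 ∘ʰ φ)
    (Specialisations.point (polynomialModel c ℓ 28) K ρ))

not-weakly-computable : ∀ {c ℓ} (F : Field c ℓ) → ¬ ABPs.WeakABPWidth F 2 28 (Theorem5p4Poly.p F)
not-weakly-computable {c} {ℓ} F = weak-lower-bound {c} {ℓ} {28} 0F robustTarget F (Theorem5p4Poly.p F) (p-value F)

-- The general program of width two.

module GeneralProgram {c ℓ} (F : Field c ℓ) where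
  private module F = Field F
  open Polynomials F
  open ABPs F
  open Theorem5p4Poly F using (x; rowSum; p)
  open PolynomialRing F 28
  open CommutativeRing polynomialRing hiding (zero)
  open Sums polynomialRing
  open SumsOverPairs polynomialRing
  open Hom constant using () renaming (0-homo to const-0)

  indicator : Fin 4 → Fin 4 → F.Carrier
  indicator r r′ with r′ Fin.≟ r
  ... | yes _ = F.1#
  ... | no _  = F.0#

  -- `Fin.quotient` recovers the row from an index built by `combine`.
  rowForm : Fin 4 → AffineForm 28
  rowForm r = Vec.tabulate (λ i → indicator r (Fin.quotient {4} 7 i)) , F.0#

  private
    indicator-own : ∀ r f → constₚ (indicator r r) *ₚ f ≈ f
    indicator-own r f with r Fin.≟ r
    ... | yes _  = *-identityˡ f
    ... | no r≢r = ⊥-elim (r≢r ≡.refl)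

    indicator-other : ∀ {r r′} → ¬ r′ ≡ r → ∀ f → constₚ (indicator r r′) *ₚ f ≈ 0ₚ
    indicator-other {r} {r′} r′≢r f with r′ Fin.≟ r
    ... | yes eq = ⊥-elim (r′≢r eq)
    ... | no _   = trans (*-congʳ {f} const-0) (zeroˡ f)

    -- The sum over all 28 variables is split into rows by `∑-combine`; the indicator coefficients
    -- annihilate every row but one.
    select-row : ∀ r (αs : Vec F.Carrier 28) (y : Fin 28 → Poly 28) →
      (∀ r′ (j : Fin 7) → Vec.lookup αs (combine r′ j) ≡ indicator r r′) →
      ∑ (λ i → Vec.lookup αs i ·ₚ y i) ≈ ∑ (λ (j : Fin 7) → y (combine r j))
    select-row r αs y coefficient = trans (∑-combine 4 7 term) (trans
      (∑-single (λ (r′ : Fin 4) → ∑ (λ (j : Fin 7) → term (combine r′ j))) r λ r′ r′≢r →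
        ∑-zero (λ (j : Fin 7) → term (combine r′ j)) λ j → trans (term-combine r′ j) (indicator-other r′≢r (y (combine r′ j))))
      (∑-cong (λ (j : Fin 7) → trans (term-combine r j) (indicator-own r (y (combine r j))))))
      where
      term : Fin 28 → Poly 28
      term i = Vec.lookup αs i ·ₚ y i
      term-combine : ∀ r′ (j : Fin 7) → term (combine r′ j) ≈ constₚ (indicator r r′) *ₚ y (combine r′ j)
      term-combine r′ j = *-congʳ {y (combine r′ j)} (reflexive (≡.cong constₚ (coefficient r′ j)))

  rowForm-value : ∀ r → ⟦ rowForm r ⟧ᵃ ≈ rowSum r
  rowForm-value r = trans (+-cong (select-row r (proj₁ (rowForm r)) var coefficient) const-0) (+-identityʳ (rowSum r))
    where
    coefficient : ∀ r′ (j : Fin 7) → Vec.lookup (proj₁ (rowForm r)) (combine r′ j) ≡ indicator r r′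
    coefficient r′ j = ≡.trans (Vec.lookup∘tabulate (λ i → indicator r (Fin.quotient {4} 7 i)) (combine r′ j))
      (≡.cong (indicator r ∘ proj₁) (Fin.remQuot-combine {4} {7} r′ j))

  -- Two parallel paths through the two middle vertices, `u v` along the first and `w z` along the
  -- second.
  program : (u v w z : AffineForm 28) → ABP (AffineForm 28)
  program u v w z = nextLayer 2 (λ _ → ⟨ u , w ⟩) (nextLayer 1 (λ l _ → ⟨ v , z ⟩ l) sinkLayer)

  program-value : ∀ u v w z {f g h k} → ⟦ u ⟧ᵃ ≈ f → ⟦ v ⟧ᵃ ≈ g → ⟦ w ⟧ᵃ ≈ h → ⟦ z ⟧ᵃ ≈ k →
    value ⟦_⟧ᵃ (program u v w z) ≈ f *ₚ g +ₚ h *ₚ k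
  program-value u v w z u≈f v≈g w≈h z≈k = +-cong (branch u v u≈f v≈g)
    (trans (+-identityʳ (⟦ w ⟧ᵃ *ₚ (⟦ z ⟧ᵃ *ₚ 1ₚ +ₚ 0ₚ))) (branch w z w≈h z≈k))
    where
    branch : ∀ u v {f g} → ⟦ u ⟧ᵃ ≈ f → ⟦ v ⟧ᵃ ≈ g → ⟦ u ⟧ᵃ *ₚ (⟦ v ⟧ᵃ *ₚ 1ₚ +ₚ 0ₚ) ≈ f *ₚ g
    branch u v {f} {g} u≈f v≈g = *-cong u≈f (trans (+-identityʳ (⟦ v ⟧ᵃ *ₚ 1ₚ)) (trans (*-identityʳ ⟦ v ⟧ᵃ) v≈g))

  private
    computes : ∀ u v w z {f g h k p} → ⟦ u ⟧ᵃ ≈ f → ⟦ v ⟧ᵃ ≈ g → ⟦ w ⟧ᵃ ≈ h → ⟦ z ⟧ᵃ ≈ k →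
      p ≡ f *ₚ g +ₚ h *ₚ k → GeneralABPWidth 2 28 p
    computes u v w z u≈f v≈g w≈h z≈k ≡.refl = program u v w z ,
      nextLayer (s≤s z≤n) (nextLayer (s≤s (s≤s z≤n)) (sinkLayer (s≤s z≤n))) ,
      _≋_.coefficients (program-value u v w z u≈f v≈g w≈h z≈k)

  generally-computable : GeneralABPWidth 2 28 p
  generally-computable = computes (rowForm 0F) (rowForm 1F) (rowForm 2F) (rowForm 3F)
    {rowSum (Fin.# 0)} {rowSum (Fin.# 1)} {rowSum (Fin.# 2)} {rowSum (Fin.# 3)} {p}
    (rowForm-value 0F) (rowForm-value 1F) (rowForm-value 2F) (rowForm-value 3F) ≡.refl

theorem5p4 : ∀ {c ℓ : Level} (F : Field c ℓ) →
    ABPs.GeneralABPWidth F 2 28 (Theorem5p4Poly.p F)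
    × ¬ ABPs.WeakABPWidth F 2 28 (Theorem5p4Poly.p F)
theorem5p4 F = GeneralProgram.generally-computable F , not-weakly-computable F
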